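{- Let $m,n,s,k$ be positive integers with $m+s=n+k$, and let $\mathbf a=(a_1,\ldots,a_s)$, $\mathbf d=(d_1,\ldots,d_m)$, $\mathbf b=(b_1,\ldots,b_k)$, $\mathbf c=(c_1,\ldots,c_n)$ be partitions with $c_i\neq d_j$ for all $i,j$. Let $S,\Delta$, $h,h'$, $c^1\ge\cdots\ge c^{h'}$, $d^1\ge\cdots\ge d^h$, $m_y,t_y,z_y$, $m'_x,t'_x,z'_x$, $\mathbf e$, $\mathbf e'$ be as defined in the context. Then there exists a partition $\mathbf g=(g_1,\ldots,g_{m+s})$ with $\mathbf g\prec''(\mathbf d,\mathbf a)$ and $\mathbf g\prec''(\mathbf c,\mathbf b)$ if and only if both of the following hold: (i) for every $y\in\{1,\ldots,h'\}$ with $t_y\le m_y$, $$\sum_{i=z_y+t_y}^{z_y+m_y}e_i\le \sum_{i=y}^{h'}c^i-\sum_{i\ge z_y+1,\ i\notin\Delta}d_i-\sum_{i=m_y+1}^{s}a_i;$$ (ii) for every $x\in\{1,\ldots,h\}$ with $t'_x\le m'_x$, $$\sum_{i=z'_x+t'_x}^{z'_x+m'_x}e'_i\le \sum_{i=x}^{h}d^i-\sum_{i\ge z'_x+1,\ i\notin S}c_i-\sum_{i=m'_x+1}^{k}b_i.$$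
   Context: A partition is a finite nonincreasing sequence of integers. Empty sums ($\sum_{i=r}^{s}$ with $r>s$) are $0$; for any sequence $y_1,\ldots,y_w$ one sets $y_i=+\infty$ for $i\le0$ and $y_i=-\infty$ for $i>w$. Weak generalized majorization: for partitions $\mathbf d=(d_1,\ldots,d_p)$, $\mathbf a=(a_1,\ldots,a_s)$, $\mathbf g=(g_1,\ldots,g_{p+s})$, put $h_j=\min\{i\mid d_{i-j+1}<g_i\}$ for $j=1,\ldots,s$. We write $\mathbf g\prec''(\mathbf d,\mathbf a)$ if $d_i\ge g_{i+s}$ for $i=1,\ldots,p$; $\sum_{i=h_j+1}^{p+s}g_i\ge\sum_{i=h_j-j+1}^{p}d_i+\sum_{i=j+1}^{s}a_i$ for $j=1,\ldots,s$; and $\sum_{i=1}^{p+s}g_i\ge\sum_{i=1}^p d_i+\sum_{i=1}^s a_i$. $\mathbf e=(e_1,\ldots,e_{m+s})$ is the nonincreasing rearrangement of all entries of $\mathbf d$ and $\mathbf a$, where whenever some $d_i$ equals some $a_j$, all $a$'s of that value are placed before the $d$'s of that value. Similarly $\mathbf e'=(e'_1,\ldots,e'_{n+k})$ is the nonincreasing rearrangement of entries of $\mathbf c$ and $\mathbf b$, with equal $b$'s placed before equal $c$'s. Sets $S\subseteq\{1,\ldots,n\}$, $\Delta\subseteq\{1,\ldots,m\}$ are defined inductively: start with $S=\Delta=\emptyset$ and process all entries of $\mathbf c$ and $\mathbf d$ one at a time, from the smallest value to the largest; among equal entries of $\mathbf c$ (resp. $\mathbf d$) the one with the larger index is processed first.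 All sets and counts below refer to the decisions made so far. If the processed entry is $d_j$: set $q_j=s-\#\{i\in S\mid c_i<d_j\}+\#\{i>j\mid i\notin\Delta\}+1$. If $q_j>s$, put $j\in\Delta$. If $q_j\le s$, let $l\in S$ be the minimal index with $d_j>c_l$, and let $N=\#\{i\mid a_i>c_l\}-s+\#\{i\in S\mid i>l\}-\#\{i\notin\Delta\mid d_i<c_l\}+1$. (a) If $N\ge1$ and the entry $d_j$ of $\mathbf e$ is among the $N$ smallest entries of $\mathbf e$ that are larger than $c_l$, put $j\notin\Delta$. (b) Otherwise put $j\notin\Delta$ if $\sum_{i\in S,\,c_i<d_j}c_i\ge\sum_{i\notin\Delta,\,i>j}d_i+d_j+\sum_{i=q_j+1}^{s}a_i$, and $j\in\Delta$ if not. If the processed entry is $c_j$: dually, set $q'_j=k-\#\{i\in\Delta\mid d_i<c_j\}+\#\{i>j\mid i\notin S\}+1$. If $q'_j>k$, put $j\in S$. If $q'_j\le k$, let $l\in\Delta$ be the minimal index with $c_j>d_l$, and $N'=\#\{i\mid b_i>d_l\}-k+\#\{i\in\Delta\mid i>l\}-\#\{i\notin S\mid c_i<d_l\}+1$. (a) If $N'\ge1$ and the entry $c_j$ of $\mathbf e'$ is among the $N'$ smallest entries of $\mathbf e'$ larger than $d_l$, put $j\notin S$. (b) Otherwise put $j\notin S$ if $\sum_{i\in\Delta,\,d_i<c_j}d_i\ge\sum_{i\notin S,\,i>j}c_i+c_j+\sum_{i=q'_j+1}^{k}b_i$, and $j\in S$ if not. Let $h=|\Delta|$, $h'=|S|$;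 $d^1\ge\cdots\ge d^h$ are the $d_i$ with $i\in\Delta$ and $c^1\ge\cdots\ge c^{h'}$ the $c_i$ with $i\in S$. For $j=1,\ldots,h'$: $m_j=\#\{i\mid a_i>c^j\}$, $t_j=s-(h'-j)+\#\{i\notin\Delta\mid d_i<c^j\}$, $z_j=\#\{i\mid d_i>c^j\}$. For $j=1,\ldots,h$: $m'_j=\#\{i\mid b_i>d^j\}$, $t'_j=k-(h-j)+\#\{i\notin S\mid c_i<d^j\}$, $z'_j=\#\{i\mid c_i>d^j\}$. -}

module Defs where

open import Data.Bool using (Bool; true; false; if_then_else_; not; _∧_; _∨_; T)
open import Data.Nat as ℕ using (ℕ; zero; suc; _∸_; _≡ᵇ_)
open import Data.Integer as Z using (ℤ; +_; -[1+_]; 0ℤ; 1ℤ; _≤ᵇ_)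
open import Data.List as L using (List; []; _∷_; length; map; foldr; upTo; filterᵇ; reverse)
open import Data.Vec as V using (Vec; toList)
open import Data.List.Relation.Unary.Linked using (Linked)
open import Data.Product using (_×_; _,_)
open import Data.Maybe using (Maybe; just; nothing)
open import Data.Empty using (⊥)
open import Data.Unit using (⊤)
open import Relation.Binary.PropositionalEquality using (_≡_)

-- Basic helpers (all indices are 1-based natural numbers)

infix 4 _<ᵇ_
_<ᵇ_ : ℤ → ℤ → Bool
x <ᵇ y = not (y ≤ᵇ x)

IsPartition : ∀ {n} → Vec ℤ n → Set
IsPartition v = Linked Z._≥_ (toList v)

-- 1-based lookup in a list; value outside 1..length is irrelevant (0)
at : List ℤ → ℕ → ℤ
at [] _ = 0ℤ
at (x ∷ xs) zero = 0ℤ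
at (x ∷ xs) (suc zero) = x
at (x ∷ xs) (suc (suc i)) = at xs (suc i)

range : ℕ → ℕ → List ℕ
range r t = map (r ℕ.+_) (upTo (suc t ∸ r))

sumZ : List ℤ → ℤ
sumZ = foldr Z._+_ 0ℤ

sumFT : (ℕ → ℤ) → ℕ → ℕ → ℤ
sumFT f r t = sumZ (map f (range r t))

count : ℕ → (ℕ → Bool) → ℕ
count w p = length (filterᵇ p (range 1 w))

sumWhere : ℕ → (ℕ → Bool) → (ℕ → ℤ) → ℤ
sumWhere w p f = sumZ (map f (filterᵇ p (range 1 w)))

-- least i ∈ {1..w} with p i (fallback: w + 1, never used in the construction)
findMin : ℕ → (ℕ → Bool) → ℕ
findMin w p = go (range 1 w)
  where
  go : List ℕ → ℕ
  go [] = suc w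
  go (i ∷ is) = if p i then i else go is

module Maj (g d a : List ℤ) where
  p s : ℕ
  p = length d
  s = length a

  -- d_{i-j+1} < g_i, with d_x = +∞ for x ≤ 0 and d_x = -∞ for x > p
  test : ℕ → ℕ → Bool
  test j i = if i ℕ.<ᵇ j then false
             else (if p ℕ.<ᵇ (suc i ∸ j) then true
                   else (at d (suc i ∸ j) <ᵇ at g i))

  -- h_j = min { i | d_{i-j+1} < g_i }; i = p + j always qualifies, and for
  -- i ≥ 1 the search can be restricted to 1..p+s.
  hIdx : ℕ → ℕ
  hIdx j = findMin (p ℕ.+ s) (test j)

  record GMaj : Set where
    field
      len  : length g ≡ p ℕ.+ s
      cond1 : ∀ i → 1 ℕ.≤ i → i ℕ.≤ p → at g (i ℕ.+ s) Z.≤ at d i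
      cond2 : ∀ j → 1 ℕ.≤ j → j ℕ.≤ s →
              sumFT (at d) (suc (hIdx j) ∸ j) p Z.+ sumFT (at a) (suc j) s
                Z.≤ sumFT (at g) (suc (hIdx j)) (p ℕ.+ s)
      cond3 : sumFT (at d) 1 p Z.+ sumFT (at a) 1 s Z.≤ sumFT (at g) 1 (p ℕ.+ s)

_≺″_ : ∀ {p s w} → Vec ℤ w → Vec ℤ p × Vec ℤ s → Set
g ≺″ (d , a) = Maj.GMaj (toList g) (toList d) (toList a)

data Status : Set where
  unproc inn out : Status

isIn isOut : Status → Bool
isIn inn = true
isIn _ = false
isOut out = true
isOut _ = false

update : (ℕ → Status) → ℕ → Status → (ℕ → Status)
update f j v i = if i ≡ᵇ j then v else f i

-- Tagged entries of the rearrangement e of (x, α): entries of α come first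
-- among equal values.
data ETag : Set where
  αT xT : ℕ → ETag

mergeE : List ℤ → List ℤ → List ℕ → List ℕ → List ETag
mergeE α x [] js = map xT js
mergeE α x (i ∷ is) [] = map αT (i ∷ is)
mergeE α x (i ∷ is) (j ∷ js) =
  if at x j ≤ᵇ at α i then αT i ∷ mergeE α x is (j ∷ js)
  else xT j ∷ mergeE α x (i ∷ is) js

eTags : List ℤ → List ℤ → List ETag
eTags α x = mergeE α x (range 1 (length α)) (range 1 (length x))

tagVal : List ℤ → List ℤ → ETag → ℤ
tagVal α x (αT i) = at α i
tagVal α x (xT j) = at x j

eSeq : List ℤ → List ℤ → List ℤ
eSeq α x = map (tagVal α x) (eTags α x)

posX : List ETag → ℕ → ℕ
posX [] j = 1
posX (αT _ ∷ ts) j = suc (posX ts j)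
posX (xT i ∷ ts) j = if i ≡ᵇ j then 1 else suc (posX ts j)

-- Σ_{i=q+1}^{|α|} α_i, or nothing when the range contains an index ≤ 0
-- (then the sum is +∞ by the convention α_i = +∞ for i ≤ 0)
tailSum : List ℤ → ℤ → Maybe ℤ
tailSum α (+ q) = just (sumFT (at α) (suc q) (length α))
tailSum α -[1+ _ ] = nothing

-- Decision (true = "put j into the set") for the entry x_j, where
--   (x, y, α, fX, fY) = (d, c, a, Δ, S)   for entries of d, and
--   (x, y, α, fX, fY) = (c, d, b, S, Δ)   for entries of c (dual rule).
decide : (x y α : List ℤ) → (fX fY : ℕ → Status) → ℕ → Bool
decide x y α fX fY j =
  if (+ sα) <ᵇ q then true else ruleAB
  where
  sα = length α
  xj = at x j
  nx = length x
  ny = length y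
  yInLt : ℕ → Bool
  yInLt i = isIn (fY i) ∧ (at y i <ᵇ xj)
  q : ℤ
  q = (+ sα) Z.- (+ count ny yInLt) Z.+ (+ count nx (λ i → (j ℕ.<ᵇ i) ∧ isOut (fX i))) Z.+ 1ℤ
  l : ℕ
  l = findMin ny yInLt
  yl = at y l
  N : ℤ
  N = (+ count sα (λ i → yl <ᵇ at α i)) Z.- (+ sα)
      Z.+ (+ count ny (λ i → isIn (fY i) ∧ (l ℕ.<ᵇ i)))
      Z.- (+ count nx (λ i → isOut (fX i) ∧ (at x i <ᵇ yl))) Z.+ 1ℤ
  tags = eTags α x
  E : ℕ
  E = count (length tags) (λ i → yl <ᵇ at (eSeq α x) i)
  pos : ℕ
  pos = posX tags j
  -- (a): N ≥ 1 and x_j is among the N smallest entries of e larger than y_l,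
  --      i.e. its position lies in E-N+1 .. E
  ruleA : Bool
  ruleA = (1ℤ ≤ᵇ N) ∧ ((((+ E) Z.- N) <ᵇ (+ pos)) ∧ (pos ℕ.≤ᵇ E)) ∧ (yl <ᵇ xj)
  lhsB : ℤ
  lhsB = sumWhere ny yInLt (at y)
  ruleB : Bool
  ruleB with tailSum α q
  ... | nothing = true
  ... | just t = not ((sumWhere nx (λ i → isOut (fX i) ∧ (j ℕ.<ᵇ i)) (at x) Z.+ xj Z.+ t) ≤ᵇ lhsB)
  ruleAB : Bool
  ruleAB = if ruleA then false else ruleB

data Item : Set where
  cI dI : ℕ → Item

-- merge of (c_n, ..., c_1) and (d_m, ..., d_1) in increasing order of value
-- (c and d share no values; within c, larger index first on ties)
mergeP : List ℤ → List ℤ → List ℕ → List ℕ → List Item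
mergeP c d [] js = map dI js
mergeP c d (i ∷ is) [] = map cI (i ∷ is)
mergeP c d (i ∷ is) (j ∷ js) =
  if at c i <ᵇ at d j then cI i ∷ mergeP c d is (j ∷ js)
  else dI j ∷ mergeP c d (i ∷ is) js

module Construction (a d b c : List ℤ) where
  m n s k : ℕ
  m = length d
  n = length c
  s = length a
  k = length b

  order : List Item
  order = mergeP c d (reverse (range 1 n)) (reverse (range 1 m))

  -- state: (status of indices of c w.r.t. S , status of indices of d w.r.t. Δ)
  State : Set
  State = (ℕ → Status) × (ℕ → Status)

  step : State → Item → State
  step (fS , fΔ) (dI j) =
    fS , update fΔ j (if decide d c a fΔ fS j then inn else out)
  step (fS , fΔ) (cI j) =
    update fS j (if decide c d b fS fΔ j then inn else out) , fΔ

  run : List Item → State → State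
  run [] st = st
  run (it ∷ its) st = run its (step st it)

  final : State
  final = run order ((λ _ → unproc) , (λ _ → unproc))

  stS stΔ : ℕ → Status
  stS = Data.Product.proj₁ final
  stΔ = Data.Product.proj₂ final

  cSup dSup : List ℤ
  cSup = map (at c) (filterᵇ (λ i → isIn (stS i)) (range 1 n))
  dSup = map (at d) (filterᵇ (λ i → isIn (stΔ i)) (range 1 m))

  e e′ : List ℤ
  e = eSeq a d
  e′ = eSeq b c

-- Generic form of conditions (i)/(ii):
--   (xs, y, yOut, α, e) = (c^•, d, ∉Δ, a, e)  gives (i)
--   (xs, y, yOut, α, e) = (d^•, c, ∉S, b, e') gives (ii)
module Cond (xs y : List ℤ) (yOut : ℕ → Bool) (α e : List ℤ) where
  h′ sα ny : ℕ
  h′ = length xs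
  sα = length α
  ny = length y

  mY zY : ℕ → ℕ
  mY j = count sα (λ i → at xs j <ᵇ at α i)
  zY j = count ny (λ i → at xs j <ᵇ at y i)

  tY : ℕ → ℤ
  tY j = (+ sα) Z.- ((+ h′) Z.- (+ j)) Z.+ (+ count ny (λ i → yOut i ∧ (at y i <ᵇ at xs j)))

  rhs : ℕ → ℤ
  rhs j = sumFT (at xs) j h′
          Z.- sumWhere ny (λ i → yOut i ∧ (zY j ℕ.<ᵇ i)) (at y)
          Z.- sumFT (at α) (suc (mY j)) sα

  -- Σ_{i = z+t}^{z+m} e_i ≤ rhs; if the lower index z+t is ≤ 0 the sum
  -- contains e_i = +∞ (and the range is nonempty since t ≤ m), so the
  -- inequality fails.
  Ineq : ℕ → Set
  Ineq j with (+ zY j) Z.+ tY j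
  ... | + zero = ⊥
  ... | -[1+ _ ] = ⊥
  ... | + suc lo = sumFT (at e) (suc lo) (zY j ℕ.+ mY j) Z.≤ rhs j

  Holds : Set
  Holds = ∀ j → 1 ℕ.≤ j → j ℕ.≤ h′ → tY j Z.≤ (+ mY j) → Ineq j

ConditionI ConditionII : (a d b c : List ℤ) → Set
ConditionI a d b c =
  Cond.Holds cSup d (λ i → isOut (stΔ i)) a e
  where open Construction a d b c
ConditionII a d b c =
  Cond.Holds dSup c (λ i → isOut (stS i)) b e′
  where open Construction a d b c

{-# OPTIONS --safe #-}
module Submission where

-- Write N_x(v) = #{i | x_i ≤ v} and P_x(v) = Σ_i (v − x_i)⁺, so that P_x(v + 1) − P_x(v) = N_x(v).  In these
-- terms g ≺″ (d , a) amounts to N_d ≤ N_g together with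
--   P_g(v) − P_d(v) ≤ Σ_{i > q} (v − a_i)⁺   where q = s − N_g(v) + N_d(v).
-- Let κ be the multiset of the chosen entries, c_i with i ∈ S and d_i with i ∈ Δ.  The rules choose an entry
-- only if leaving it out would break this inequality, so N_κ ≤ N_g for every solution g.  Hence
-- P_κ ≤ P_g ≤ P_d + P_a, and (i) is this bound evaluated at the entry of e with the least index in its sum.
-- Conversely, as v grows, the inequality for κ in place of g can fail only while some a_i with i > q exceeds v;
-- there it reads P_κ ≤ P_d + P_a, which is what (i) provides.  So under (i) and (ii) the entries of κ, completed
-- by copies of a large number, form a solution.

-- Why hinge functions: for nonincreasing x, Σ_{i>q} (v - x_i) ≤ P_x(v) for every v, with equality
-- when x_q ≥ v ≥ x_{q+1}. So each inequality between tail sums, in ≺″ as in (i) and (ii), is an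
-- inequality between hinge functions at a suitable threshold, and induction on v replaces the
-- bookkeeping of h_j, z_y and t_y. The number q_j is the value that q takes for κ at v = d_j once
-- d_j is left out, so rule (b) tests the inequality for κ at that point, but with Σ (v - a_i) in
-- place of Σ (v - a_i)⁺. The two differ when some a_i with i > q exceeds v; rule (a) exists for
-- that case. It speaks of positions in e, and becomes the condition a_{q_j} ≥ d_j only because the
-- later entries of d above c_l are then left out as well. A decision reads only statuses that are
-- already settled. The final sets therefore satisfy all rules at once, and the order of processing
-- can be forgotten. That κ has at most m + s entries is a matter of growth: past all entries P_κ -
-- P_d has slope |κ| - m, yet it stays below P_a, whose slope is at most s.

module Greedy where
  open import Defs
  open import Data.Bool using (Bool; true; false; if_then_else_; not; _∧_; T)
  open import Data.Bool.Properties using (∧-zeroʳ; ∧-comm)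
  open import Data.Nat as ℕ using (ℕ; zero; suc; _∸_; z≤n; s≤s)
  import Data.Nat.Properties as ℕ
  open import Data.Integer using (ℤ; +_; -[1+_]; 0ℤ; 1ℤ; _+_; _-_; _*_; _≤_; _≤ᵇ_; +≤+; -≤+)
  import Data.Integer as ℤ
  open import Data.Integer.Properties as ℤP using (≤-refl; ≤-reflexive; ≤-trans; ≤-antisym)
  open import Data.Integer.Tactic.RingSolver using (solve)
  open import Data.Fin as Fin using (Fin)
  open import Data.Maybe using (Maybe; just; nothing)
  open import Data.List using (List; []; _∷_; length; map; filterᵇ; applyUpTo; reverse; applyDownFrom; _++_; replicate)
  open import Data.List.Properties using (map-upTo; reverse-applyUpTo; length-map; length-++; length-replicate)
  open import Data.List.Membership.Propositional using (_∈_)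
  open import Data.List.Relation.Unary.Any using (here; there)
  open import Data.List.Relation.Unary.All as All using (All) renaming ([] to []ᵃ; _∷_ to _∷ᵃ_)
  open import Data.List.Relation.Unary.AllPairs using (AllPairs) renaming ([] to []ᵖ; _∷_ to _∷ᵖ_)
  import Data.List.Relation.Unary.AllPairs.Properties as AllPairsP
  open import Data.List.Relation.Unary.Linked using (Linked)
  open import Data.List.Relation.Unary.Linked.Properties using (Linked⇒AllPairs)
  open import Data.List.Relation.Binary.Permutation.Propositional as Perm using (_↭_)
  open import Data.List.Relation.Binary.Permutation.Propositional.Properties using (↭-length)
  open import Data.Vec as Vec using (Vec; lookup; toList)
  open import Data.Vec.Properties using (length-toList; toList-cast; toList∘fromList)
  open import Data.Product using (_×_; _,_; proj₁; proj₂; ∃-syntax; Σ-syntax)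
  open import Data.Sum using (_⊎_; inj₁; inj₂; [_,_]′)
  open import Data.Empty using (⊥; ⊥-elim)
  open import Data.Unit using (tt)
  open import Function using (_∘_; id)
  open import Relation.Nullary using (yes; no)
  open import Relation.Binary.Definitions using (tri<; tri≈; tri>)
  open import Relation.Binary.PropositionalEquality using (_≡_; _≢_; refl; sym; trans; cong; cong₂; subst; subst₂)
  open import Relation.Binary.Construct.Flip.EqAndOrd using (decTotalOrder)
  open import Data.List.Sort (decTotalOrder ℤP.≤-decTotalOrder) using (sort; sort-↭; sort-↗)

  -- Integer inequalities and Boolean tests

  infixl 5 _⊕_
  _⊕_ : ∀ {a b c d} → a ≤ b → c ≤ d → a + c ≤ b + d
  _⊕_ = ℤP.+-mono-≤

  -- Linear arithmetic by certificate: hypotheses are added up with `_⊕_`, and the ring solver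
  -- checks that the slack of the conclusion equals the slack of their sum.
  lin : ∀ {a b c d} → a ≤ b → d - c ≡ b - a → c ≤ d
  lin p e = ℤP.0≤i-j⇒j≤i (subst (0ℤ ≤_) (sym e) (ℤP.i≤j⇒0≤j-i p))

  0≤1 : 0ℤ ≤ 1ℤ
  0≤1 = +≤+ z≤n

  ≤+1 : ∀ x → x ≤ 1ℤ + x
  ≤+1 x = lin 0≤1 (solve (x ∷ []))

  -- Strict inequalities are written `1ℤ + y ≤ x` throughout, so that `lin` can use them like any
  -- other.
  absurd : ∀ {x y} {A : Set} → x ≤ y → 1ℤ + y ≤ x → A
  absurd {x} {y} p q = ⊥-elim (1≰0 (lin (p ⊕ q) (eq x y)))
    where
    1≰0 : 1ℤ ≤ 0ℤ → ⊥
    1≰0 (+≤+ ())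
    eq : ∀ x y → 0ℤ - 1ℤ ≡ (y + x) - (x + (1ℤ + y))
    eq x y = solve (x ∷ y ∷ [])

  infix 4 _≤or>_
  _≤or>_ : ∀ x y → x ≤ y ⊎ 1ℤ + y ≤ x
  x ≤or> y with x ℤ.≤? y
  ... | yes p = inj₁ p
  ... | no ¬p = inj₂ (ℤP.i<j⇒suc[i]≤j (ℤP.≰⇒> ¬p))

  ≤⇒true : ∀ {x y} → x ≤ y → (x ≤ᵇ y) ≡ true
  ≤⇒true {x} {y} p with x ≤ᵇ y | ℤP.≤⇒≤ᵇ p
  ... | true | _ = refl

  true⇒≤ : ∀ {x y} → (x ≤ᵇ y) ≡ true → x ≤ y
  true⇒≤ {x} {y} e = ℤP.≤ᵇ⇒≤ (subst T (sym e) tt)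

  false⇒> : ∀ {x y} → (x ≤ᵇ y) ≡ false → 1ℤ + y ≤ x
  false⇒> {x} {y} e with x ≤or> y
  ... | inj₂ q = q
  ... | inj₁ p with trans (sym e) (≤⇒true p)
  ...   | ()

  >⇒false : ∀ {x} y → 1ℤ + y ≤ x → (x ≤ᵇ y) ≡ false
  >⇒false {x} y q with x ≤ᵇ y in e
  ... | false = refl
  ... | true  = absurd (true⇒≤ e) q

  <⇒true : ∀ x {y} → 1ℤ + x ≤ y → (x <ᵇ y) ≡ true
  <⇒true x q = cong not (>⇒false x q)

  ≥⇒false : ∀ {x y} → y ≤ x → (x <ᵇ y) ≡ false
  ≥⇒false q = cong not (≤⇒true q)

  true⇒< : ∀ {x y} → (x <ᵇ y) ≡ true → 1ℤ + x ≤ y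
  true⇒< {x} {y} e with y ≤ᵇ x in e′
  ... | false = false⇒> e′

  false⇒≥ : ∀ {x y} → (x <ᵇ y) ≡ false → y ≤ x
  false⇒≥ {x} {y} e with y ≤ᵇ x in e′
  ... | true = true⇒≤ e′

  n<⇒true : ∀ {i j} → i ℕ.< j → (i ℕ.<ᵇ j) ≡ true
  n<⇒true {i} {j} p with i ℕ.<ᵇ j | ℕ.<⇒<ᵇ p
  ... | true | _ = refl

  n≥⇒false : ∀ {i j} → j ℕ.≤ i → (i ℕ.<ᵇ j) ≡ false
  n≥⇒false {i} {j} p with i ℕ.<ᵇ j in e
  ... | false = refl
  ... | true  = ⊥-elim (ℕ.<⇒≱ (ℕ.<ᵇ⇒< i j (subst T (sym e) tt)) p)

  true⇒n< : ∀ {i j} → (i ℕ.<ᵇ j) ≡ true → i ℕ.< j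
  true⇒n< {i} {j} e = ℕ.<ᵇ⇒< i j (subst T (sym e) tt)

  false⇒n≥ : ∀ {i j} → (i ℕ.<ᵇ j) ≡ false → j ℕ.≤ i
  false⇒n≥ {i} {j} e with j ℕ.≤? i
  ... | yes p = p
  ... | no ¬p with trans (sym e) (n<⇒true (ℕ.≰⇒> ¬p))
  ...   | ()

  ∧-true : ∀ {a b} → (a ∧ b) ≡ true → a ≡ true × b ≡ true
  ∧-true {true} e = refl , e

  +≤ : ∀ {i j} → i ℕ.≤ j → + i ≤ + j
  +≤ = +≤+

  ≤+ : ∀ {i j} → + i ≤ + j → i ℕ.≤ j
  ≤+ (+≤+ p) = p

  -- Finite sums

  infixr 7 _·_
  _·_ : Bool → ℤ → ℤ
  b · z = if b then z else 0ℤ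

  ·-0 : ∀ b → b · 0ℤ ≡ 0ℤ
  ·-0 true  = refl
  ·-0 false = refl

  ·-0≤ : ∀ b {z} → 0ℤ ≤ z → 0ℤ ≤ b · z
  ·-0≤ true  p = p
  ·-0≤ false p = ≤-refl

  from : ℕ → ℕ → List ℕ
  from r zero    = []
  from r (suc k) = r ∷ from (suc r) k

  applyUpTo-from : ∀ (f : ℕ → ℕ) r k → (∀ i → f i ≡ r ℕ.+ i) → applyUpTo f k ≡ from r k
  applyUpTo-from f r zero    h = refl
  applyUpTo-from f r (suc k) h =
    cong₂ _∷_ (trans (h 0) (ℕ.+-identityʳ r))
      (applyUpTo-from (f ∘ suc) (suc r) k (λ i → trans (h (suc i)) (ℕ.+-suc r i)))

  range-from : ∀ r t → range r t ≡ from r (suc t ∸ r)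
  range-from r t = trans (map-upTo (r ℕ.+_) (suc t ∸ r)) (applyUpTo-from (r ℕ.+_) r (suc t ∸ r) (λ _ → refl))

  ∈-from : ∀ {i} r k → i ∈ from r k → r ℕ.≤ i × i ℕ.< r ℕ.+ k
  ∈-from r (suc k) (here refl) = ℕ.≤-refl , ℕ.m<m+n r (s≤s z≤n)
  ∈-from {i} r (suc k) (there p) with ∈-from (suc r) k p
  ... | a , b = ℕ.<⇒≤ a , subst (i ℕ.<_) (sym (ℕ.+-suc r k)) b

  ΣL : {A : Set} → (A → ℤ) → List A → ℤ
  ΣL f []       = 0ℤ
  ΣL f (i ∷ is) = f i + ΣL f is

  sumZ-map : ∀ {A : Set} (f : A → ℤ) l → sumZ (map f l) ≡ ΣL f l
  sumZ-map f []      = refl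
  sumZ-map f (i ∷ l) = cong (λ t → f i + t) (sumZ-map f l)

  ΣL-map : ∀ {A B : Set} (f : B → ℤ) (g : A → B) l → ΣL f (map g l) ≡ ΣL (f ∘ g) l
  ΣL-map f g []      = refl
  ΣL-map f g (i ∷ l) = cong (λ t → f (g i) + t) (ΣL-map f g l)

  ΣL-filter : ∀ {A : Set} (f : A → ℤ) p l → ΣL f (filterᵇ p l) ≡ ΣL (λ i → p i · f i) l
  ΣL-filter f p []      = refl
  ΣL-filter f p (i ∷ l) with p i
  ... | true  = cong (λ t → f i + t) (ΣL-filter f p l)
  ... | false = trans (ΣL-filter f p l) (sym (ℤP.+-identityˡ _))

  ΣL-≤ : ∀ {A : Set} {f g : A → ℤ} l → (∀ i → i ∈ l → f i ≤ g i) → ΣL f l ≤ ΣL g l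
  ΣL-≤ []      h = ≤-refl
  ΣL-≤ (i ∷ l) h = h i (here refl) ⊕ ΣL-≤ l (λ j p → h j (there p))

  ΣL-≡ : ∀ {A : Set} {f g : A → ℤ} l → (∀ i → i ∈ l → f i ≡ g i) → ΣL f l ≡ ΣL g l
  ΣL-≡ []      h = refl
  ΣL-≡ (i ∷ l) h = cong₂ _+_ (h i (here refl)) (ΣL-≡ l (λ j p → h j (there p)))

  ΣL-+ : ∀ {A : Set} (f g : A → ℤ) l → ΣL (λ i → f i + g i) l ≡ ΣL f l + ΣL g l
  ΣL-+ f g []      = refl
  ΣL-+ f g (i ∷ l) = trans (cong (λ t → f i + g i + t) (ΣL-+ f g l)) (eq (f i) (g i) (ΣL f l) (ΣL g l))
    where
    eq : ∀ a b c d → a + b + (c + d) ≡ a + c + (b + d)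
    eq a b c d = solve (a ∷ b ∷ c ∷ d ∷ [])

  ΣL-minus : ∀ {A : Set} (f g : A → ℤ) l → ΣL (λ i → f i - g i) l ≡ ΣL f l - ΣL g l
  ΣL-minus f g []      = refl
  ΣL-minus f g (i ∷ l) = trans (cong (λ t → f i - g i + t) (ΣL-minus f g l))
      (eq (f i) (g i) (ΣL f l) (ΣL g l))
    where
    eq : ∀ a b c d → a - b + (c - d) ≡ a + c - (b + d)
    eq a b c d = solve (a ∷ b ∷ c ∷ d ∷ [])

  ΣL-* : ∀ {A : Set} v (f : A → ℤ) l → ΣL (λ i → v * f i) l ≡ v * ΣL f l
  ΣL-* v f []      = sym (ℤP.*-zeroʳ v)
  ΣL-* v f (i ∷ l) = trans (cong (λ t → v * f i + t) (ΣL-* v f l)) (sym (ℤP.*-distribˡ-+ v (f i) (ΣL f l)))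

  ΣL-++ : ∀ {A : Set} (f : A → ℤ) l l′ → ΣL f (l ++ l′) ≡ ΣL f l + ΣL f l′
  ΣL-++ f []      l′ = sym (ℤP.+-identityˡ _)
  ΣL-++ f (i ∷ l) l′ = trans (cong (λ t → f i + t) (ΣL-++ f l l′)) (sym (ℤP.+-assoc (f i) (ΣL f l) (ΣL f l′)))

  ΣL-length : ∀ {A : Set} (l : List A) → + length l ≡ ΣL (λ _ → 1ℤ) l
  ΣL-length []      = refl
  ΣL-length (_ ∷ l) = cong (λ t → 1ℤ + t) (ΣL-length l)

  Σ : ℕ → (ℕ → ℤ) → ℤ
  Σ n f = ΣL f (from 1 n)

  within : ∀ {n i} → i ∈ from 1 n → 1 ℕ.≤ i × i ℕ.≤ n
  within {n} p with ∈-from 1 n p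
  ... | a , s≤s b = a , b

  Σ-≤ : ∀ n {f g} → (∀ i → 1 ℕ.≤ i → i ℕ.≤ n → f i ≤ g i) → Σ n f ≤ Σ n g
  Σ-≤ n h = ΣL-≤ (from 1 n) (λ i p → h i (proj₁ (within p)) (proj₂ (within p)))

  Σ-≡ : ∀ n {f g} → (∀ i → 1 ℕ.≤ i → i ℕ.≤ n → f i ≡ g i) → Σ n f ≡ Σ n g
  Σ-≡ n h = ΣL-≡ (from 1 n) (λ i p → h i (proj₁ (within p)) (proj₂ (within p)))

  Σ-≡₊ : ∀ n {f g k} → (∀ i → 1 ℕ.≤ i → i ℕ.≤ n → f i ≡ g i + k i) → Σ n f ≡ Σ n g + Σ n k
  Σ-≡₊ n {f} {g} {k} h = trans (Σ-≡ n h) (ΣL-+ g k (from 1 n))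

  Σ-≡₋ : ∀ n {f g k} → (∀ i → 1 ℕ.≤ i → i ℕ.≤ n → f i ≡ g i - k i) → Σ n f ≡ Σ n g - Σ n k
  Σ-≡₋ n {f} {g} {k} h = trans (Σ-≡ n h) (ΣL-minus g k (from 1 n))

  Σ-≤₊ : ∀ n {f g k} → (∀ i → 1 ℕ.≤ i → i ℕ.≤ n → f i ≤ g i + k i) → Σ n f ≤ Σ n g + Σ n k
  Σ-≤₊ n {f} {g} {k} h = ≤-trans (Σ-≤ n h) (≤-reflexive (ΣL-+ g k (from 1 n)))

  Σ-₊≤ : ∀ n {f g k} → (∀ i → 1 ℕ.≤ i → i ℕ.≤ n → g i + k i ≤ f i) → Σ n g + Σ n k ≤ Σ n f
  Σ-₊≤ n {f} {g} {k} h = ≤-trans (≤-reflexive (sym (ΣL-+ g k (from 1 n)))) (Σ-≤ n h)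

  Σ-0 : ∀ n → Σ n (λ _ → 0ℤ) ≡ 0ℤ
  Σ-0 n = go (from 1 n)
    where
    go : ∀ (l : List ℕ) → ΣL (λ _ → 0ℤ) l ≡ 0ℤ
    go []      = refl
    go (_ ∷ l) = trans (ℤP.+-identityˡ _) (go l)

  Σ-≡0 : ∀ n {f} → (∀ i → 1 ℕ.≤ i → i ℕ.≤ n → f i ≡ 0ℤ) → Σ n f ≡ 0ℤ
  Σ-≡0 n h = trans (Σ-≡ n h) (Σ-0 n)

  Σ-0≤ : ∀ n {f} → (∀ i → 1 ℕ.≤ i → i ℕ.≤ n → 0ℤ ≤ f i) → 0ℤ ≤ Σ n f
  Σ-0≤ n h = ≤-trans (≤-reflexive (sym (Σ-0 n))) (Σ-≤ n h)

  length-from : ∀ r k → length (from r k) ≡ k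
  length-from r zero    = refl
  length-from r (suc k) = cong suc (length-from (suc r) k)

  Σ-1 : ∀ n → Σ n (λ _ → 1ℤ) ≡ + n
  Σ-1 n = trans (sym (ΣL-length (from 1 n))) (cong +_ (length-from 1 n))

  ΣL-tail : ∀ f q r k → r ℕ.≤ suc q →
    ΣL (λ i → (q ℕ.<ᵇ i) · f i) (from r k) ≡ ΣL f (from (suc q) (r ℕ.+ k ∸ suc q))
  ΣL-tail f q r zero p
    rewrite ℕ.+-identityʳ r | ℕ.m≤n⇒m∸n≡0 p = refl
  ΣL-tail f q r (suc k) p with ℕ.m≤n⇒m<n∨m≡n p
  ... | inj₁ (s≤s r≤q)
    rewrite n≥⇒false r≤q | ℕ.+-suc r k = trans (ℤP.+-identityˡ _) (ΣL-tail f q (suc r) k (s≤s r≤q))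
  ... | inj₂ refl
    rewrite ℕ.m+n∸m≡n q (suc k) = ΣL-≡ (from (suc q) (suc k)) pw
    where
    pw : ∀ i → i ∈ from (suc q) (suc k) → (q ℕ.<ᵇ i) · f i ≡ f i
    pw i e rewrite n<⇒true (proj₁ (∈-from (suc q) (suc k) e)) = refl

  Σ-tail : ∀ f q n → Σ n (λ i → (q ℕ.<ᵇ i) · f i) ≡ ΣL f (from (suc q) (n ∸ q))
  Σ-tail f q n = ΣL-tail f q 1 n (s≤s z≤n)

  Σ-peel : ∀ f q n → suc q ℕ.≤ n →
    Σ n (λ i → (q ℕ.<ᵇ i) · f i) ≡ f (suc q) + Σ n (λ i → (suc q ℕ.<ᵇ i) · f i)
  Σ-peel f q n p rewrite Σ-tail f q n | Σ-tail f (suc q) n | ℕ.+-∸-assoc 1 p = refl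

  Σ-count> : ∀ q n → q ℕ.≤ n → Σ n (λ i → (q ℕ.<ᵇ i) · 1ℤ) ≡ + n - + q
  Σ-count> q n p =
    trans (Σ-tail (λ _ → 1ℤ) q n)
      (trans (sym (ΣL-length (from (suc q) (n ∸ q))))
        (trans (cong +_ (length-from (suc q) (n ∸ q)))
          (trans (sym (ℤP.⊖-≥ p)) (sym (ℤP.m-n≡m⊖n n q)))))

  sumFT-Σ : ∀ f q n → sumFT f (suc q) n ≡ Σ n (λ i → (q ℕ.<ᵇ i) · f i)
  sumFT-Σ f q n =
    trans (cong (λ l → sumZ (map f l)) (range-from (suc q) n))
      (trans (sumZ-map f (from (suc q) (n ∸ q))) (sym (Σ-tail f q n)))

  count-Σ : ∀ n p → + count n p ≡ Σ n (λ i → p i · 1ℤ)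
  count-Σ n p =
    trans (cong (λ l → + length (filterᵇ p l)) (range-from 1 n))
      (trans (ΣL-length (filterᵇ p (from 1 n))) (ΣL-filter (λ _ → 1ℤ) p (from 1 n)))

  sumWhere-Σ : ∀ n p f → sumWhere n p f ≡ Σ n (λ i → p i · f i)
  sumWhere-Σ n p f =
    trans (cong (λ l → sumZ (map f (filterᵇ p l))) (range-from 1 n))
      (trans (sumZ-map f (filterᵇ p (from 1 n))) (ΣL-filter f p (from 1 n)))

  Σ-hinge : ∀ n (b : ℕ → Bool) (x : ℕ → ℤ) v →
    Σ n (λ i → b i · (v - x i)) ≡ v * Σ n (λ i → b i · 1ℤ) - Σ n (λ i → b i · x i)
  Σ-hinge n b x v =
    trans (Σ-≡₋ n {g = λ i → v * (b i · 1ℤ)} {k = λ i → b i · x i} (λ i _ _ → pw (b i) (x i)))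
      (cong (_- Σ n (λ i → b i · x i)) (ΣL-* v (λ i → b i · 1ℤ) (from 1 n)))
    where
    pw : ∀ c y → c · (v - y) ≡ v * (c · 1ℤ) - c · y
    pw true  y = cong (_- y) (sym (ℤP.*-identityʳ v))
    pw false y = eq v
      where
      eq : ∀ v → 0ℤ ≡ v * 0ℤ - 0ℤ
      eq v = solve (v ∷ [])

  Σ-shift : ∀ a b f → Σ (a ℕ.+ b) f ≡ Σ a f + Σ b (λ i → f (a ℕ.+ i))
  Σ-shift a b f = trans (cong (ΣL f) (split 1 a)) (trans (ΣL-++ f (from 1 a) (from (1 ℕ.+ a) b))
      (cong (λ t → Σ a f + t) (trans (cong (ΣL f) (sym (shift 1 b))) (ΣL-map f (a ℕ.+_) (from 1 b)))))
    where
    split : ∀ r k → from r (k ℕ.+ b) ≡ from r k ++ from (r ℕ.+ k) b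
    split r zero    = cong (λ t → from t b) (sym (ℕ.+-identityʳ r))
    split r (suc k) = cong (r ∷_) (trans (split (suc r) k)
        (cong (λ t → from (suc r) k ++ from t b) (sym (ℕ.+-suc r k))))
    shift : ∀ r k → map (a ℕ.+_) (from r k) ≡ from (r ℕ.+ a) k
    shift r zero    = refl
    shift r (suc k) = cong₂ _∷_ (ℕ.+-comm a r) (shift (suc r) k)

  -- Hinge functions

  pos : ℤ → ℤ
  pos (+ n)    = + n
  pos -[1+ _ ] = 0ℤ

  0≤pos : ∀ z → 0ℤ ≤ pos z
  0≤pos (+ n)    = +≤+ z≤n
  0≤pos -[1+ _ ] = ≤-refl

  ≤pos : ∀ z → z ≤ pos z
  ≤pos (+ n)    = ≤-refl
  ≤pos -[1+ _ ] = -≤+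

  pos-≥0 : ∀ {z} → 0ℤ ≤ z → pos z ≡ z
  pos-≥0 (+≤+ _) = refl

  pos-≤0 : ∀ {z} → z ≤ 0ℤ → pos z ≡ 0ℤ
  pos-≤0 -≤+         = refl
  pos-≤0 (+≤+ z≤n) = refl

  pos-below : ∀ {v x} → x ≤ v → pos (v - x) ≡ v - x
  pos-below p = pos-≥0 (ℤP.i≤j⇒0≤j-i p)

  pos-above : ∀ {v x} → v ≤ x → pos (v - x) ≡ 0ℤ
  pos-above p = pos-≤0 (ℤP.i≤j⇒i-j≤0 p)

  pos-step : ∀ v x → pos (1ℤ + v - x) ≡ pos (v - x) + (x ≤ᵇ v) · 1ℤ
  pos-step v x with x ≤or> v
  ... | inj₁ p rewrite pos-below p | pos-below (≤-trans p (≤+1 v)) | ≤⇒true p = eq v x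
    where
    eq : ∀ v x → 1ℤ + v - x ≡ v - x + 1ℤ
    eq v x = solve (v ∷ x ∷ [])
  ... | inj₂ q rewrite pos-above q | pos-above (≤-trans (≤+1 v) q) | >⇒false v q = refl

  P N : ℕ → (ℕ → ℤ) → ℤ → ℤ
  P n x v = Σ n (λ i → pos (v - x i))
  N n x v = Σ n (λ i → (x i ≤ᵇ v) · 1ℤ)

  P-step : ∀ n x v → P n x (1ℤ + v) ≡ P n x v + N n x v
  P-step n x v = Σ-≡₊ n (λ i _ _ → pos-step v (x i))

  N-≤ : ∀ n x v → N n x v ≤ + n
  N-≤ n x v = ≤-trans (Σ-≤ n (λ i _ _ → pw (x i ≤ᵇ v))) (≤-reflexive (Σ-1 n))
    where
    pw : ∀ b → b · 1ℤ ≤ 1ℤ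
    pw true  = ≤-refl
    pw false = 0≤1

  N-mono : ∀ n x {u v} → u ≤ v → N n x u ≤ N n x v
  N-mono n x {u} {v} u≤v = Σ-≤ n λ i _ _ → pw (x i)
    where
    pw : ∀ y → (y ≤ᵇ u) · 1ℤ ≤ (y ≤ᵇ v) · 1ℤ
    pw y with y ≤or> u
    ... | inj₁ p rewrite ≤⇒true p | ≤⇒true (≤-trans p u≤v) = ≤-refl
    ... | inj₂ q rewrite >⇒false u q = ·-0≤ (y ≤ᵇ v) 0≤1

  Anti : ℕ → (ℕ → ℤ) → Set
  Anti n x = ∀ i j → 1 ℕ.≤ i → i ℕ.≤ j → j ℕ.≤ n → x j ≤ x i

  -- With `N-high`, `M-low` and `M-high` this is the dictionary between the position of an entry in
  -- a sorted sequence and the counts at a threshold.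
  N-low : ∀ n x → Anti n x → ∀ q v → suc q ℕ.≤ n → x (suc q) ≤ v → + n - + q ≤ N n x v
  N-low n x A q v q<n p =
    ≤-trans (≤-reflexive (sym (Σ-count> q n (ℕ.<⇒≤ q<n)))) (Σ-≤ n pw)
    where
    pw : ∀ i → 1 ℕ.≤ i → i ℕ.≤ n → (q ℕ.<ᵇ i) · 1ℤ ≤ (x i ≤ᵇ v) · 1ℤ
    pw i _ i≤n with q ℕ.<ᵇ i in e
    ... | false = ·-0≤ (x i ≤ᵇ v) 0≤1
    ... | true rewrite ≤⇒true (≤-trans (A (suc q) i (s≤s z≤n) (true⇒n< e) i≤n) p) = ≤-refl

  N-high : ∀ n x → Anti n x → ∀ i v → 1 ℕ.≤ i → i ℕ.≤ n → 1ℤ + v ≤ x i → N n x v ≤ + n - + i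
  N-high n x A i v 1≤i i≤n p =
    ≤-trans (Σ-≤ n pw) (≤-reflexive (Σ-count> i n i≤n))
    where
    pw : ∀ k → 1 ℕ.≤ k → k ℕ.≤ n → (x k ≤ᵇ v) · 1ℤ ≤ (i ℕ.<ᵇ k) · 1ℤ
    pw k 1≤k k≤n with i ℕ.<ᵇ k in e
    ... | false rewrite >⇒false v (≤-trans p (A k i 1≤k (false⇒n≥ e) i≤n)) = ≤-refl
    ... | true with x k ≤ᵇ v
    ...   | true  = ≤-refl
    ...   | false = 0≤1

  -- For q ≤ 0 every index counts, matching the convention α_i = +∞ for i ≤ 0.
  T₊ : ℕ → (ℕ → ℤ) → ℤ → ℤ → ℤ
  T₊ s a q v = Σ s (λ i → (q <ᵇ + i) · pos (v - a i))

  T₊≤P : ∀ s a q v → T₊ s a q v ≤ P s a v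
  T₊≤P s a q v = Σ-≤ s λ i _ _ → pw (q <ᵇ + i) (0≤pos (v - a i))
    where
    pw : ∀ b {z} → 0ℤ ≤ z → b · z ≤ z
    pw true  _ = ≤-refl
    pw false p = p

  T₊-anti : ∀ s a {q r} v → q ≤ r → T₊ s a r v ≤ T₊ s a q v
  T₊-anti s a {q} {r} v p = Σ-≤ s pw
    where
    pw : ∀ i → 1 ℕ.≤ i → i ℕ.≤ s → (r <ᵇ + i) · pos (v - a i) ≤ (q <ᵇ + i) · pos (v - a i)
    pw i _ _ with + i ≤or> r
    ... | inj₁ h rewrite ≥⇒false h = ·-0≤ (q <ᵇ + i) (0≤pos (v - a i))
    ... | inj₂ h rewrite <⇒true r h | <⇒true q (≤-trans (ℤP.+-monoʳ-≤ 1ℤ p) h) = ≤-refl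

  +<ᵇ : ∀ q i → (+ q <ᵇ + i) ≡ (q ℕ.<ᵇ i)
  +<ᵇ q i with q ℕ.<ᵇ i in e
  ... | true  = <⇒true (+ q) {+ i} (+≤ (true⇒n< {q} {i} e))
  ... | false = ≥⇒false {+ q} {+ i} (+≤ (false⇒n≥ {q} {i} e))

  true≢false : true ≢ false
  true≢false ()

  upTo-count : ∀ i n → i ℕ.≤ n → Σ n (λ k → 1ℤ - (i ℕ.<ᵇ k) · 1ℤ) ≡ + i
  upTo-count i n i≤n = trans (Σ-≡₋ n {g = λ _ → 1ℤ} {k = λ k → (i ℕ.<ᵇ k) · 1ℤ} (λ _ _ _ → refl))
    (trans (cong₂ _-_ (Σ-1 n) (Σ-count> i n i≤n)) (eq (+ n) (+ i)))
    where
    eq : ∀ n i → n - (n - i) ≡ i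
    eq n i = solve (n ∷ i ∷ [])

  M : ℕ → (ℕ → ℤ) → ℤ → ℤ
  M s a v = Σ s (λ i → (v ≤ᵇ a i) · 1ℤ)

  ·1≤1 : ∀ b → b · 1ℤ ≤ 1ℤ
  ·1≤1 true  = ≤-refl
  ·1≤1 false = 0≤1

  0≤·1 : ∀ b → 0ℤ ≤ b · 1ℤ
  0≤·1 b = ·-0≤ b 0≤1

  0≤M : ∀ s a v → 0ℤ ≤ M s a v
  0≤M s a v = Σ-0≤ s (λ i _ _ → 0≤·1 (v ≤ᵇ a i))

  M-anti : ∀ s a {u v} → u ≤ v → M s a v ≤ M s a u
  M-anti s a {u} {v} p = Σ-≤ s λ i _ _ → pw i
    where
    pw : ∀ i → (v ≤ᵇ a i) · 1ℤ ≤ (u ≤ᵇ a i) · 1ℤ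
    pw i with v ≤ᵇ a i in e
    ... | false = 0≤·1 (u ≤ᵇ a i)
    ... | true rewrite ≤⇒true (≤-trans p (true⇒≤ e)) = ≤-refl

  M-low : ∀ s a → Anti s a → ∀ i v → 1 ℕ.≤ i → i ℕ.≤ s → v ≤ a i → + i ≤ M s a v
  M-low s a A i v 1≤i i≤s p = ≤-trans (≤-reflexive (sym (upTo-count i s i≤s))) (Σ-≤ s pw)
    where
    pw : ∀ k → 1 ℕ.≤ k → k ℕ.≤ s → 1ℤ - (i ℕ.<ᵇ k) · 1ℤ ≤ (v ≤ᵇ a k) · 1ℤ
    pw k 1≤k k≤s with i ℕ.<ᵇ k in e
    ... | true = 0≤·1 (v ≤ᵇ a k)
    ... | false rewrite ≤⇒true (≤-trans p (A k i 1≤k (false⇒n≥ e) i≤s)) = ≤-refl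

  M-high : ∀ s a → Anti s a → ∀ i v → i ℕ.< s → 1ℤ + a (suc i) ≤ v → M s a v ≤ + i
  M-high s a A i v i<s p = ≤-trans (Σ-≤ s pw) (≤-reflexive (upTo-count i s (ℕ.<⇒≤ i<s)))
    where
    pw : ∀ k → 1 ℕ.≤ k → k ℕ.≤ s → (v ≤ᵇ a k) · 1ℤ ≤ 1ℤ - (i ℕ.<ᵇ k) · 1ℤ
    pw k 1≤k k≤s with i ℕ.<ᵇ k in e
    ... | false = ·1≤1 (v ≤ᵇ a k)
    ... | true rewrite >⇒false {v} (a k) (≤-trans (ℤP.+-monoʳ-≤ 1ℤ (A (suc i) k (s≤s z≤n) (true⇒n< e) k≤s))
        p) = ≤-refl

  gap : ∀ {v V} → v ≤ V → Σ[ k ∈ ℕ ] V ≡ + k + v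
  gap {v} {V} h with V - v in e | ℤP.i≤j⇒0≤j-i h
  ... | + k | _ = k , trans (eq V v) (cong (λ t → t + v) e)
    where
    eq : ∀ V v → V ≡ V - v + v
    eq V v = solve (V ∷ v ∷ [])

  -- Least indices

  record Least (p : ℕ → Bool) (w i : ℕ) : Set where
    constructor least
    field
      1≤i : 1 ℕ.≤ i
      i≤w : i ℕ.≤ w
      holds : p i ≡ true
      below : ∀ k → 1 ℕ.≤ k → k ℕ.< i → p k ≡ false

  find-spec : ∀ (p : ℕ → Bool) w (go : List ℕ → ℕ) → go [] ≡ suc w →
    (∀ i is → go (i ∷ is) ≡ (if p i then i else go is)) →
    ∀ r k → 1 ℕ.≤ r → r ℕ.+ k ≡ suc w → (∀ i → 1 ℕ.≤ i → i ℕ.< r → p i ≡ false) →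
    Least p w (go (from r k)) ⊎ (go (from r k) ≡ suc w × (∀ i → 1 ℕ.≤ i → i ℕ.≤ w → p i ≡ false))
  find-spec p w go e₀ e₁ r zero 1≤r eq h =
    inj₂ (e₀ , λ i a b → h i a (subst (i ℕ.<_) (trans (sym eq) (ℕ.+-identityʳ r)) (s≤s b)))
  find-spec p w go e₀ e₁ r (suc k) 1≤r eq h rewrite e₁ r (from (suc r) k) with p r in pr
  ... | true  = inj₁ (least 1≤r (ℕ.≤-pred (subst (r ℕ.<_) eq (ℕ.m<m+n r (s≤s z≤n)))) pr h)
  ... | false = find-spec p w go e₀ e₁ (suc r) k (s≤s z≤n) (trans (sym (ℕ.+-suc r k)) eq) h′
    where
    h′ : ∀ i → 1 ℕ.≤ i → i ℕ.< suc r → p i ≡ false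
    h′ i a (s≤s b) with ℕ.m≤n⇒m<n∨m≡n b
    ... | inj₁ c = h i a c
    ... | inj₂ refl = pr

  find-spec′ : ∀ (p : ℕ → Bool) w (go : List ℕ → ℕ) → ∀ l → l ≡ from 1 w → go [] ≡ suc w →
    (∀ i is → go (i ∷ is) ≡ (if p i then i else go is)) →
    Least p w (go l) ⊎ (go l ≡ suc w × (∀ i → 1 ℕ.≤ i → i ℕ.≤ w → p i ≡ false))
  find-spec′ p w go _ refl e₀ e₁ =
    find-spec p w go e₀ e₁ 1 w ℕ.≤-refl refl (λ i a b → ⊥-elim (ℕ.<⇒≱ b a))

  mutual
    -- The search function of findMin is local to its definition; unification recovers it.
    findMin-go : ℕ → (ℕ → Bool) → List ℕ → ℕ
    findMin-go = _

    findMin-spec : ∀ w p →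
      Least p w (findMin w p) ⊎ (findMin w p ≡ suc w × (∀ i → 1 ℕ.≤ i → i ℕ.≤ w → p i ≡ false))
    findMin-spec w p with range 1 w | range-from 1 w
    ... | l | e = find-spec′ p w (findMin-go w p) l e refl (λ _ _ → refl)

  -- Locality of the decision rule

  module Decision (x y α : List ℤ) (fX fY : ℕ → Status) (j : ℕ) where
    sα nx ny : ℕ
    sα = length α
    nx = length x
    ny = length y
    v : ℤ
    v = at x j
    yInLt : ℕ → Bool
    yInLt i = isIn (fY i) ∧ (at y i <ᵇ v)
    q : ℤ
    q = (+ sα) - (+ count ny yInLt) + (+ count nx (λ i → (j ℕ.<ᵇ i) ∧ isOut (fX i))) + 1ℤ
    l : ℕ
    l = findMin ny yInLt
    yl : ℤ
    yl = at y l
    N′ : ℤ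
    N′ = (+ count sα (λ i → yl <ᵇ at α i)) - (+ sα)
        + (+ count ny (λ i → isIn (fY i) ∧ (l ℕ.<ᵇ i)))
        - (+ count nx (λ i → isOut (fX i) ∧ (at x i <ᵇ yl))) + 1ℤ
    E pos′ : ℕ
    E = count (length (eTags α x)) (λ i → yl <ᵇ at (eSeq α x) i)
    pos′ = posX (eTags α x) j
    ruleA : Bool
    ruleA = (1ℤ ≤ᵇ N′) ∧ ((((+ E) - N′) <ᵇ (+ pos′)) ∧ (pos′ ℕ.≤ᵇ E)) ∧ (yl <ᵇ v)
    lhsB rhsB : ℤ
    lhsB = sumWhere ny yInLt (at y)
    rhsB = sumWhere nx (λ i → isOut (fX i) ∧ (j ℕ.<ᵇ i)) (at x) + v

    ruleB : Maybe ℤ → Bool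
    ruleB nothing  = true
    ruleB (just t) = not ((rhsB + t) ≤ᵇ lhsB)

    decide-unfold : decide x y α fX fY j ≡ (if (+ sα) <ᵇ q then true else
        (if ruleA then false else ruleB (tailSum α q)))
    decide-unfold with tailSum α q
    ... | nothing = refl
    ... | just t = refl

  filterᵇ-cong : ∀ {A : Set} {p p′ : A → Bool} l → (∀ i → i ∈ l → p i ≡ p′ i) → filterᵇ p l ≡ filterᵇ p′ l
  filterᵇ-cong [] h = refl
  filterᵇ-cong {p = p} {p′} (i ∷ l) h with p i | p′ i | h i (here refl)
  ... | true  | _ | refl = cong (i ∷_) (filterᵇ-cong l (λ k e → h k (there e)))
  ... | false | _ | refl = filterᵇ-cong l (λ k e → h k (there e))

  filter-range-cong : ∀ n {p p′} → (∀ i → 1 ℕ.≤ i → i ℕ.≤ n → p i ≡ p′ i) →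
    filterᵇ p (range 1 n) ≡ filterᵇ p′ (range 1 n)
  filter-range-cong n h rewrite range-from 1 n =
    filterᵇ-cong (from 1 n) (λ i e → h i (proj₁ (within e)) (proj₂ (within e)))

  count-cong : ∀ n {p p′} → (∀ i → 1 ℕ.≤ i → i ℕ.≤ n → p i ≡ p′ i) → count n p ≡ count n p′
  count-cong n h = cong length (filter-range-cong n h)

  sumWhere-cong : ∀ n {p p′} f → (∀ i → 1 ℕ.≤ i → i ℕ.≤ n → p i ≡ p′ i) → sumWhere n p f ≡ sumWhere n p′ f
  sumWhere-cong n f h = cong (λ l → sumZ (map f l)) (filter-range-cong n h)

  Least-unique : ∀ {p p′ w i i′} → (∀ k → 1 ℕ.≤ k → k ℕ.≤ w → p k ≡ p′ k) →
    Least p w i → Least p′ w i′ → i ≡ i′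
  Least-unique {i = i} {i′} h (least a b c d) (least a′ b′ c′ d′) with ℕ.<-cmp i i′
  ... | tri≈ _ e _ = e
  ... | tri< u _ _ with trans (sym c) (trans (h i a b) (d′ i a u))
  ...   | ()
  Least-unique {i = i} {i′} h (least a b c d) (least a′ b′ c′ d′)
      | tri> _ _ u with trans (sym c′) (trans (sym (h i′ a′ b′)) (d i′ a′ u))
  ...   | ()

  findMin-cong : ∀ w {p p′} → (∀ i → 1 ℕ.≤ i → i ℕ.≤ w → p i ≡ p′ i) → findMin w p ≡ findMin w p′
  findMin-cong w {p} {p′} h with findMin-spec w p | findMin-spec w p′
  ... | inj₁ L | inj₁ L′ = Least-unique h L L′
  ... | inj₂ (e , _) | inj₂ (e′ , _) = trans e (sym e′)
  ... | inj₁ (least a b c _) | inj₂ (_ , n) with trans (sym c) (trans (h _ a b) (n _ a b))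
  ...   | ()
  findMin-cong w {p} {p′} h | inj₂ (_ , n) | inj₁ (least a b c _) with trans (sym c)
      (trans (sym (h _ a b)) (n _ a b))
  ...   | ()

  count-false : ∀ n {p} → (∀ i → 1 ℕ.≤ i → i ℕ.≤ n → p i ≡ false) → + count n p ≡ 0ℤ
  count-false n {p} h = trans (count-Σ n p) (Σ-≡0 n λ i a b → cong (_· 1ℤ) (h i a b))

  0≤count : ∀ n p → 0ℤ ≤ + count n p
  0≤count n p = +≤+ z≤n

  module _ (x y α : List ℤ) (fX fY : ℕ → Status) (j : ℕ) where
    open Decision x y α fX fY j

    -- With no chosen `y` below `x_j`, `q` is at least `sα + 1` and the first test already decides.
    -- So whenever rules (a) and (b) are consulted, `l` is a genuine index and not the default value
    -- of `findMin`.
    q≤⇒least : q ≤ + sα → Least yInLt ny l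
    q≤⇒least h with findMin-spec ny yInLt
    ... | inj₁ L = L
    ... | inj₂ (_ , n) = absurd h (lin (≤-reflexive (count-false ny n)
        ⊕ 0≤count nx (λ i → (j ℕ.<ᵇ i) ∧ isOut (fX i)))
          (eq (+ sα) (+ count ny yInLt) (+ count nx (λ i → (j ℕ.<ᵇ i) ∧ isOut (fX i)))))
      where
      eq : ∀ s k o → s - k + o + 1ℤ - (1ℤ + s) ≡ 0ℤ + o - (k + 0ℤ)
      eq s k o = solve (s ∷ k ∷ o ∷ [])

  if-cong : ∀ {b b′ c c′} → b ≡ b′ → (b ≡ false → c ≡ c′) → (if b then true else c)
      ≡ (if b′ then true else c′)
  if-cong {true}  refl h = refl
  if-cong {false} refl h = h refl

  module _ (x y α : List ℤ) {fX fX′ fY fY′ : ℕ → Status} (j : ℕ)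
    (Ax : Anti (length x) (at x)) (Ay : Anti (length y) (at y))
    (j≤nx : j ℕ.≤ length x)
    (hX : ∀ i → 1 ℕ.≤ i → i ℕ.≤ length x → j ℕ.< i → fX i ≡ fX′ i)
    (hY : ∀ i → 1 ℕ.≤ i → i ℕ.≤ length y → 1ℤ + at y i ≤ at x j → fY i ≡ fY′ i) where

    private
      module A = Decision x y α fX fY j
      module B = Decision x y α fX′ fY′ j
      s nx ny : ℕ
      s = length α
      nx = length x
      ny = length y

      yIn≡ : ∀ i → 1 ℕ.≤ i → i ℕ.≤ ny → A.yInLt i ≡ B.yInLt i
      yIn≡ i a b with at y i <ᵇ at x j in e
      ... | true  = cong (λ t → isIn t ∧ true) (hY i a b (true⇒< e))
      ... | false = trans (∧-zeroʳ (isIn (fY i))) (sym (∧-zeroʳ (isIn (fY′ i))))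

      out≡ : ∀ i → 1 ℕ.≤ i → i ℕ.≤ nx → ((j ℕ.<ᵇ i) ∧ isOut (fX i)) ≡ ((j ℕ.<ᵇ i) ∧ isOut (fX′ i))
      out≡ i a b with j ℕ.<ᵇ i in e
      ... | true  = cong isOut (hX i a b (true⇒n< e))
      ... | false = refl

      out≡′ : ∀ i → 1 ℕ.≤ i → i ℕ.≤ nx → (isOut (fX i) ∧ (j ℕ.<ᵇ i)) ≡ (isOut (fX′ i) ∧ (j ℕ.<ᵇ i))
      out≡′ i a b = trans (∧-comm (isOut (fX i)) (j ℕ.<ᵇ i))
          (trans (out≡ i a b) (∧-comm (j ℕ.<ᵇ i) (isOut (fX′ i))))

      q≡ : A.q ≡ B.q
      q≡ = cong₂ (λ k o → (+ s) - (+ k) + (+ o) + 1ℤ) (count-cong ny yIn≡) (count-cong nx out≡)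

      l≡ : A.l ≡ B.l
      l≡ = findMin-cong ny yIn≡

      module _ (L : Least A.yInLt ny A.l) where
        open Least L
        yl<v : 1ℤ + at y A.l ≤ at x j
        yl<v = true⇒< (proj₂ (∧-true {isIn (fY A.l)} holds))

        c₁ : ∀ i → 1 ℕ.≤ i → i ℕ.≤ ny → (isIn (fY i) ∧ (A.l ℕ.<ᵇ i)) ≡ (isIn (fY′ i) ∧ (B.l ℕ.<ᵇ i))
        c₁ i a b rewrite sym l≡ with A.l ℕ.<ᵇ i in e
        ... | true  = cong (λ t → isIn t ∧ true)
                        (hY i a b (≤-trans (ℤP.+-monoʳ-≤ 1ℤ (Ay A.l i 1≤i (ℕ.<⇒≤ (true⇒n< e)) b)) yl<v))
        ... | false = trans (∧-zeroʳ (isIn (fY i))) (sym (∧-zeroʳ (isIn (fY′ i))))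

        c₂ : ∀ i → 1 ℕ.≤ i → i ℕ.≤ nx → (isOut (fX i) ∧ (at x i <ᵇ A.yl)) ≡ (isOut (fX′ i) ∧ (at x i <ᵇ B.yl))
        c₂ i a b rewrite sym l≡ with at x i <ᵇ A.yl in e
        ... | false = trans (∧-zeroʳ (isOut (fX i))) (sym (∧-zeroʳ (isOut (fX′ i))))
        ... | true with j ℕ.<? i
        ...   | yes p = cong (λ t → isOut t ∧ true) (hX i a b p)
        ...   | no ¬p = absurd (Ax i j a (ℕ.≮⇒≥ ¬p) j≤nx) (≤-trans (true⇒< e) (≤-trans (≤+1 A.yl) yl<v))

        N≡ : A.N′ ≡ B.N′
        N≡ = cong₃ (λ l k o → (+ count s (λ i → at y l <ᵇ at α i)) - (+ s) + (+ k) - (+ o) + 1ℤ)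
               l≡ (count-cong ny c₁) (count-cong nx c₂)
          where
          cong₃ : ∀ {A B C D : Set} (f : A → B → C → D) {a a′ b b′ c c′} →
            a ≡ a′ → b ≡ b′ → c ≡ c′ → f a b c ≡ f a′ b′ c′
          cong₃ f refl refl refl = refl

        ruleA≡ : A.ruleA ≡ B.ruleA
        ruleA≡ = cong₂ (λ l M → (1ℤ ≤ᵇ M) ∧ ((((+ EE l) - M) <ᵇ (+ A.pos′)) ∧ (A.pos′ ℕ.≤ᵇ EE l)) ∧
            (at y l <ᵇ at x j)) l≡ N≡
          where
          EE : ℕ → ℕ
          EE l = count (length (eTags α x)) (λ i → at y l <ᵇ at (eSeq α x) i)

        ruleB≡ : A.ruleB (tailSum α A.q) ≡ B.ruleB (tailSum α B.q)
        ruleB≡ rewrite q≡ with tailSum α B.q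
        ... | nothing = refl
        ... | just t  = cong₂ (λ R L → not ((R + at x j + t) ≤ᵇ L)) (sumWhere-cong nx (at x) out≡′)
            (sumWhere-cong ny (at y) yIn≡)

    -- Every count, sum and search in the rules is restricted to later indices of `x` or to entries
    -- of `y` below `x_j`. For the entries compared with `y_l` this uses `y_l < x_j`, which is known
    -- only when `q ≤ s`; hence the conditional comparison through `if-cong`.
    decide-cong : decide x y α fX fY j ≡ decide x y α fX′ fY′ j
    decide-cong = trans A.decide-unfold (trans
      (if-cong (cong ((+ s) <ᵇ_) q≡) λ e → cong₂ (if_then false else_)
         (ruleA≡ (q≤⇒least x y α fX fY j (false⇒≥ e))) (ruleB≡ (q≤⇒least x y α fX fY j (false⇒≥ e))))
      (sym B.decide-unfold))

  status : Bool → Status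
  status t = if t then inn else out

  -- The processing order

  down : ℕ → List ℕ
  down zero    = []
  down (suc n) = suc n ∷ down n

  reverse-range : ∀ n → reverse (range 1 n) ≡ down n
  reverse-range n = trans (cong reverse (map-upTo suc n)) (trans (reverse-applyUpTo suc n) (go n))
    where
    go : ∀ n → applyDownFrom suc n ≡ down n
    go zero    = refl
    go (suc n) = cong (suc n ∷_) (go n)

  ≡ᵇ-refl : ∀ i → (i ℕ.≡ᵇ i) ≡ true
  ≡ᵇ-refl zero    = refl
  ≡ᵇ-refl (suc i) = ≡ᵇ-refl i

  ≢⇒≡ᵇ-false : ∀ i j → i ≢ j → (i ℕ.≡ᵇ j) ≡ false
  ≢⇒≡ᵇ-false i j h with i ℕ.≡ᵇ j in e
  ... | false = refl
  ... | true  = ⊥-elim (h (ℕ.≡ᵇ⇒≡ i j (subst T (sym e) tt)))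

  update-same : ∀ f j s → update f j s j ≡ s
  update-same f j s rewrite ≡ᵇ-refl j = refl

  update-other : ∀ f {j i} s → i ≢ j → update f j s i ≡ f i
  update-other f {j} {i} s h rewrite ≢⇒≡ᵇ-false i j h = refl

  module Process (a d b c : List ℤ) (Ad : Anti (length d) (at d)) (Ac : Anti (length c) (at c)) where
    open Construction a d b c

    InRange : ℕ → ℕ → Item → Set
    InRange n m (cI i) = 1 ℕ.≤ i × i ℕ.≤ n
    InRange n m (dI i) = 1 ℕ.≤ i × i ℕ.≤ m

    infix 4 _⊏_
    -- Records just what `decide-cong` needs: after an entry come no larger index of its own
    -- sequence and no smaller value of the other one.
    _⊏_ : Item → Item → Set
    dI j ⊏ dI i = i ℕ.< j
    dI j ⊏ cI i = at d j ≤ at c i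
    cI j ⊏ cI i = i ℕ.< j
    cI j ⊏ dI i = at c j ≤ at d i

    weaken : ∀ {n m n′ m′} → n ℕ.≤ n′ → m ℕ.≤ m′ → ∀ {it} → InRange n m it → InRange n′ m′ it
    weaken p q {cI _} (a , b) = a , ℕ.≤-trans b p
    weaken p q {dI _} (a , b) = a , ℕ.≤-trans b q

    merge-nil : ∀ n′ → mergeP c d (down n′) [] ≡ map cI (down n′)
    merge-nil zero     = refl
    merge-nil (suc n′) = refl

    merge-range : ∀ n′ m′ → All (InRange n′ m′) (mergeP c d (down n′) (down m′))
    merge-range zero zero = []ᵃ
    merge-range zero (suc m′) = (s≤s z≤n , ℕ.≤-refl) ∷ᵃ All.map (λ {it} → weaken z≤n (ℕ.n≤1+n m′) {it})
        (merge-range zero m′)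
    merge-range (suc n′) zero = (s≤s z≤n , ℕ.≤-refl) ∷ᵃ
      subst (All (InRange (suc n′) zero)) (merge-nil n′)
          (All.map (λ {it} → weaken (ℕ.n≤1+n n′) z≤n {it}) (merge-range n′ zero))
    merge-range (suc n′) (suc m′) with at c (suc n′) <ᵇ at d (suc m′)
    ... | true  = (s≤s z≤n , ℕ.≤-refl) ∷ᵃ All.map (λ {it} → weaken (ℕ.n≤1+n n′) ℕ.≤-refl {it})
        (merge-range n′ (suc m′))
    ... | false = (s≤s z≤n , ℕ.≤-refl) ∷ᵃ All.map (λ {it} → weaken ℕ.≤-refl (ℕ.n≤1+n m′) {it})
        (merge-range (suc n′) m′)

    merge-sorted : ∀ n′ m′ → n′ ℕ.≤ n → m′ ℕ.≤ m → AllPairs _⊏_ (mergeP c d (down n′) (down m′))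
    merge-sorted zero zero _ _ = []ᵖ
    merge-sorted zero (suc m′) p q = All.map (λ {it} → h {it}) (merge-range zero m′) ∷ᵖ merge-sorted zero
        m′ p (ℕ.≤-trans (ℕ.n≤1+n m′) q)
      where
      h : ∀ {it} → InRange zero m′ it → dI (suc m′) ⊏ it
      h {cI _} (a , b) = ⊥-elim (ℕ.<⇒≱ a b)
      h {dI _} (a , b) = s≤s b
    merge-sorted (suc n′) zero p q =
      subst (All (cI (suc n′) ⊏_)) (merge-nil n′) (All.map (λ {it} → h {it}) (merge-range n′ zero))
        ∷ᵖ subst (AllPairs _⊏_) (merge-nil n′) (merge-sorted n′ zero (ℕ.≤-trans (ℕ.n≤1+n n′) p) q)
      where
      h : ∀ {it} → InRange n′ zero it → cI (suc n′) ⊏ it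
      h {cI _} (a , b) = s≤s b
      h {dI _} (a , b) = ⊥-elim (ℕ.<⇒≱ a b)
    merge-sorted (suc n′) (suc m′) p q with at c (suc n′) <ᵇ at d (suc m′) in e
    ... | true  = All.map (λ {it} → h {it}) (merge-range n′ (suc m′)) ∷ᵖ merge-sorted n′ (suc m′)
        (ℕ.≤-trans (ℕ.n≤1+n n′) p) q
      where
      h : ∀ {it} → InRange n′ (suc m′) it → cI (suc n′) ⊏ it
      h {cI _} (a , b) = s≤s b
      h {dI i} (a , b) = ≤-trans (≤+1 (at c (suc n′))) (≤-trans (true⇒< e) (Ad i (suc m′) a b q))
    ... | false = All.map (λ {it} → h {it}) (merge-range (suc n′) m′) ∷ᵖ merge-sorted (suc n′) m′ p
        (ℕ.≤-trans (ℕ.n≤1+n m′) q)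
      where
      h : ∀ {it} → InRange (suc n′) m′ it → dI (suc m′) ⊏ it
      h {cI i} (a , b) = ≤-trans (false⇒≥ e) (Ac i (suc n′) a b p)
      h {dI i} (a , b) = s≤s b

    merge-full : ∀ n′ m′ it → InRange n′ m′ it → it ∈ mergeP c d (down n′) (down m′)
    merge-full zero zero (cI _) (a , b) = ⊥-elim (ℕ.<⇒≱ a b)
    merge-full zero zero (dI _) (a , b) = ⊥-elim (ℕ.<⇒≱ a b)
    merge-full zero (suc m′) (cI _) (a , b) = ⊥-elim (ℕ.<⇒≱ a b)
    merge-full zero (suc m′) (dI i) (a , b) =
      [ (λ h → there (merge-full zero m′ (dI i) (a , ℕ.≤-pred h))) , (λ e → here (cong dI e)) ]′
          (ℕ.m≤n⇒m<n∨m≡n b)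
    merge-full (suc n′) zero (dI _) (a , b) = ⊥-elim (ℕ.<⇒≱ a b)
    merge-full (suc n′) zero (cI i) (a , b) =
      [ (λ h → there (subst (cI i ∈_) (merge-nil n′) (merge-full n′ zero (cI i) (a , ℕ.≤-pred h)))) ,
          (λ e → here (cong cI e)) ]′
        (ℕ.m≤n⇒m<n∨m≡n b)
    merge-full (suc n′) (suc m′) (cI i) (a , b) with at c (suc n′) <ᵇ at d (suc m′)
    ... | true  = [ (λ h → there (merge-full n′ (suc m′) (cI i) (a , ℕ.≤-pred h))) ,
        (λ e → here (cong cI e)) ]′ (ℕ.m≤n⇒m<n∨m≡n b)
    ... | false = there (merge-full (suc n′) m′ (cI i) (a , b))
    merge-full (suc n′) (suc m′) (dI i) (a , b) with at c (suc n′) <ᵇ at d (suc m′)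
    ... | true  = there (merge-full n′ (suc m′) (dI i) (a , b))
    ... | false = [ (λ h → there (merge-full (suc n′) m′ (dI i) (a , ℕ.≤-pred h))) ,
        (λ e → here (cong dI e)) ]′ (ℕ.m≤n⇒m<n∨m≡n b)

    run-c : ∀ its st i → All (_≢ cI i) its → proj₁ (run its st) i ≡ proj₁ st i
    run-c [] st i _ = refl
    run-c (cI j ∷ its) (fS , fΔ) i (h ∷ᵃ hs) = trans (run-c its _ i hs)
        (update-other fS _ (λ e → h (cong cI (sym e))))
    run-c (dI j ∷ its) (fS , fΔ) i (h ∷ᵃ hs) = run-c its _ i hs

    run-d : ∀ its st i → All (_≢ dI i) its → proj₂ (run its st) i ≡ proj₂ st i
    run-d [] st i _ = refl
    run-d (dI j ∷ its) (fS , fΔ) i (h ∷ᵃ hs) = trans (run-d its _ i hs)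
        (update-other fΔ _ (λ e → h (cong dI (sym e))))
    run-d (cI j ∷ its) (fS , fΔ) i (h ∷ᵃ hs) = run-d its _ i hs

    -- The items still to come change neither the status of `j` nor any status on which the decision
    -- depends, so the decision may be evaluated again in the final state.
    run-fix-d : ∀ its st j → AllPairs _⊏_ its → 1 ℕ.≤ j → j ℕ.≤ m → dI j ∈ its → let (gS , gΔ) = run its st in
      gΔ j ≡ status (decide d c a gΔ gS j)
    run-fix-d (it ∷ its) st j (_ ∷ᵖ hs) 1≤j j≤m (there e) = run-fix-d its (step st it) j hs 1≤j j≤m e
    run-fix-d (dI .j ∷ its) (fS , fΔ) j (h ∷ᵖ hs) 1≤j j≤m (here refl) =
      trans (run-d its st′ j (All.map (λ {it} → h₀ {it}) h)) (trans (update-same fΔ j _)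
        (cong status (decide-cong d c a j Ad Ac j≤m hX hY)))
      where
      st′ : State
      st′ = step (fS , fΔ) (dI j)
      h₀ : ∀ {it} → dI j ⊏ it → it ≢ dI j
      h₀ {dI _} p refl = ℕ.<-irrefl refl p
      hX : ∀ i → 1 ℕ.≤ i → i ℕ.≤ m → j ℕ.< i → fΔ i ≡ proj₂ (run its st′) i
      hX i _ _ j<i = sym (trans (run-d its st′ i (All.map (λ {it} → h₁ {it}) h))
          (update-other fΔ _ λ e → ℕ.<⇒≢ j<i (sym e)))
        where
        h₁ : ∀ {it} → dI j ⊏ it → it ≢ dI i
        h₁ {dI _} p refl = ℕ.<-asym p j<i
      hY : ∀ i → 1 ℕ.≤ i → i ℕ.≤ n → 1ℤ + at c i ≤ at d j → fS i ≡ proj₁ (run its st′) i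
      hY i _ _ ci<dj = sym (run-c its st′ i (All.map (λ {it} → h₁ {it}) h))
        where
        h₁ : ∀ {it} → dI j ⊏ it → it ≢ cI i
        h₁ {cI _} p refl = absurd p ci<dj

    run-fix-c : ∀ its st j → AllPairs _⊏_ its → 1 ℕ.≤ j → j ℕ.≤ n → cI j ∈ its → let (gS , gΔ) = run its st in
      gS j ≡ status (decide c d b gS gΔ j)
    run-fix-c (it ∷ its) st j (_ ∷ᵖ hs) 1≤j j≤n (there e) = run-fix-c its (step st it) j hs 1≤j j≤n e
    run-fix-c (cI .j ∷ its) (fS , fΔ) j (h ∷ᵖ hs) 1≤j j≤n (here refl) =
      trans (run-c its st′ j (All.map (λ {it} → h₀ {it}) h)) (trans (update-same fS j _)
        (cong status (decide-cong c d b j Ac Ad j≤n hX hY)))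
      where
      st′ : State
      st′ = step (fS , fΔ) (cI j)
      h₀ : ∀ {it} → cI j ⊏ it → it ≢ cI j
      h₀ {cI _} p refl = ℕ.<-irrefl refl p
      hX : ∀ i → 1 ℕ.≤ i → i ℕ.≤ n → j ℕ.< i → fS i ≡ proj₁ (run its st′) i
      hX i _ _ j<i = sym (trans (run-c its st′ i (All.map (λ {it} → h₁ {it}) h))
          (update-other fS _ λ e → ℕ.<⇒≢ j<i (sym e)))
        where
        h₁ : ∀ {it} → cI j ⊏ it → it ≢ cI i
        h₁ {cI _} p refl = ℕ.<-asym p j<i
      hY : ∀ i → 1 ℕ.≤ i → i ℕ.≤ m → 1ℤ + at d i ≤ at c j → fΔ i ≡ proj₂ (run its st′) i
      hY i _ _ di<cj = sym (run-d its st′ i (All.map (λ {it} → h₁ {it}) h))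
        where
        h₁ : ∀ {it} → cI j ⊏ it → it ≢ dI i
        h₁ {dI _} p refl = absurd p di<cj

    order≡ : order ≡ mergeP c d (down n) (down m)
    order≡ = cong₂ (mergeP c d) (reverse-range n) (reverse-range m)

    fix-Δ : ∀ j → 1 ℕ.≤ j → j ℕ.≤ m → stΔ j ≡ status (decide d c a stΔ stS j)
    fix-Δ j p q rewrite order≡ =
      run-fix-d _ _ j (merge-sorted n m ℕ.≤-refl ℕ.≤-refl) p q (merge-full n m (dI j) (p , q))

    fix-S : ∀ j → 1 ℕ.≤ j → j ℕ.≤ n → stS j ≡ status (decide c d b stS stΔ j)
    fix-S j p q rewrite order≡ =
      run-fix-c _ _ j (merge-sorted n m ℕ.≤-refl ℕ.≤-refl) p q (merge-full n m (cI j) (p , q))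

  Σ-suc : ∀ n f → Σ (suc n) f ≡ f 1 + Σ n (f ∘ suc)
  Σ-suc n f = trans (Σ-shift 1 n f) (cong (_+ Σ n (f ∘ suc)) (ℤP.+-identityʳ (f 1)))

  at-suc : ∀ z l {i} → 1 ℕ.≤ i → at (z ∷ l) (suc i) ≡ at l i
  at-suc z l (s≤s _) = refl

  Σ-at : ∀ (f : ℤ → ℤ) l → Σ (length l) (λ i → f (at l i)) ≡ ΣL f l
  Σ-at f [] = refl
  Σ-at f (z ∷ l) = trans (Σ-suc (length l) (λ i → f (at (z ∷ l) i)))
    (cong (λ t → f z + t) (trans (Σ-≡ (length l) (λ i p _ → cong f (at-suc z l p))) (Σ-at f l)))

  at-∈ : ∀ l {i} → 1 ℕ.≤ i → i ℕ.≤ length l → at l i ∈ l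
  at-∈ (z ∷ l) {suc zero} p q = here refl
  at-∈ (z ∷ l) {suc (suc i)} p (s≤s q) = there (at-∈ l (s≤s z≤n) q)

  sorted⇒Anti : ∀ l → AllPairs (λ x y → y ≤ x) l → Anti (length l) (at l)
  sorted⇒Anti (z ∷ l) (h ∷ᵖ hs) (suc zero) (suc zero) _ _ _ = ≤-refl
  sorted⇒Anti (z ∷ l) (h ∷ᵖ hs) (suc zero) (suc (suc j)) _ _ (s≤s q) = All.lookup h (at-∈ l (s≤s z≤n) q)
  sorted⇒Anti (z ∷ l) (h ∷ᵖ hs) (suc (suc i)) (suc (suc j)) _ (s≤s p) (s≤s q) = sorted⇒Anti l hs (suc i)
      (suc j) (s≤s z≤n) p q

  -- The rearrangement e

  module _ (α x : List ℤ) where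

    mergeE-Σ : ∀ (f : ETag → ℤ) is js → ΣL f (mergeE α x is js) ≡ ΣL (f ∘ αT) is + ΣL (f ∘ xT) js
    mergeE-Σ f [] js = trans (ΣL-map f xT js) (sym (ℤP.+-identityˡ _))
    mergeE-Σ f (i ∷ is) [] = trans (cong (λ t → f (αT i) + t) (ΣL-map f αT is)) (sym (ℤP.+-identityʳ _))
    mergeE-Σ f (i ∷ is) (j ∷ js) with at x j ≤ᵇ at α i | mergeE-Σ f is (j ∷ js) | mergeE-Σ f (i ∷ is) js
    ... | true  | r | _ = trans (cong (λ t → f (αT i) + t) r) (sym (ℤP.+-assoc (f (αT i)) _ _))
    ... | false | _ | r = trans (cong (λ t → f (xT j) + t) r)
                    (eq (f (xT j)) (f (αT i)) (ΣL (f ∘ αT) is) (ΣL (f ∘ xT) js))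
      where
      eq : ∀ a b c d → a + (b + c + d) ≡ b + c + (a + d)
      eq a b c d = solve (a ∷ b ∷ c ∷ d ∷ [])

    mergeE-All : ∀ {Q : ETag → Set} is js → All (Q ∘ αT) is → All (Q ∘ xT) js → All Q (mergeE α x is js)
    mergeE-All [] [] p q = []ᵃ
    mergeE-All [] (j ∷ js) p (q ∷ᵃ qs) = q ∷ᵃ mergeE-All [] js p qs
    mergeE-All (i ∷ []) [] (p ∷ᵃ ps) q = p ∷ᵃ []ᵃ
    mergeE-All (i ∷ i′ ∷ is) [] (p ∷ᵃ ps) q = p ∷ᵃ mergeE-All (i′ ∷ is) [] ps q
    mergeE-All (i ∷ is) (j ∷ js) (p ∷ᵃ ps) (q ∷ᵃ qs) with at x j ≤ᵇ at α i | mergeE-All is (j ∷ js) ps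
        (q ∷ᵃ qs) | mergeE-All (i ∷ is) js (p ∷ᵃ ps) qs
    ... | true  | r | _ = p ∷ᵃ r
    ... | false | _ | r = q ∷ᵃ r

    ≥α ≥x : ℕ → ℕ → Set
    ≥α i i′ = at α i′ ≤ at α i
    ≥x i i′ = at x i′ ≤ at x i
    ≥E : ETag → ETag → Set
    ≥E t t′ = tagVal α x t′ ≤ tagVal α x t

    mergeE-sorted : ∀ is js → AllPairs ≥α is → AllPairs ≥x js → AllPairs ≥E (mergeE α x is js)
    mergeE-sorted [] js p q = AllPairsP.map⁺ q
    mergeE-sorted (i ∷ is) [] p q = AllPairsP.map⁺ p
    mergeE-sorted (i ∷ is) (j ∷ js) (p ∷ᵖ ps) (q ∷ᵖ qs)
      with at x j ≤ᵇ at α i in e | mergeE-sorted is (j ∷ js) ps (q ∷ᵖ qs) | mergeE-sorted (i ∷ is) js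
          (p ∷ᵖ ps) qs
    ... | true  | r | _ = mergeE-All is (j ∷ js) p (true⇒≤ e ∷ᵃ All.map (λ h → ≤-trans h (true⇒≤ e)) q)
                    ∷ᵖ r
    ... | false | _ | r = mergeE-All (i ∷ is) js (α<x ∷ᵃ All.map (λ h → ≤-trans h α<x) p) q
                    ∷ᵖ r
      where
      α<x : at α i ≤ at x j
      α<x = ≤-trans (≤+1 (at α i)) (false⇒> e)

    eSeq-Σ : ∀ (f : ℤ → ℤ) → ΣL f (eSeq α x) ≡ Σ (length α) (f ∘ at α) + Σ (length x) (f ∘ at x)
    eSeq-Σ f = trans (ΣL-map f (tagVal α x) (eTags α x))
        (trans (mergeE-Σ (f ∘ tagVal α x) (range 1 (length α)) (range 1 (length x)))
      (cong₂ (λ l l′ → ΣL (f ∘ at α) l + ΣL (f ∘ at x) l′) (range-from 1 (length α))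
          (range-from 1 (length x))))

  from-sorted : ∀ n x → Anti n x → AllPairs (λ i i′ → x i′ ≤ x i) (range 1 n)
  from-sorted n x A rewrite range-from 1 n = go 1 n (s≤s z≤n) ℕ.≤-refl
    where
    go : ∀ r k → 1 ℕ.≤ r → r ℕ.+ k ℕ.≤ suc n → AllPairs (λ i i′ → x i′ ≤ x i) (from r k)
    go r zero _ _ = []ᵖ
    go r (suc k) p q = All.tabulate (λ {i} e → A r i p (ℕ.<⇒≤ (proj₁ (∈-from (suc r) k e)))
          (ℕ.≤-pred (ℕ.≤-trans (proj₂ (∈-from (suc r) k e)) (subst (ℕ._≤ suc n) (ℕ.+-suc r k) q))))
       ∷ᵖ go (suc r) k (s≤s z≤n) (subst (ℕ._≤ suc n) (ℕ.+-suc r k) q)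

  eSeq-Anti : ∀ α x → Anti (length α) (at α) → Anti (length x) (at x) →
      Anti (length (eSeq α x)) (at (eSeq α x))
  eSeq-Anti α x Aα Ax = sorted⇒Anti (eSeq α x)
    (AllPairsP.map⁺ (mergeE-sorted α x (range 1 (length α)) (range 1 (length x)) (from-sorted _ _ Aα)
        (from-sorted _ _ Ax)))

  module _ (α x : List ℤ) (Aα : Anti (length α) (at α)) (Ax : Anti (length x) (at x)) where

    -- Entries of `α` precede equal entries of `x`, so exactly the `α i ≥ x j` stand before `x j`.
    -- The offset `1ℤ + + j - + j₀` counts the entries of `x` from the current head up to `j`
    -- inclusive.
    posX-merge : ∀ i₀ k j₀ k′ j → 1 ℕ.≤ i₀ → i₀ ℕ.+ k ≡ suc (length α) → 1 ℕ.≤ j₀ → j₀ ℕ.≤ j →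
        j ℕ.< j₀ ℕ.+ k′ → j ℕ.≤ length x →
      + posX (mergeE α x (from i₀ k) (from j₀ k′)) j
          ≡ ΣL (λ i → (at x j ≤ᵇ at α i) · 1ℤ) (from i₀ k) + (1ℤ + + j - + j₀)
    posX-merge i₀ zero j₀ k′ j a b c d e f = go j₀ k′ d e
      where
      go : ∀ j₀ k′ → j₀ ℕ.≤ j → j ℕ.< j₀ ℕ.+ k′ → + posX (map xT (from j₀ k′)) j ≡ 0ℤ + (1ℤ + + j - + j₀)
      go j₀ zero p q = ⊥-elim (ℕ.<⇒≱ q (subst (ℕ._≤ j) (sym (ℕ.+-identityʳ j₀)) p))
      go j₀ (suc k′) p q with j₀ ℕ.≡ᵇ j in e
      ... | true = eq (+ j) (+ j₀) (cong +_ (ℕ.≡ᵇ⇒≡ j₀ j (subst T (sym e) tt)))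
        where
        eq : ∀ a b → b ≡ a → 1ℤ ≡ 0ℤ + (1ℤ + a - b)
        eq a b refl = solve (a ∷ [])
      ... | false = trans (cong (λ t → 1ℤ + t) (go (suc j₀) k′ (ℕ.≤∧≢⇒< p ne)
          (subst (j ℕ.<_) (ℕ.+-suc j₀ k′) q)))
                       (eq (+ j) (+ j₀))
        where
        ne : j₀ ≢ j
        ne h with subst T e (ℕ.≡⇒≡ᵇ j₀ j h)
        ... | ()
        eq : ∀ a b → 1ℤ + (0ℤ + (1ℤ + a - (1ℤ + b))) ≡ 0ℤ + (1ℤ + a - b)
        eq a b = solve (a ∷ b ∷ [])
    posX-merge i₀ (suc k) j₀ zero j a b c d e f = ⊥-elim (ℕ.<⇒≱ e (subst (ℕ._≤ j) (sym (ℕ.+-identityʳ j₀)) d))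
    posX-merge i₀ (suc k) j₀ (suc k′) j a b c d e f with at x j₀ ≤ᵇ at α i₀ in le
    ... | true rewrite ≤⇒true (≤-trans (Ax j₀ j c d f) (true⇒≤ le)) =
          trans (cong (λ t → 1ℤ + t) (posX-merge (suc i₀) k j₀ (suc k′) j (s≤s z≤n)
              (trans (sym (ℕ.+-suc i₀ k)) b) c d e f))
            (sym (ℤP.+-assoc 1ℤ (ΣL (λ i → (at x j ≤ᵇ at α i) · 1ℤ) (from (suc i₀) k)) (1ℤ + + j - + j₀)))
    ... | false with j₀ ℕ.≡ᵇ j in je
    ...   | true = eq (+ j) (+ j₀) (ΣL (λ i → (at x j ≤ᵇ at α i) · 1ℤ) (from i₀ (suc k))) (cong +_ j₀≡j)
              (trans (ΣL-≡ (from i₀ (suc k)) none) (zeros (from i₀ (suc k))))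
        where
        j₀≡j : j₀ ≡ j
        j₀≡j = ℕ.≡ᵇ⇒≡ j₀ j (subst T (sym je) tt)
        none : ∀ i → i ∈ from i₀ (suc k) → (at x j ≤ᵇ at α i) · 1ℤ ≡ 0ℤ
        none i i∈ with ∈-from i₀ (suc k) i∈
        ... | lo , hi rewrite >⇒false {at x j} (at α i)
                (≤-trans (ℤP.+-monoʳ-≤ 1ℤ (Aα i₀ i a lo (ℕ.≤-pred (subst (i ℕ.<_) b hi))))
                    (subst (λ t → 1ℤ + at α i₀ ≤ at x t) j₀≡j (false⇒> le))) = refl
        zeros : ∀ (l : List ℕ) → ΣL (λ _ → 0ℤ) l ≡ 0ℤ
        zeros []      = refl
        zeros (_ ∷ l) = trans (ℤP.+-identityˡ _) (zeros l)
        eq : ∀ a b s → b ≡ a → s ≡ 0ℤ → 1ℤ ≡ s + (1ℤ + a - b)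
        eq a b s refl refl = solve (a ∷ [])
    ...   | false = trans (cong (λ t → 1ℤ + t) (posX-merge i₀ (suc k) (suc j₀) k′ j a b (s≤s z≤n)
        (ℕ.≤∧≢⇒< d ne) (subst (j ℕ.<_) (ℕ.+-suc j₀ k′) e) f))
                       (eq (+ j) (+ j₀) (ΣL (λ i → (at x j ≤ᵇ at α i) · 1ℤ) (from i₀ (suc k))))
        where
        ne : j₀ ≢ j
        ne h with subst T je (ℕ.≡⇒≡ᵇ j₀ j h)
        ... | ()
        eq : ∀ a b s → 1ℤ + (s + (1ℤ + a - (1ℤ + b))) ≡ s + (1ℤ + a - b)
        eq a b s = solve (a ∷ b ∷ s ∷ [])

    posX-eTags : ∀ j → 1 ℕ.≤ j → j ℕ.≤ length x →
      + posX (eTags α x) j ≡ Σ (length α) (λ i → (at x j ≤ᵇ at α i) · 1ℤ) + + j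
    posX-eTags j p q rewrite range-from 1 (length α) | range-from 1 (length x) =
      trans (posX-merge 1 (length α) 1 (length x) j ℕ.≤-refl refl ℕ.≤-refl p (s≤s q) q)
        (cong (λ t → Σ (length α) (λ i → (at x j ≤ᵇ at α i) · 1ℤ) + t) (eq (+ j)))
      where
      eq : ∀ a → 1ℤ + a - 1ℤ ≡ a
      eq a = solve (a ∷ [])

  count-at : ∀ l (p : ℤ → Bool) → + count (length l) (λ i → p (at l i)) ≡ ΣL (λ z → p z · 1ℤ) l
  count-at l p = trans (count-Σ (length l) (λ i → p (at l i))) (Σ-at (λ z → p z · 1ℤ) l)

  count-eSeq : ∀ α x X → + count (length (eTags α x)) (λ i → X <ᵇ at (eSeq α x) i)
    ≡ Σ (length α) (λ i → (X <ᵇ at α i) · 1ℤ) + Σ (length x) (λ i → (X <ᵇ at x i) · 1ℤ)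
  count-eSeq α x X =
    trans (cong (λ k → + count k (λ i → X <ᵇ at (eSeq α x) i)) (sym (length-map (tagVal α x) (eTags α x))))
      (trans (count-at (eSeq α x) (X <ᵇ_)) (eSeq-Σ α x (λ z → (X <ᵇ z) · 1ℤ)))

  -- Ranks of the selected entries

  record Index (f : ℕ → ℤ) (p : ℕ → Bool) (r k : ℕ) (xs : List ℤ) (y l : ℕ) : Set where
    constructor index
    field
      1≤y  : 1 ℕ.≤ y
      y≤h  : y ℕ.≤ length xs
      r≤l  : r ℕ.≤ l
      l<rk : l ℕ.< r ℕ.+ k
      pl   : p l ≡ true
      val  : at xs y ≡ f l
      -- An arbitrary summand `h` serves both uses: the constant `1ℤ` gives the number of later
      -- selected entries, the identity gives their sum.
      tail : ∀ (h : ℤ → ℤ) → Σ (length xs) (λ i → (y ℕ.<ᵇ i) · h (at xs i))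
               ≡ ΣL (λ i → (l ℕ.<ᵇ i) · (p i · h (f i))) (from r k)

  module _ (f : ℕ → ℤ) (p : ℕ → Bool) where
    sel : ℕ → ℕ → List ℤ
    sel r k = map f (filterᵇ p (from r k))

    ΣL-sel : ∀ (h : ℤ → ℤ) r k → ΣL h (sel r k) ≡ ΣL (λ i → p i · h (f i)) (from r k)
    ΣL-sel h r k = trans (ΣL-map h f (filterᵇ p (from r k))) (ΣL-filter (h ∘ f) p (from r k))

    skip : ∀ {r k l xs y} → p r ≡ false → Index f p (suc r) k xs y l → Index f p r (suc k) xs y l
    skip {r} {k} {l} e (index a b c d pl v t) = index a b (ℕ.<⇒≤ c) (subst (l ℕ.<_) (sym (ℕ.+-suc r k)) d)
        pl v
      (λ h → trans (t h) (trans (sym (ℤP.+-identityˡ _))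
          (cong (_+ ΣL (λ i → (l ℕ.<ᵇ i) · (p i · h (f i))) (from (suc r) k)) (sym (zero′ h)))))
      where
      zero′ : ∀ (h : ℤ → ℤ) → (l ℕ.<ᵇ r) · (p r · h (f r)) ≡ 0ℤ
      zero′ h rewrite n≥⇒false (ℕ.<⇒≤ c) = refl

    shift : ∀ {r k l xs y} → Index f p (suc r) k xs y l → Index f p r (suc k) (f r ∷ xs) (suc y) l
    shift {r} {k} {l} {xs} {y} (index a b c d pl v t) = index (s≤s z≤n) (s≤s b) (ℕ.<⇒≤ c)
        (subst (l ℕ.<_) (sym (ℕ.+-suc r k)) d) pl
      (trans (at-suc (f r) xs a) v)
      λ h → trans (Σ-suc (length xs) (λ i → (suc y ℕ.<ᵇ i) · h (at (f r ∷ xs) i)))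
        (cong₂ _+_ (sym (zero′ h)) (trans (Σ-≡ (length xs)
            (λ i 1≤i _ → cong (λ z → (y ℕ.<ᵇ i) · h z) (at-suc (f r) xs 1≤i))) (t h)))
      where
      zero′ : ∀ (h : ℤ → ℤ) → (l ℕ.<ᵇ r) · (p r · h (f r)) ≡ 0ℤ
      zero′ h rewrite n≥⇒false (ℕ.<⇒≤ c) = refl

    start : ∀ r k → p r ≡ true → Index f p r (suc k) (f r ∷ sel (suc r) k) 1 r
    start r k e = index ℕ.≤-refl (s≤s z≤n) ℕ.≤-refl (ℕ.m<m+n r (s≤s z≤n)) e refl
      λ h → trans (Σ-suc (length xs) (λ i → (1 ℕ.<ᵇ i) · h (at (f r ∷ xs) i)))
        (cong₂ _+_ (sym (zero′ h)) (trans (Σ-≡ (length xs) (pw h))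
            (trans (Σ-at h xs) (trans (ΣL-sel h (suc r) k) (ΣL-≡ (from (suc r) k) (pw′ h))))))
      where
      xs : List ℤ
      xs = sel (suc r) k
      zero′ : ∀ (h : ℤ → ℤ) → (r ℕ.<ᵇ r) · (p r · h (f r)) ≡ 0ℤ
      zero′ h rewrite n≥⇒false (ℕ.≤-refl {r}) = refl
      pw : ∀ (h : ℤ → ℤ) i → 1 ℕ.≤ i → i ℕ.≤ length xs → (1 ℕ.<ᵇ suc i) · h (at (f r ∷ xs) (suc i))
          ≡ h (at xs i)
      pw h (suc i) _ _ = refl
      pw′ : ∀ (h : ℤ → ℤ) i → i ∈ from (suc r) k → p i · h (f i) ≡ (r ℕ.<ᵇ i) · (p i · h (f i))
      pw′ h i e rewrite n<⇒true (proj₁ (∈-from (suc r) k e)) = refl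

    fwd : ∀ r k y → 1 ℕ.≤ y → y ℕ.≤ length (sel r k) → ∃[ l ] Index f p r k (sel r k) y l
    fwd r zero y a b = ⊥-elim (ℕ.<⇒≱ a b)
    fwd r (suc k) y a b with p r in e
    ... | false with fwd (suc r) k y a b
    ...   | l , I = l , skip e I
    fwd r (suc k) (suc zero) a b | true = r , start r k e
    fwd r (suc k) (suc (suc y)) a (s≤s b) | true with fwd (suc r) k (suc y) (s≤s z≤n) b
    ...   | l , I = l , shift I

    bwd : ∀ r k l → r ℕ.≤ l → l ℕ.< r ℕ.+ k → p l ≡ true → ∃[ y ] Index f p r k (sel r k) y l
    bwd r zero l a b _ = ⊥-elim (ℕ.<⇒≱ b (subst (ℕ._≤ l) (sym (ℕ.+-identityʳ r)) a))
    bwd r (suc k) l a b pl with ℕ.m≤n⇒m<n∨m≡n a | p r in e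
    ... | inj₂ refl | true = 1 , start r k e
    ... | inj₂ refl | false with trans (sym pl) e
    ...   | ()
    bwd r (suc k) l a b pl | inj₁ c | false with bwd (suc r) k l c (subst (l ℕ.<_) (ℕ.+-suc r k) b) pl
    ...   | y , I = y , skip e I
    bwd r (suc k) l a b pl | inj₁ c | true with bwd (suc r) k l c (subst (l ℕ.<_) (ℕ.+-suc r k) b) pl
    ...   | y , I = suc y , shift I

  firstIndex : ∀ n p → (∃[ i ] Least p n i) ⊎ (∀ i → 1 ℕ.≤ i → i ℕ.≤ n → p i ≡ false)
  firstIndex n p with findMin-spec n p
  ... | inj₁ L = inj₁ (_ , L)
  ... | inj₂ (_ , none) = inj₂ none

  lower : ∀ n (x : ℕ → ℤ) v → Σ[ b ∈ ℤ ] b ≤ v × (∀ i → 1 ℕ.≤ i → i ℕ.≤ n → 1ℤ + b ≤ x i)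
  lower zero x v = v , ≤-refl , λ i a b → ⊥-elim (ℕ.<⇒≱ a b)
  lower (suc n) x v with lower n x v
  ... | b , b≤v , h = b ℤ.⊓ (x (suc n) - 1ℤ) , ≤-trans (ℤP.i⊓j≤i b (x (suc n) - 1ℤ)) b≤v , below
    where
    eq : ∀ z → 1ℤ + (z - 1ℤ) ≡ z
    eq z = solve (z ∷ [])
    below : ∀ i → 1 ℕ.≤ i → i ℕ.≤ suc n → 1ℤ + (b ℤ.⊓ (x (suc n) - 1ℤ)) ≤ x i
    below i 1≤i i≤ with ℕ.m≤n⇒m<n∨m≡n i≤
    ... | inj₁ (s≤s q) = ≤-trans (ℤP.+-monoʳ-≤ 1ℤ (ℤP.i⊓j≤i b (x (suc n) - 1ℤ))) (h i 1≤i q)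
    ... | inj₂ refl = ≤-trans (ℤP.+-monoʳ-≤ 1ℤ (ℤP.i⊓j≤j b (x (suc n) - 1ℤ))) (≤-reflexive (eq (x (suc n))))

  above-all : ∀ n (x : ℕ → ℤ) v → Σ[ t ∈ ℤ ] v ≤ t × (∀ i → 1 ℕ.≤ i → i ℕ.≤ n → x i ≤ t)
  above-all zero x v = v , ≤-refl , λ i a b → ⊥-elim (ℕ.<⇒≱ a b)
  above-all (suc n) x v with above-all n x v
  ... | t , v≤t , h = t ℤ.⊔ x (suc n) , ≤-trans v≤t (ℤP.i≤i⊔j t (x (suc n))) , below
    where
    below : ∀ i → 1 ℕ.≤ i → i ℕ.≤ suc n → x i ≤ t ℤ.⊔ x (suc n)
    below i 1≤i i≤ with ℕ.m≤n⇒m<n∨m≡n i≤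
    ... | inj₁ (s≤s q) = ≤-trans (h i 1≤i q) (ℤP.i≤i⊔j t (x (suc n)))
    ... | inj₂ refl = ℤP.i≤j⊔i t (x (suc n))

  Σ-from : ∀ n j (b : ℕ → Bool) → 1 ℕ.≤ j → j ℕ.≤ n → b j ≡ true →
    Σ n (λ i → (j ℕ.≤ᵇ i) · (b i · 1ℤ)) ≡ 1ℤ + Σ n (λ i → (j ℕ.<ᵇ i) · (b i · 1ℤ))
  Σ-from n (suc j) b _ q e = trans (Σ-peel (λ i → b i · 1ℤ) j n q)
      (cong (λ t → t · 1ℤ + Σ n (λ i → (suc j ℕ.<ᵇ i) · (b i · 1ℤ))) e)

  ·-∧ : ∀ a b z → a · (b · z) ≡ (a ∧ b) · z
  ·-∧ true  b z = refl
  ·-∧ false b z = refl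

  -- Counts and hinge functions of chosen entries

  Nw : ℕ → (ℕ → ℤ) → (ℕ → Bool) → ℤ → ℤ
  Nw n x b v = Σ n (λ i → b i · ((x i ≤ᵇ v) · 1ℤ))

  Pw : ℕ → (ℕ → ℤ) → (ℕ → Bool) → ℤ → ℤ
  Pw n x b v = Σ n (λ i → b i · pos (v - x i))

  Pw-step : ∀ n x b v → Pw n x b (1ℤ + v) ≡ Pw n x b v + Nw n x b v
  Pw-step n x b v = Σ-≡₊ n λ i _ _ → pw (b i) (x i)
    where
    pw : ∀ c z → c · pos (1ℤ + v - z) ≡ c · pos (v - z) + c · ((z ≤ᵇ v) · 1ℤ)
    pw true  z = pos-step v z
    pw false z = refl

  Pw-low : ∀ n x b v → (∀ i → 1 ℕ.≤ i → i ℕ.≤ n → 1ℤ + v ≤ x i) → Pw n x b v ≡ 0ℤ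
  Pw-low n x b v h = Σ-≡0 n λ i p q → trans (cong (b i ·_) (pos-above (≤-trans (≤+1 v) (h i p q))))
      (·-0 (b i))

  Nw-low : ∀ n x b v → (∀ i → 1 ℕ.≤ i → i ℕ.≤ n → 1ℤ + v ≤ x i) → Nw n x b v ≡ 0ℤ
  Nw-low n x b v h = Σ-≡0 n λ i p q → trans (cong (λ t → b i · (t · 1ℤ)) (>⇒false v (h i p q))) (·-0 (b i))

  0≤Nw : ∀ n x b v → 0ℤ ≤ Nw n x b v
  0≤Nw n x b v = Σ-0≤ n λ i _ _ → ·-0≤ (b i) (0≤·1 (x i ≤ᵇ v))

  Nw-mono : ∀ n x b {u v} → u ≤ v → Nw n x b u ≤ Nw n x b v
  Nw-mono n x b {u} {v} h = Σ-≤ n λ i _ _ → pw (b i) (x i)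
    where
    pw : ∀ c z → c · ((z ≤ᵇ u) · 1ℤ) ≤ c · ((z ≤ᵇ v) · 1ℤ)
    pw false z = ≤-refl
    pw true  z with z ≤ᵇ u in e
    ... | false = 0≤·1 (z ≤ᵇ v)
    ... | true rewrite ≤⇒true (≤-trans (true⇒≤ {z} e) h) = ≤-refl

  -- (x, y, α) stands for (d, c, a) or, dually, for (c, d, b); Q j is the q_j of the construction.
  module Core (nx ny s : ℕ) (x y α : ℕ → ℤ) (inX outX inY : ℕ → Bool)
    (Ax : Anti nx x) (Ay : Anti ny y) (Aα : Anti s α)
    (x≢y : ∀ i j → 1 ℕ.≤ i → i ℕ.≤ nx → 1 ℕ.≤ j → j ℕ.≤ ny → x i ≢ y j)
    (compl : ∀ i → 1 ℕ.≤ i → i ℕ.≤ nx → outX i ≡ not (inX i)) where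

    cY cX Q : ℕ → ℤ
    cY j = Σ ny (λ i → (inY i ∧ (y i <ᵇ x j)) · 1ℤ)
    cX j = Σ nx (λ i → ((j ℕ.<ᵇ i) ∧ outX i) · 1ℤ)
    Q j = (+ s) - cY j + cX j + 1ℤ

    U : ℤ → ℤ
    U v = Σ ny (λ i → inY i · pos (v - y i)) - Σ nx (λ i → outX i · pos (v - x i))

    used unused : ℤ → ℤ
    used u = Nw ny y inY u - Nw nx x outX u
    unused u = + s - used u

    Pκ Nκ : ℤ → ℤ
    Pκ v = Pw nx x inX v + Pw ny y inY v
    Nκ v = Nw nx x inX v + Nw ny y inY v

    in+out : ∀ (f : ℕ → ℤ) → Σ nx (λ i → inX i · f i) + Σ nx (λ i → outX i · f i) ≡ Σ nx f
    in+out f = trans (sym (ΣL-+ (λ i → inX i · f i) (λ i → outX i · f i) (from 1 nx)))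
        (Σ-≡ nx λ i a b → pw i (compl i a b))
      where
      pw : ∀ i → outX i ≡ not (inX i) → inX i · f i + outX i · f i ≡ f i
      pw i e rewrite e with inX i
      ... | true  = ℤP.+-identityʳ (f i)
      ... | false = ℤP.+-identityˡ (f i)

    Pκ≡ : ∀ v → Pκ v ≡ P nx x v + U v
    Pκ≡ v = trans (eq (Pw nx x inX v) (Pw ny y inY v) (Pw nx x outX v))
        (cong (λ t → t + U v) (in+out (λ i → pos (v - x i))))
      where
      eq : ∀ a b c → a + b ≡ a + c + (b - c)
      eq a b c = solve (a ∷ b ∷ c ∷ [])

    Nκ≡ : ∀ v → Nκ v ≡ N nx x v + used v
    Nκ≡ v = trans (eq (Nw nx x inX v) (Nw ny y inY v) (Nw nx x outX v))
        (cong (λ t → t + used v) (in+out (λ i → (x i ≤ᵇ v) · 1ℤ)))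
      where
      eq : ∀ a b c → a + b ≡ a + c + (b - c)
      eq a b c = solve (a ∷ b ∷ c ∷ [])

    cY≤ : ∀ j v → x j ≤ v → cY j ≤ Nw ny y inY v
    cY≤ j v h = Σ-≤ ny λ i _ _ → pw (inY i) (y i)
      where
      pw : ∀ c z → (c ∧ (z <ᵇ x j)) · 1ℤ ≤ c · ((z ≤ᵇ v) · 1ℤ)
      pw false z = ≤-refl
      pw true  z with z <ᵇ x j in e
      ... | false = 0≤·1 (z ≤ᵇ v)
      ... | true rewrite ≤⇒true (≤-trans (≤+1 z) (≤-trans (true⇒< {z} e) h)) = ≤-refl

    cX-from : ∀ j → 1 ℕ.≤ j → j ℕ.≤ nx → outX j ≡ true → Σ nx (λ i → (j ℕ.≤ᵇ i) · (outX i · 1ℤ)) ≡ 1ℤ + cX j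
    cX-from j p q e = trans (Σ-from nx j outX p q e)
        (cong (λ t → 1ℤ + t) (Σ-≡ nx λ i _ _ → ·-∧ (j ℕ.<ᵇ i) (outX i) 1ℤ))

    out-count : ∀ j v → 1 ℕ.≤ j → j ℕ.≤ nx → outX j ≡ true →
      (∀ i → 1 ℕ.≤ i → i ℕ.< j → (outX i ∧ (x i ≤ᵇ v)) ≡ false) → Nw nx x outX v ≤ 1ℤ + cX j
    out-count j v 1≤j j≤nx e below = ≤-trans (Σ-≤ nx pw) (≤-reflexive (cX-from j 1≤j j≤nx e))
      where
      pw : ∀ i → 1 ℕ.≤ i → i ℕ.≤ nx → outX i · ((x i ≤ᵇ v) · 1ℤ) ≤ (j ℕ.≤ᵇ i) · (outX i · 1ℤ)
      pw i a b with j ℕ.≤? i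
      ... | yes p with j ℕ.≤ᵇ i | ℕ.≤⇒≤ᵇ p
      ...   | true | _ with outX i
      ...     | true  = ·1≤1 (x i ≤ᵇ v)
      ...     | false = ≤-refl
      pw i a b | no ¬p = ≤-trans (≤-reflexive (trans (·-∧ (outX i) (x i ≤ᵇ v) 1ℤ)
          (cong (_· 1ℤ) (below i a (ℕ.≰⇒> ¬p)))))
        (·-0≤ (j ℕ.≤ᵇ i) (0≤·1 (outX i)))

    -- Necessity: chosen entries are forced

    module Necessity
      (in⇒ : ∀ j → 1 ℕ.≤ j → j ℕ.≤ nx → inX j ≡ true → 1ℤ + + s ≤ Q j ⊎ 1ℤ + T₊ s α (Q j) (x j) ≤ U (x j))
      (w : ℕ) (g : ℕ → ℤ)
      (N≤ : ∀ u → N nx x u ≤ N w g u)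
      (P≤ : ∀ v → P w g v ≤ P nx x v + T₊ s α (+ s - N w g v + N nx x v) v) where

      -- Minimality of `j` confines the chosen `x` counted at `x j` to indices from `j` on, which
      -- bounds `Nκ` through `Q j`. If the first test chose `x j`, this bound is at most `N nx x`.
      -- Otherwise `Nκ > N w g` would make the q of `g` at least `Q j`, so `P w g` would be at most
      -- `P nx x + T₊ s α (Q j)`, which is less than `P nx x + U`, that is `Pκ`.
      forced : ∀ j → Least (λ i → inX i ∧ ((x i ≤ᵇ x j))) nx j → Pκ (x j) ≤ P w g (x j) → Nκ (x j)
          ≤ N w g (x j)
      forced j (least 1≤j j≤nx e below) Pκ≤ = cases (in⇒ j 1≤j j≤nx inj)
        where
        v : ℤ
        v = x j
        inj : inX j ≡ true
        inj = proj₁ (∧-true {inX j} e)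
        I : ℤ
        I = Σ nx (λ i → (j ℕ.<ᵇ i) · (inX i · 1ℤ))
        first : Nw nx x inX v ≤ 1ℤ + I
        first = ≤-trans (Σ-≤ nx pw) (≤-reflexive (Σ-from nx j inX 1≤j j≤nx inj))
          where
          pw : ∀ i → 1 ℕ.≤ i → i ℕ.≤ nx → inX i · ((x i ≤ᵇ v) · 1ℤ) ≤ (j ℕ.≤ᵇ i) · (inX i · 1ℤ)
          pw i a b with j ℕ.≤? i
          ... | yes p with j ℕ.≤ᵇ i | ℕ.≤⇒≤ᵇ p
          ...   | true | _ with inX i
          ...     | true  = ·1≤1 (x i ≤ᵇ v)
          ...     | false = ≤-refl
          pw i a b | no ¬p = ≤-trans (≤-reflexive (trans (·-∧ (inX i) (x i ≤ᵇ v) 1ℤ)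
              (cong (_· 1ℤ) (below i a (ℕ.≰⇒> ¬p)))))
            (·-0≤ (j ℕ.≤ᵇ i) (0≤·1 (inX i)))
        second : Nw ny y inY v ≤ cY j
        second = Σ-≤ ny pw
          where
          pw : ∀ i → 1 ℕ.≤ i → i ℕ.≤ ny → inY i · ((y i ≤ᵇ v) · 1ℤ) ≤ (inY i ∧ (y i <ᵇ x j)) · 1ℤ
          pw i a b with inY i
          ... | false = ≤-refl
          ... | true with y i ≤ᵇ v in e′
          ...   | false = 0≤·1 (y i <ᵇ x j)
          ...   | true rewrite <⇒true (y i) {x j} (ℤP.i<j⇒suc[i]≤j
              (ℤP.≤∧≢⇒< (true⇒≤ {y i} e′) (λ q → x≢y j i 1≤j j≤nx a b (sym q)))) = ≤-refl
        rest : I + cX j ≡ + nx - + j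
        rest = trans (cong (λ t → I + t) (Σ-≡ nx λ i _ _ → sym (·-∧ (j ℕ.<ᵇ i) (outX i) 1ℤ)))
          (trans (sym (ΣL-+ (λ i → (j ℕ.<ᵇ i) · (inX i · 1ℤ)) (λ i → (j ℕ.<ᵇ i) · (outX i · 1ℤ)) (from 1 nx)))
            (trans (Σ-≡ nx pw) (Σ-count> j nx j≤nx)))
          where
          pw : ∀ i → 1 ℕ.≤ i → i ℕ.≤ nx → (j ℕ.<ᵇ i) · (inX i · 1ℤ) + (j ℕ.<ᵇ i) · (outX i · 1ℤ)
              ≡ (j ℕ.<ᵇ i) · 1ℤ
          pw i a b rewrite compl i a b with j ℕ.<ᵇ i | inX i
          ... | false | _ = refl
          ... | true | true  = refl
          ... | true | false = refl
        Nx≥ : + nx - + j + 1ℤ ≤ N nx x v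
        Nx≥ = low j 1≤j j≤nx
          where
          low : ∀ j → 1 ℕ.≤ j → j ℕ.≤ nx → + nx - + j + 1ℤ ≤ N nx x (x j)
          low (suc j) _ q = ≤-trans (≤-reflexive (eq (+ nx) (+ j))) (N-low nx x Ax j (x (suc j)) q ≤-refl)
            where
            eq : ∀ n j → n - (1ℤ + j) + 1ℤ ≡ n - j
            eq n j = solve (n ∷ j ∷ [])
        Nκ≤ : Nκ v ≤ + nx - + j + 1ℤ + (1ℤ + + s - Q j)
        Nκ≤ = lin (first ⊕ second) (eq (+ nx) (+ j) (+ s) (cY j) (cX j) I (Nw nx x inX v) (Nw ny y inY v)
            (sym rest))
          where
          eq : ∀ n j s a b i f g → n - j ≡ i + b → n - j + 1ℤ + (1ℤ + s - (s - a + b + 1ℤ)) - (f + g)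
              ≡ 1ℤ + i + a - (f + g)
          eq n j s a b i f g e rewrite e = solve (s ∷ a ∷ b ∷ i ∷ f ∷ g ∷ [])
        cases : 1ℤ + + s ≤ Q j ⊎ 1ℤ + T₊ s α (Q j) (x j) ≤ U (x j) → Nκ v ≤ N w g v
        cases (inj₁ h) = ≤-trans (lin (Nκ≤ ⊕ h ⊕ Nx≥)
            (eq (Nκ v) (+ nx - + j + 1ℤ) (1ℤ + + s) (Q j) (N nx x v))) (N≤ v)
          where
          eq : ∀ a b c q n → n - a ≡ b + (c - q) + q + n - (a + c + b)
          eq a b c q n = solve (a ∷ b ∷ c ∷ q ∷ n ∷ [])
        cases (inj₂ h) with Nκ v ≤or> N w g v
        ... | inj₁ ok = ok
        ... | inj₂ bad = absurd {U v + P nx x v} {T₊ s α (Q j) v + P nx x v}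
              (≤-trans (≤-reflexive (trans (ℤP.+-comm (U v) (P nx x v)) (sym (Pκ≡ v))))
                  (≤-trans Pκ≤ (≤-trans (P≤ v)
                (≤-trans (ℤP.+-monoʳ-≤ (P nx x v) (T₊-anti s α {Q j} {+ s - N w g v + N nx x v} v
                    (lin (bad ⊕ Nκ≤ ⊕ Nx≥)
                    (eq′ (Nκ v) (+ nx - + j + 1ℤ) (+ s) (Q j) (N nx x v) (N w g v)))))
                  (≤-reflexive (ℤP.+-comm (P nx x v) (T₊ s α (Q j) v)))))))
              (lin h (eq (U v) (P nx x v) (T₊ s α (Q j) v)))
          where
          eq : ∀ u p t → u + p - (1ℤ + (t + p)) ≡ u - (1ℤ + t)
          eq u p t = solve (u ∷ p ∷ t ∷ [])
          eq′ : ∀ k b s q n g → s - g + n - q ≡ k + (b + (1ℤ + s - q)) + n - (1ℤ + g + k + b)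
          eq′ k b s q n g = solve (k ∷ b ∷ s ∷ q ∷ n ∷ g ∷ [])

    -- The terms missing from `T₊`, those with `i ≤ q`, have `α i ≥ v` and vanish.
    P≤T : ∀ q v → q ≤ M s α v → P s α v ≤ T₊ s α q v
    P≤T q v h = Σ-≤ s pw
      where
      pw : ∀ i → 1 ℕ.≤ i → i ℕ.≤ s → pos (v - α i) ≤ (q <ᵇ + i) · pos (v - α i)
      pw (suc i) a b with + suc i ≤or> q
      ... | inj₂ p rewrite <⇒true q p = ≤-refl
      ... | inj₁ p with v ≤or> α (suc i)
      ...   | inj₁ r = ≤-trans (≤-reflexive (pos-above r)) (·-0≤ (q <ᵇ + suc i) (0≤pos (v - α (suc i))))
      ...   | inj₂ r = absurd (≤-trans (≤-trans p h) (M-high s α Aα i v b r)) ≤-refl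

    M≤s : ∀ v → M s α v ≤ + s
    M≤s v = ≤-trans (Σ-≤ s (λ i _ _ → ·1≤1 (v ≤ᵇ α i))) (≤-reflexive (Σ-1 s))

    -- Condition (i) at y_l: its partial sum of e is the maximum over v of a linear minus a hinge function.
    Star : ℕ → ℤ → Set
    Star l v = Σ ny (λ i → (l ℕ.≤ᵇ i) · (inY i · (v - y i)))
      ≤ Σ nx (λ i → (outX i ∧ (x i <ᵇ y l)) · (v - x i)) + Σ nx (λ i → (y l <ᵇ x i) · pos (v - x i)) + P s α v

    -- The `t` and `m` of condition (i) at the chosen entry `y l`, indexed by `l` instead of its
    -- rank among the chosen entries.
    tl ml : ℕ → ℤ
    tl l = + s - Σ ny (λ i → (l ℕ.<ᵇ i) · (inY i · 1ℤ)) + Σ nx (λ i → (outX i ∧ (x i <ᵇ y l)) · 1ℤ)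
    ml l = Σ s (λ i → (y l <ᵇ α i) · 1ℤ)

    -- Sufficiency: κ satisfies the hinge inequality

    module Sufficiency
      (early : ∀ j → 1 ℕ.≤ j → j ℕ.≤ nx → Q j ≤ + s → Q j ≤ M s α (x j) → outX j ≡ true)
      (out⇒ : ∀ j → 1 ℕ.≤ j → j ℕ.≤ nx → outX j ≡ true → Q j ≤ + s ×
        (P s α (x j) ≤ T₊ s α (Q j) (x j) ⊎ U (x j) ≤ T₊ s α (Q j) (x j)))
      (star : ∀ l → 1 ℕ.≤ l → l ℕ.≤ ny → inY l ≡ true → tl l ≤ ml l → ∀ v → y l ≤ v → Star l v) where

      -- The least left-out index `j` with `x j ≤ u` accounts for all left-out entries up to `u`, so
      -- `used u` is at least `s − Q j`, and an entry is left out only if `Q j ≤ s`.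
      0≤used : ∀ u → 0ℤ ≤ used u
      0≤used u with firstIndex nx (λ i → outX i ∧ (x i ≤ᵇ u))
      ... | inj₂ none = lin (0≤Nw ny y inY u) (trans (cong (λ t → Nw ny y inY u - t - 0ℤ) zeros)
          (eq (Nw ny y inY u)))
        where
        zeros : Nw nx x outX u ≡ 0ℤ
        zeros = Σ-≡0 nx λ i a b → trans (·-∧ (outX i) (x i ≤ᵇ u) 1ℤ) (cong (_· 1ℤ) (none i a b))
        eq : ∀ a → a - 0ℤ - 0ℤ ≡ a - 0ℤ
        eq a = solve (a ∷ [])
      ... | inj₁ (j , least 1≤j j≤nx e below) =
        lin (proj₁ (out⇒ j 1≤j j≤nx (proj₁ (∧-true e))) ⊕ out-count j u 1≤j j≤nx (proj₁ (∧-true e)) below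
              ⊕ cY≤ j u (true⇒≤ {x j} (proj₂ (∧-true {outX j} e))))
          (eq (+ s) (cY j) (cX j) (Nw nx x outX u) (Nw ny y inY u))
        where
        eq : ∀ s a b o n → n - o - 0ℤ ≡ s + (1ℤ + b) + n - (s - a + b + 1ℤ + o + a)
        eq s a b o n = solve (s ∷ a ∷ b ∷ o ∷ n ∷ [])

      U-step : ∀ u → U (1ℤ + u) ≡ U u + used u
      U-step u rewrite Pw-step ny y inY u | Pw-step nx x outX u = eq (Pw ny y inY u) (Nw ny y inY u)
          (Pw nx x outX u) (Nw nx x outX u)
        where
        eq : ∀ a b c d → a + b - (c + d) ≡ a - c + (b - d)
        eq a b c d = solve (a ∷ b ∷ c ∷ d ∷ [])

      -- Some used entry of α still exceeds u, so every x since the last chosen y was left out, and Star applies.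
      pending : ∀ u → 1ℤ + unused u ≤ M s α (1ℤ + u) → U (1ℤ + u) ≤ P s α (1ℤ + u)
      pending u h with firstIndex ny (λ i → inY i ∧ (y i ≤ᵇ u))
      ... | inj₂ none = absurd {1ℤ + unused u} {+ s} (≤-trans h (M≤s (1ℤ + u)))
            (lin (0≤Nw nx x outX u) (trans (cong (λ t → 1ℤ + (+ s - (t - Nw nx x outX u)) - (1ℤ + + s))
                zeros) (eq (+ s) (Nw nx x outX u))))
        where
        zeros : Nw ny y inY u ≡ 0ℤ
        zeros = Σ-≡0 ny λ i a b → trans (·-∧ (inY i) (y i ≤ᵇ u) 1ℤ) (cong (_· 1ℤ) (none i a b))
        eq : ∀ s o → 1ℤ + (s - (0ℤ - o)) - (1ℤ + s) ≡ o - 0ℤ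
        eq s o = solve (s ∷ o ∷ [])
      ... | inj₁ (l , least 1≤l l≤ny e below) = ≤-trans U≤
          (lin (star l 1≤l l≤ny inl t≤m v (≤-trans X≤u (≤+1 u)))
              (eq″ Y₁ X₁ X₂ (P s α v)))
        where
        v X : ℤ
        v = 1ℤ + u
        X = y l
        inl : inY l ≡ true
        inl = proj₁ (∧-true e)
        X≤u : X ≤ u
        X≤u = true⇒≤ {X} (proj₂ (∧-true {inY l} e))
        Y₁ X₁ X₂ : ℤ
        Y₁ = Σ ny (λ i → (l ℕ.≤ᵇ i) · (inY i · (v - y i)))
        X₁ = Σ nx (λ i → (outX i ∧ (x i <ᵇ X)) · (v - x i))
        X₂ = Σ nx (λ i → (X <ᵇ x i) · pos (v - x i))
        eq″ : ∀ a b c d → d - (a - (b + c)) ≡ b + c + d - a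
        eq″ a b c d = solve (a ∷ b ∷ c ∷ d ∷ [])
        outs : ∀ i → 1 ℕ.≤ i → i ℕ.≤ nx → 1ℤ + X ≤ x i → x i ≤ u → outX i ≡ true
        outs i a b X<xi xi≤u = early i a b (≤-trans Qi≤ (≤-trans h (M≤s v)))
            (≤-trans Qi≤ (≤-trans h (M-anti s α (≤-trans xi≤u (≤+1 u)))))
          where
          Y≤ : Nw ny y inY u ≤ cY i
          Y≤ = Σ-≤ ny pw
            where
            pw : ∀ k → 1 ℕ.≤ k → k ℕ.≤ ny → inY k · ((y k ≤ᵇ u) · 1ℤ) ≤ (inY k ∧ (y k <ᵇ x i)) · 1ℤ
            pw k p q with k ℕ.<? l
            ... | yes k<l = ≤-trans (≤-reflexive (trans (·-∧ (inY k) (y k ≤ᵇ u) 1ℤ)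
                (cong (_· 1ℤ) (below k p k<l)))) (0≤·1 (inY k ∧ (y k <ᵇ x i)))
            ... | no ¬p rewrite <⇒true (y k) {x i} (≤-trans (ℤP.+-monoʳ-≤ 1ℤ (Ay l k 1≤l (ℕ.≮⇒≥ ¬p) q))
                X<xi) with inY k
            ...   | true  = ·1≤1 (y k ≤ᵇ u)
            ...   | false = ≤-refl
          X≤ : cX i ≤ Nw nx x outX u
          X≤ = Σ-≤ nx pw
            where
            pw : ∀ k → 1 ℕ.≤ k → k ℕ.≤ nx → ((i ℕ.<ᵇ k) ∧ outX k) · 1ℤ ≤ outX k · ((x k ≤ᵇ u) · 1ℤ)
            pw k p q with i ℕ.<ᵇ k in e′
            ... | false = ·-0≤ (outX k) (0≤·1 (x k ≤ᵇ u))
            ... | true rewrite ≤⇒true (≤-trans (Ax i k a (ℕ.<⇒≤ (true⇒n< {i} {k} e′)) q) xi≤u) = ≤-refl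
          Qi≤ : Q i ≤ 1ℤ + unused u
          Qi≤ = lin (Y≤ ⊕ X≤) (eq (+ s) (cY i) (cX i) (Nw ny y inY u) (Nw nx x outX u))
            where
            eq : ∀ s a b c d → 1ℤ + (s - (c - d)) - (s - a + b + 1ℤ) ≡ a + d - (c + b)
            eq s a b c d = solve (s ∷ a ∷ b ∷ c ∷ d ∷ [])
        t≤m : tl l ≤ ml l
        t≤m = ≤-trans (lin (Y≤ ⊕ X≤) (eq (+ s) (Nw ny y inY u) (Nw nx x outX u)
            (Σ ny (λ i → (l ℕ.<ᵇ i) · (inY i · 1ℤ))) (Σ nx (λ i → (outX i ∧ (x i <ᵇ X)) · 1ℤ))))
                (≤-trans h (Σ-≤ s λ i _ _ → pwα (α i)))
          where
          eq : ∀ s a b c d → 1ℤ + (s - (a - b)) - (s - c + d) ≡ 1ℤ + c + b - (a + d)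
          eq s a b c d = solve (s ∷ a ∷ b ∷ c ∷ d ∷ [])
          pwα : ∀ z → (v ≤ᵇ z) · 1ℤ ≤ (X <ᵇ z) · 1ℤ
          pwα z with v ≤ᵇ z in e′
          ... | false = 0≤·1 (X <ᵇ z)
          ... | true rewrite <⇒true X (≤-trans (ℤP.+-monoʳ-≤ 1ℤ X≤u) (true⇒≤ {v} e′)) = ≤-refl
          Y≤ : Nw ny y inY u ≤ 1ℤ + Σ ny (λ i → (l ℕ.<ᵇ i) · (inY i · 1ℤ))
          Y≤ = ≤-trans (Σ-≤ ny pw) (≤-reflexive (Σ-from ny l inY 1≤l l≤ny inl))
            where
            pw : ∀ i → 1 ℕ.≤ i → i ℕ.≤ ny → inY i · ((y i ≤ᵇ u) · 1ℤ) ≤ (l ℕ.≤ᵇ i) · (inY i · 1ℤ)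
            pw i a b with l ℕ.≤? i
            ... | yes p with l ℕ.≤ᵇ i | ℕ.≤⇒≤ᵇ p
            ...   | true | _ with inY i
            ...     | true  = ·1≤1 (y i ≤ᵇ u)
            ...     | false = ≤-refl
            pw i a b | no ¬p = ≤-trans (≤-reflexive (trans (·-∧ (inY i) (y i ≤ᵇ u) 1ℤ)
                (cong (_· 1ℤ) (below i a (ℕ.≰⇒> ¬p)))))
              (·-0≤ (l ℕ.≤ᵇ i) (0≤·1 (inY i)))
          X≤ : Σ nx (λ i → (outX i ∧ (x i <ᵇ X)) · 1ℤ) ≤ Nw nx x outX u
          X≤ = Σ-≤ nx λ i _ _ → pw (outX i) (x i)
            where
            pw : ∀ c z → (c ∧ (z <ᵇ X)) · 1ℤ ≤ c · ((z ≤ᵇ u) · 1ℤ)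
            pw false z = ≤-refl
            pw true  z with z <ᵇ X in e′
            ... | false = 0≤·1 (z ≤ᵇ u)
            ... | true rewrite ≤⇒true (≤-trans (≤+1 z) (≤-trans (true⇒< {z} e′) X≤u)) = ≤-refl
        U≤ : U v ≤ Y₁ - (X₁ + X₂)
        U≤ = lin (Σ-≤ ny pwY ⊕ Σ-₊≤ nx pwX) (eq Y₁ X₁ X₂ (Pw ny y inY v) (Pw nx x outX v))
          where
          eq : ∀ a b c d e → a - (b + c) - (d - e) ≡ a + e - (d + (b + c))
          eq a b c d e = solve (a ∷ b ∷ c ∷ d ∷ e ∷ [])
          pwY : ∀ i → 1 ℕ.≤ i → i ℕ.≤ ny → inY i · pos (v - y i) ≤ (l ℕ.≤ᵇ i) · (inY i · (v - y i))
          pwY i a b with l ℕ.≤? i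
          ... | yes p with l ℕ.≤ᵇ i | ℕ.≤⇒≤ᵇ p
          ...   | true | _ = ≤-reflexive (cong (inY i ·_)
              (pos-below (≤-trans (Ay l i 1≤l p b) (≤-trans X≤u (≤+1 u)))))
          pwY i a b | no ¬p with l ℕ.≤ᵇ i in e′
          ...   | true = ⊥-elim (¬p (ℕ.≤ᵇ⇒≤ l i (subst T (sym e′) tt)))
          ...   | false with inY i | below i a (ℕ.≰⇒> ¬p)
          ...     | false | _ = ≤-refl
          ...     | true  | f = ≤-reflexive (pos-above (false⇒> {y i} {u} f))
          pwX : ∀ i → 1 ℕ.≤ i → i ℕ.≤ nx → (outX i ∧ (x i <ᵇ X)) · (v - x i) + (X <ᵇ x i) · pos (v - x i)
              ≤ outX i · pos (v - x i)
          pwX i a b with x i ≤or> X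
          ... | inj₁ p rewrite ≥⇒false {X} {x i} p | pos-below {v} {x i} (≤-trans p (≤-trans X≤u (≤+1 u)))
              with outX i
          ...   | false = ≤-refl
          ...   | true with x i <ᵇ X
          ...     | true  = ≤-reflexive (ℤP.+-identityʳ (v - x i))
          ...     | false = ℤP.i≤j⇒0≤j-i (≤-trans p (≤-trans X≤u (≤+1 u)))
          pwX i a b | inj₂ p rewrite <⇒true X p | ≥⇒false {x i} {X} (≤-trans (≤+1 X) p) with x i ≤or> u
          ...   | inj₁ q rewrite outs i a b p q = ≤-reflexive (ℤP.+-identityˡ (pos (v - x i)))
          ...   | inj₂ q rewrite pos-above {v} {x i} q with outX i
          ...     | true  = ≤-refl
          ...     | false = ≤-refl

      -- Raises the threshold while q stays at its value for `u`. Either `pending` applies and `T₊`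
      -- is all of `P s α`; or the `α i` with `i > q` are at most `u`, and then `T₊` grows by
      -- `s − q = used u`, exactly as `U` does.
      advance : ∀ u → U u ≤ T₊ s α (unused u) u → U (1ℤ + u) ≤ T₊ s α (unused u) (1ℤ + u)
      advance u h with (1ℤ + unused u) ≤or> M s α (1ℤ + u)
      ... | inj₁ p = ≤-trans (pending u p) (P≤T (unused u) (1ℤ + u) (≤-trans (≤+1 (unused u)) p))
      ... | inj₂ p = ≤-trans (≤-reflexive (U-step u))
          (≤-trans (lin (h ⊕ tail (unused u) refl) (eq (U u) (used u) (+ s) (T₊ s α (unused u) u) C))
              (≤-trans (Σ-₊≤ s pw) ≤-refl))
        where
        C : ℤ
        C = Σ s (λ i → (unused u <ᵇ + i) · 1ℤ)
        M≤unused : M s α (1ℤ + u) ≤ unused u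
        M≤unused = lin p (eq₀ (M s α (1ℤ + u)) (unused u))
          where
          eq₀ : ∀ a b → b - a ≡ 1ℤ + b - (1ℤ + a)
          eq₀ a b = solve (a ∷ b ∷ [])
        eq : ∀ a b s t c → t + c - (a + b) ≡ t + c - (a + (s - (s - b)))
        eq a b s t c = solve (a ∷ b ∷ s ∷ t ∷ c ∷ [])
        tail : ∀ q → unused u ≡ q → + s - q ≤ Σ s (λ i → (q <ᵇ + i) · 1ℤ)
        tail -[1+ q ] e = absurd {0ℤ} { -[1+ q ]} (subst (0ℤ ≤_) e (≤-trans (0≤M s α (1ℤ + u)) M≤unused))
            (ℤP.i<j⇒suc[i]≤j { -[1+ q ]} {0ℤ} ℤ.-<+)
        tail (+ q) e = ≤-reflexive (trans (sym (Σ-count> q s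
            (≤+ (subst (_≤ + s) e (lin (0≤used u) (eq₁ (+ s) (used u)))))))
            (Σ-≡ s λ i _ _ → cong (_· 1ℤ) (sym (+<ᵇ q i))))
          where
          eq₁ : ∀ s b → s - (s - b) ≡ b - 0ℤ
          eq₁ s b = solve (s ∷ b ∷ [])
        pw : ∀ i → 1 ℕ.≤ i → i ℕ.≤ s → (unused u <ᵇ + i) · pos (u - α i) + (unused u <ᵇ + i) · 1ℤ
            ≤ (unused u <ᵇ + i) · pos (1ℤ + u - α i)
        pw i a b with unused u <ᵇ + i in e
        ... | false = ≤-refl
        ... | true with α i ≤or> u
        ...   | inj₁ r rewrite pos-step u (α i) | ≤⇒true r = ≤-refl
        ...   | inj₂ r = absurd (≤-trans (M-low s α Aα i (1ℤ + u) a b r) M≤unused) (true⇒< {unused u} {+ i} e)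

      -- Updates q at a fixed threshold. A smaller q only enlarges `T₊`. The number q can rise only
      -- if some `x j = 1ℤ + u` was left out, and the rule that left it out bounds `U` with `Q j`,
      -- which is at least the new q.
      settle : ∀ u → U (1ℤ + u) ≤ T₊ s α (unused u) (1ℤ + u) → U (1ℤ + u) ≤ T₊ s α (unused (1ℤ + u)) (1ℤ + u)
      settle u h with firstIndex nx (λ i → outX i ∧ (x i ≤ᵇ (1ℤ + u)))
      ... | inj₂ none = ≤-trans h (T₊-anti s α {unused (1ℤ + u)} {unused u} (1ℤ + u)
              (lin (Nw-mono ny y inY (≤+1 u) ⊕ 0≤Nw nx x outX u)
                  (trans (cong (λ t → unused u - (+ s - (Nw ny y inY (1ℤ + u) - t))) zeros)
                 (eq (+ s) (Nw ny y inY u) (Nw ny y inY (1ℤ + u)) (Nw nx x outX u)))))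
        where
        zeros : Nw nx x outX (1ℤ + u) ≡ 0ℤ
        zeros = Σ-≡0 nx λ i a b → trans (·-∧ (outX i) (x i ≤ᵇ (1ℤ + u)) 1ℤ) (cong (_· 1ℤ) (none i a b))
        eq : ∀ s a b o → s - (a - o) - (s - (b - 0ℤ)) ≡ b + o - (a + 0ℤ)
        eq s a b o = solve (s ∷ a ∷ b ∷ o ∷ [])
      ... | inj₁ (j , least 1≤j j≤nx e below) with (1ℤ + u) ≤or> x j
      ...   | inj₁ p = ≤-trans (cases (proj₂ (out⇒ j 1≤j j≤nx outj)))
          (T₊-anti s α {unused v} {Q j} v unused≤Q)
        where
        v : ℤ
        v = 1ℤ + u
        outj : outX j ≡ true
        outj = proj₁ (∧-true e)
        xj≤v : x j ≤ v
        xj≤v = true⇒≤ {x j} (proj₂ (∧-true {outX j} e))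
        xj≡v : x j ≡ v
        xj≡v = ≤-antisym xj≤v p
        cases : P s α (x j) ≤ T₊ s α (Q j) (x j) ⊎ U (x j) ≤ T₊ s α (Q j) (x j) → U v ≤ T₊ s α (Q j) v
        cases (inj₁ r) = ≤-trans h (≤-trans (T₊≤P s α (unused u) v)
            (subst (λ z → P s α z ≤ T₊ s α (Q j) z) xj≡v r))
        cases (inj₂ r) = subst (λ z → U z ≤ T₊ s α (Q j) z) xj≡v r
        unused≤Q : unused v ≤ Q j
        unused≤Q = lin (cY≤ j v xj≤v ⊕ out-count j v 1≤j j≤nx outj below)
            (eq (+ s) (cY j) (cX j) (Nw ny y inY v) (Nw nx x outX v))
          where
          eq : ∀ s a b c d → s - a + b + 1ℤ - (s - (c - d)) ≡ c + (1ℤ + b) - (a + d)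
          eq s a b c d = solve (s ∷ a ∷ b ∷ c ∷ d ∷ [])
      ...   | inj₂ p = ≤-trans h (T₊-anti s α {unused (1ℤ + u)} {unused u} (1ℤ + u)
              (lin (Nw-mono ny y inY (≤+1 u) ⊕ Σ-≤ nx pw) (eq (+ s) (Nw ny y inY u) (Nw ny y inY (1ℤ + u))
                  (Nw nx x outX u) (Nw nx x outX (1ℤ + u)))))
        where
        eq : ∀ s a b o r → s - (a - o) - (s - (b - r)) ≡ b + o - (a + r)
        eq s a b o r = solve (s ∷ a ∷ b ∷ o ∷ r ∷ [])
        xj≤u : x j ≤ u
        xj≤u = lin p (eq₀ (x j) u)
          where
          eq₀ : ∀ a b → b - a ≡ 1ℤ + b - (1ℤ + a)
          eq₀ a b = solve (a ∷ b ∷ [])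
        pw : ∀ i → 1 ℕ.≤ i → i ℕ.≤ nx → outX i · ((x i ≤ᵇ (1ℤ + u)) · 1ℤ) ≤ outX i · ((x i ≤ᵇ u) · 1ℤ)
        pw i a b with i ℕ.<? j
        ... | yes q = ≤-trans (≤-reflexive (trans (·-∧ (outX i) (x i ≤ᵇ (1ℤ + u)) 1ℤ)
            (cong (_· 1ℤ) (below i a q)))) (·-0≤ (outX i) (0≤·1 (x i ≤ᵇ u)))
        ... | no ¬q rewrite ≤⇒true (≤-trans (Ax j i 1≤j (ℕ.≮⇒≥ ¬q) b) xj≤u) | ≤⇒true
            (≤-trans (Ax j i 1≤j (ℕ.≮⇒≥ ¬q) b) (≤-trans xj≤u (≤+1 u))) = ≤-refl

      -- The induction starts below every entry of `x` and `y`, where `U` is zero.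
      feasible : ∀ u → U u ≤ T₊ s α (unused u) u
      feasible u with lower nx x u
      ... | b₀ , b₀≤u , hx with lower ny y b₀
      ...   | b , b≤b₀ , hy with gap (≤-trans b≤b₀ b₀≤u)
      ...     | k , refl = go k
        where
        hx′ : ∀ i → 1 ℕ.≤ i → i ℕ.≤ nx → 1ℤ + b ≤ x i
        hx′ i p q = ≤-trans (ℤP.+-monoʳ-≤ 1ℤ b≤b₀) (hx i p q)
        go : ∀ k → U (+ k + b) ≤ T₊ s α (unused (+ k + b)) (+ k + b)
        go zero = subst (λ z → U z ≤ T₊ s α (unused z) z) (sym (ℤP.+-identityˡ b))
          (≤-trans (≤-reflexive (cong₂ _-_ (Pw-low ny y inY b hy) (Pw-low nx x outX b hx′)))
            (Σ-0≤ s λ i _ _ → ·-0≤ (unused b <ᵇ + i) (0≤pos (b - α i))))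
        go (suc k) rewrite ℤP.+-assoc 1ℤ (+ k) b = settle (+ k + b) (advance (+ k + b) (go k))

      -- Beyond `top`, `U` grows by `used top` per step and `P s α` by at most `s`. If
      -- `used top > s`, the difference `P s α − U` loses at least 1 per step; with `K` its value at
      -- `top`, or 0 if that is larger, it is negative after `K + 1` steps, against `feasible`.
      used≤s : ∀ top → (∀ i → 1 ℕ.≤ i → i ℕ.≤ nx → x i ≤ top) → (∀ i → 1 ℕ.≤ i → i ℕ.≤ ny → y i ≤ top) →
        (∀ i → 1 ℕ.≤ i → i ℕ.≤ s → α i ≤ top) → used top ≤ + s
      used≤s top x≤ y≤ α≤ with used top ≤or> + s
      ... | inj₁ h = h
      ... | inj₂ h with gap (ℤP.i≤i⊔j 0ℤ (P s α top - U top))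
      ...   | K , e = absurd {1ℤ + + K} {P s α top - U top} too-far
          (≤-trans (ℤP.+-monoʳ-≤ 1ℤ (ℤP.i≤j⊔i 0ℤ (P s α top - U top)))
              (≤-reflexive (cong (λ z → 1ℤ + z) (trans e (ℤP.+-identityʳ (+ K))))))
        where
        flat : ∀ n z b k → (∀ i → 1 ℕ.≤ i → i ℕ.≤ n → z i ≤ top) → Nw n z b (+ k + top) ≡ Nw n z b top
        flat n z b k z≤ = Σ-≡ n λ i p q → cong (λ t → b i · (t · 1ℤ))
            (trans (≤⇒true (≤-trans (z≤ i p q) (ℤP.i≤j+i top (+ k)))) (sym (≤⇒true (z≤ i p q))))
        grow : ∀ k → + k ≤ P s α top - U top - (P s α (+ k + top) - U (+ k + top))
        grow zero = ≤-reflexive (trans (eq₀ (P s α top - U top))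
            (cong (λ z → P s α top - U top - (P s α z - U z)) (sym (ℤP.+-identityˡ top))))
          where
          eq₀ : ∀ a → 0ℤ ≡ a - a
          eq₀ a = solve (a ∷ [])
        grow (suc k) rewrite ℤP.+-assoc 1ℤ (+ k) top | P-step s α (+ k + top) | U-step (+ k + top)
            | flat ny y inY k y≤ | flat nx x outX k x≤ =
          lin (grow k ⊕ N-≤ s α (+ k + top) ⊕ h) (eq (+ k) (P s α top) (U top) (P s α (+ k + top))
              (U (+ k + top)) (N s α (+ k + top)) (used top) (+ s))
          where
          eq : ∀ k a b c d n u s → a - b - (c + n - (d + u)) - (1ℤ + k)
              ≡ a - b - (c - d) + s + u - (k + n + (1ℤ + s))
          eq k a b c d n u s = solve (k ∷ a ∷ b ∷ c ∷ d ∷ n ∷ u ∷ s ∷ [])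
        too-far : 1ℤ + + K ≤ P s α top - U top
        too-far = lin (grow (suc K) ⊕ ≤-trans (feasible (+ suc K + top))
            (T₊≤P s α (unused (+ suc K + top)) (+ suc K + top)))
          (eq (P s α top) (U top) (P s α (+ suc K + top)) (U (+ suc K + top)) (+ suc K))
          where
          eq : ∀ a b c d k → a - b - k ≡ a - b - (c - d) + c - (k + d)
          eq a b c d k = solve (a ∷ b ∷ c ∷ d ∷ k ∷ [])

    bound⇒star : (∀ v → Pκ v ≤ P nx x v + P s α v) →
      ∀ l → 1 ℕ.≤ l → l ℕ.≤ ny → inY l ≡ true → ∀ v → y l ≤ v → Star l v
    bound⇒star bound l 1≤l l≤ny inl v X≤v =
      lin (bound v ⊕ Σ-≤ ny pwY ⊕ ≤-trans (Σ-≤₊ nx {g = λ i → inX i · pos (v - x i)}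
          {k = λ i → (outX i ∧ (x i <ᵇ X)) · (v - x i) + (X <ᵇ x i) · pos (v - x i)} pwX)
            (≤-reflexive (cong (λ t → Pw nx x inX v + t) (ΣL-+ (λ i → (outX i ∧ (x i <ᵇ X)) · (v - x i))
                (λ i → (X <ᵇ x i) · pos (v - x i)) (from 1 nx)))))
        (eq (Pw nx x inX v) (Pw ny y inY v) (P nx x v) (P s α v) S₁ S₂ S₄)
      where
      X S₁ S₂ S₄ : ℤ
      X = y l
      S₁ = Σ ny (λ i → (l ℕ.≤ᵇ i) · (inY i · (v - y i)))
      S₂ = Σ nx (λ i → (outX i ∧ (x i <ᵇ X)) · (v - x i))
      S₄ = Σ nx (λ i → (X <ᵇ x i) · pos (v - x i))
      eq : ∀ a b p q s t u → t + u + q - s ≡ p + q + b + (a + (t + u)) - (a + b + s + p)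
      eq a b p q s t u = solve (a ∷ b ∷ p ∷ q ∷ s ∷ t ∷ u ∷ [])
      pwY : ∀ i → 1 ℕ.≤ i → i ℕ.≤ ny → (l ℕ.≤ᵇ i) · (inY i · (v - y i)) ≤ inY i · pos (v - y i)
      pwY i _ _ with l ℕ.≤ᵇ i | inY i
      ... | false | c = ·-0≤ c (0≤pos (v - y i))
      ... | true | false = ≤-refl
      ... | true | true  = ≤pos (v - y i)
      pwX : ∀ i → 1 ℕ.≤ i → i ℕ.≤ nx → pos (v - x i)
        ≤ inX i · pos (v - x i) + ((outX i ∧ (x i <ᵇ X)) · (v - x i) + (X <ᵇ x i) · pos (v - x i))
      pwX i a b rewrite compl i a b with inX i
      ... | true = lin (·-0≤ (X <ᵇ x i) (0≤pos (v - x i))) (eq′ (pos (v - x i)) ((X <ᵇ x i) · pos (v - x i)))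
        where
        eq′ : ∀ p r → p + (0ℤ + r) - p ≡ r - 0ℤ
        eq′ p r = solve (p ∷ r ∷ [])
      ... | false with x i ≤or> X
      ...   | inj₁ p rewrite <⇒true (x i) {X} (ℤP.i<j⇒suc[i]≤j (ℤP.≤∧≢⇒< p (x≢y i l a b 1≤l l≤ny))) |
          ≥⇒false {X} {x i} p
                     | pos-below {v} {x i} (≤-trans p X≤v) = ≤-reflexive (eq′ (v - x i))
        where
        eq′ : ∀ p → p ≡ 0ℤ + (p + 0ℤ)
        eq′ p = solve (p ∷ [])
      ...   | inj₂ p rewrite <⇒true X p | ≥⇒false {x i} {X} (≤-trans (≤+1 X) p) = ≤-reflexive
          (eq′ (pos (v - x i)))
        where
        eq′ : ∀ p → p ≡ 0ℤ + (0ℤ + p)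
        eq′ p = solve (p ∷ [])

  -- Rules (a) and (b) as hinge inequalities

  out-if : ∀ {b c d} → b ≡ false → c ≡ true → status (if b then true else (if c then false else d)) ≡ out
  out-if refl refl = refl

  module Side (x y α : List ℤ) (fX fY : ℕ → Status)
    (Ax : Anti (length x) (at x)) (Ay : Anti (length y) (at y)) (Aα : Anti (length α) (at α))
    (x≢y : ∀ i j → 1 ℕ.≤ i → i ℕ.≤ length x → 1 ℕ.≤ j → j ℕ.≤ length y → at x i ≢ at y j)
    (fix : ∀ j → 1 ℕ.≤ j → j ℕ.≤ length x → fX j ≡ status (decide x y α fX fY j)) where

    s nx ny : ℕ
    s = length α
    nx = length x
    ny = length y
    inX outX inY : ℕ → Bool
    inX i = isIn (fX i)
    outX i = isOut (fX i)
    inY i = isIn (fY i)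

    not-inX : ∀ i → 1 ℕ.≤ i → i ℕ.≤ nx → outX i ≡ not (inX i)
    not-inX i a b rewrite fix i a b with decide x y α fX fY i
    ... | true  = refl
    ... | false = refl

    open Core nx ny s (at x) (at y) (at α) inX outX inY Ax Ay Aα x≢y not-inX using (cY; cX; Q; U; P≤T)

    Q≡ : ∀ j → Decision.q x y α fX fY j ≡ Q j
    Q≡ j = cong₂ (λ k o → (+ s) - k + o + 1ℤ) (count-Σ ny (Decision.yInLt x y α fX fY j))
        (count-Σ nx (λ i → (j ℕ.<ᵇ i) ∧ outX i))

    module Rule (j : ℕ) (1≤j : 1 ℕ.≤ j) (j≤nx : j ℕ.≤ nx) (Q≤s : Q j ≤ + s) where
      open Decision x y α fX fY j using (v; yInLt; l; yl; N′; E; pos′; ruleA)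

      lLeast : Least yInLt ny l
      lLeast = q≤⇒least x y α fX fY j (≤-trans (≤-reflexive (Q≡ j)) Q≤s)
      open Least lLeast public

      yl<v : 1ℤ + yl ≤ v
      yl<v = true⇒< (proj₂ (∧-true {inY l} holds))

      inYl : inY l ≡ true
      inYl = proj₁ (∧-true {inY l} holds)

      c₁ c₂ D B Z : ℤ
      c₁ = Σ ny (λ i → (inY i ∧ (l ℕ.<ᵇ i)) · 1ℤ)
      c₂ = Σ nx (λ i → (outX i ∧ (at x i <ᵇ yl)) · 1ℤ)
      D = Σ nx (λ i → (j ℕ.<ᵇ i) · ((yl <ᵇ at x i) · (outX i · 1ℤ)))
      B = Σ nx (λ i → (j ℕ.<ᵇ i) · ((yl <ᵇ at x i) · (inX i · 1ℤ)))
      Z = Σ nx (λ i → (yl <ᵇ at x i) · 1ℤ)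

      cY≡ : cY j ≡ 1ℤ + c₁
      cY≡ = trans (Σ-≡ ny pw) (aux l 1≤i i≤w inYl)
        where
        pw : ∀ i → 1 ℕ.≤ i → i ℕ.≤ ny → (inY i ∧ (at y i <ᵇ at x j)) · 1ℤ ≡ (l ℕ.≤ᵇ i) · (inY i · 1ℤ)
        pw i a b with l ℕ.≤? i
        ... | yes p rewrite <⇒true (at y i) (≤-trans (ℤP.+-monoʳ-≤ 1ℤ (Ay l i 1≤i p b)) yl<v) with l ℕ.≤ᵇ i
            | ℕ.≤⇒≤ᵇ p
        ...   | true | _ with inY i
        ...     | true  = refl
        ...     | false = refl
        pw i a b | no ¬p rewrite below i a (ℕ.≰⇒> ¬p) with l ℕ.≤ᵇ i in e
        ...   | false = refl
        ...   | true = ⊥-elim (¬p (ℕ.≤ᵇ⇒≤ l i (subst T (sym e) tt)))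
        aux : ∀ l → 1 ℕ.≤ l → l ℕ.≤ ny → inY l ≡ true → Σ ny (λ i → (l ℕ.≤ᵇ i) · (inY i · 1ℤ))
            ≡ 1ℤ + Σ ny (λ i → (inY i ∧ (l ℕ.<ᵇ i)) · 1ℤ)
        aux (suc l) _ q e = trans (Σ-peel (λ i → inY i · 1ℤ) l ny q)
            (cong₂ _+_ (cong (_· 1ℤ) e) (Σ-≡ ny λ i _ _ → sw (inY i) (suc l ℕ.<ᵇ i)))
          where
          sw : ∀ a b → b · (a · 1ℤ) ≡ (a ∧ b) · 1ℤ
          sw true  b = refl
          sw false true = refl
          sw false false = refl

      i≤j⇒yl< : ∀ i → 1 ℕ.≤ i → i ℕ.≤ j → 1ℤ + yl ≤ at x i
      i≤j⇒yl< i a b = ≤-trans yl<v (Ax i j a b j≤nx)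

      cX≡ : cX j ≡ c₂ + D
      cX≡ = Σ-≡₊ nx pw
        where
        pw : ∀ i → 1 ℕ.≤ i → i ℕ.≤ nx → ((j ℕ.<ᵇ i) ∧ outX i) · 1ℤ
           ≡ (outX i ∧ (at x i <ᵇ yl)) · 1ℤ + (j ℕ.<ᵇ i) · ((yl <ᵇ at x i) · (outX i · 1ℤ))
        pw i a b with j ℕ.<ᵇ i in e
        ... | false rewrite ≥⇒false {at x i} {yl} (≤-trans (≤+1 yl) (i≤j⇒yl< i a (false⇒n≥ e))) with outX i
        ...   | true  = refl
        ...   | false = refl
        pw i a b | true with at x i ≤or> yl
        ...   | inj₁ p rewrite ≥⇒false p | <⇒true (at x i)
            (ℤP.i<j⇒suc[i]≤j (ℤP.≤∧≢⇒< p (x≢y i l a b 1≤i i≤w))) with outX i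
        ...     | true  = refl
        ...     | false = refl
        pw i a b | true | inj₂ p rewrite <⇒true yl p | ≥⇒false {at x i} {yl} (≤-trans (≤+1 yl) p) with outX i
        ...     | true  = refl
        ...     | false = refl

      Z≡ : Z ≡ + j + (D + B)
      Z≡ = trans (Σ-≡₊ nx {g = λ i → 1ℤ - (j ℕ.<ᵇ i) · 1ℤ} pw)
        (cong₂ _+_ (upTo-count j nx j≤nx) (ΣL-+ (λ i → (j ℕ.<ᵇ i) · ((yl <ᵇ at x i) · (outX i · 1ℤ)))
            (λ i → (j ℕ.<ᵇ i) · ((yl <ᵇ at x i) · (inX i · 1ℤ))) (from 1 nx)))
        where
        pw : ∀ i → 1 ℕ.≤ i → i ℕ.≤ nx → (yl <ᵇ at x i) · 1ℤ
           ≡ (1ℤ - (j ℕ.<ᵇ i) · 1ℤ) + ((j ℕ.<ᵇ i) · ((yl <ᵇ at x i) · (outX i · 1ℤ)) + (j ℕ.<ᵇ i) ·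
               ((yl <ᵇ at x i) · (inX i · 1ℤ)))
        pw i a b rewrite not-inX i a b with j ℕ.<ᵇ i in e
        ... | false rewrite <⇒true yl (i≤j⇒yl< i a (false⇒n≥ e)) = refl
        ... | true with yl <ᵇ at x i
        ...   | false = refl
        ...   | true with inX i
        ...     | true  = refl
        ...     | false = refl

      Cα : ℤ
      Cα = Σ s (λ i → (yl <ᵇ at α i) · 1ℤ)

      N≡ : N′ ≡ Cα - (+ s) + c₁ - c₂ + 1ℤ
      N≡ = trans (cong (λ t → t - (+ s) + (+ count ny (λ i → inY i ∧ (l ℕ.<ᵇ i))) -
          (+ count nx (λ i → outX i ∧ (at x i <ᵇ yl))) + 1ℤ)
                    (count-Σ s (λ i → yl <ᵇ at α i)))
             (cong₂ (λ k o → Cα - (+ s) + k - o + 1ℤ) (count-Σ ny (λ i → inY i ∧ (l ℕ.<ᵇ i)))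
                 (count-Σ nx (λ i → outX i ∧ (at x i <ᵇ yl))))

      E≡ : + E ≡ Cα + Z
      E≡ = count-eSeq α x yl

      pos≡ : + pos′ ≡ M s (at α) v + + j
      pos≡ = posX-eTags α x Aα Ax j 1≤j j≤nx

      0≤B : 0ℤ ≤ B
      0≤B = Σ-0≤ nx (λ i _ _ → ·-0≤ (j ℕ.<ᵇ i) (·-0≤ (yl <ᵇ at x i) (0≤·1 (inX i))))

      0≤D : 0ℤ ≤ D
      0≤D = Σ-0≤ nx (λ i _ _ → ·-0≤ (j ℕ.<ᵇ i) (·-0≤ (yl <ᵇ at x i) (0≤·1 (outX i))))

      M≤Cα : M s (at α) v ≤ Cα
      M≤Cα = Σ-≤ s pw
        where
        pw : ∀ i → 1 ℕ.≤ i → i ℕ.≤ s → (v ≤ᵇ at α i) · 1ℤ ≤ (yl <ᵇ at α i) · 1ℤ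
        pw i _ _ with v ≤ᵇ at α i in e
        ... | false = 0≤·1 (yl <ᵇ at α i)
        ... | true rewrite <⇒true yl (≤-trans yl<v (true⇒≤ e)) = ≤-refl

      -- As `yl < v`, the entry itself lies in the part of e above `yl`. This makes the test
      -- `pos′ ≤ E` automatic, and `1 ≤ N′` as well once the lower bound on the position holds.
      pos≤E : + pos′ ≤ + E
      pos≤E = subst₂ _≤_ (sym pos≡) (sym (trans E≡ (cong (λ t → Cα + t) Z≡)))
        (lin (M≤Cα ⊕ 0≤D ⊕ 0≤B) (eq (M s (at α) v) Cα D B (+ j)))
        where
        eq : ∀ m c d b j → c + (j + (d + b)) - (m + j) ≡ c + d + b - (m + 0ℤ + 0ℤ)
        eq m c d b j = solve (m ∷ c ∷ d ∷ b ∷ j ∷ [])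

      -- Turns the position test of rule (a) into `Q j + B ≤ M`. The surplus `B` counts later
      -- entries of `x` above `yl` that were chosen; it is why `ruleA⇒` and `⇒ruleA` are not
      -- converse to each other by themselves.
      balance : M s (at α) v - (Q j + B) ≡ + pos′ - (1ℤ + (+ E - N′))
      balance rewrite pos≡ | E≡ | N≡ | Z≡ | cY≡ | cX≡ = eq (M s (at α) v) (+ s) c₁ c₂ D B Cα (+ j)
        where
        eq : ∀ m s c₁ c₂ d b c j → m - (s - (1ℤ + c₁) + (c₂ + d) + 1ℤ + b)
          ≡ m + j - (1ℤ + (c + (j + (d + b)) - (c - s + c₁ - c₂ + 1ℤ)))
        eq m s c₁ c₂ d b c j = solve (m ∷ s ∷ c₁ ∷ c₂ ∷ d ∷ b ∷ c ∷ j ∷ [])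

      ruleA⇒ : ruleA ≡ true → Q j ≤ M s (at α) v
      ruleA⇒ e = lin (true⇒< {+ E - N′} {+ pos′} (proj₁
          (∧-true (proj₁ (∧-true (proj₂ (∧-true {1ℤ ≤ᵇ N′} e)))))) ⊕ 0≤B)
        (trans (eq (M s (at α) v) (Q j) B) (trans (cong (λ t → t + B) balance)
            (eq′ (+ pos′) (1ℤ + (+ E - N′)) B)))
        where
        eq : ∀ m q b → m - q ≡ m - (q + b) + b
        eq m q b = solve (m ∷ q ∷ b ∷ [])
        eq′ : ∀ m q b → m - q + b ≡ m + b - (q + 0ℤ)
        eq′ m q b = solve (m ∷ q ∷ b ∷ [])

      ⇒ruleA : Q j + B ≤ M s (at α) v → ruleA ≡ true
      ⇒ruleA h = cong₂ _∧_ (≤⇒true 1≤N) (cong₂ _∧_ (cong₂ _∧_ (<⇒true (+ E - N′) A₁) A₂) (<⇒true yl yl<v))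
        where
        A₁ : 1ℤ + (+ E - N′) ≤ + pos′
        A₁ = lin h (sym balance)
        A₂ : (pos′ ℕ.≤ᵇ E) ≡ true
        A₂ with pos′ ℕ.≤ᵇ E | ℕ.≤⇒≤ᵇ (≤+ pos≤E)
        ... | true | _ = refl
        1≤N : 1ℤ ≤ N′
        1≤N = lin (A₁ ⊕ pos≤E) (eq (+ pos′) (+ E) N′)
          where
          eq : ∀ p e n → n - 1ℤ ≡ p + e - (1ℤ + (e - n) + p)
          eq p e n = solve (p ∷ e ∷ n ∷ [])

    decided : ∀ j → 1 ℕ.≤ j → j ℕ.≤ nx →
      fX j ≡ status (if (+ s) <ᵇ Q j then true else
          (if Decision.ruleA x y α fX fY j then false else Decision.ruleB x y α fX fY j (tailSum α (Q j))))
    decided j a b = trans (fix j a b) (cong status (trans (Decision.decide-unfold x y α fX fY j)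
      (cong (λ t → if (+ s) <ᵇ t then true else (if Decision.ruleA x y α fX fY j then false else
          Decision.ruleB x y α fX fY j (tailSum α t))) (Q≡ j))))

    -- Rule (a) applies exactly when the q_j-th entry of α is still at least x_j.
    early-out : ∀ j → 1 ℕ.≤ j → j ℕ.≤ nx → Q j ≤ + s → Q j ≤ M s (at α) (at x j) → fX j ≡ out
    early-out j = go nx j (ℕ.m≤m+n nx j)
      where
      go : ∀ fuel j → nx ℕ.≤ fuel ℕ.+ j → 1 ℕ.≤ j → j ℕ.≤ nx → Q j ≤ + s → Q j ≤ M s (at α) (at x j) → fX j
          ≡ out
      go fuel j enough 1≤j j≤nx h h′ = trans (decided j 1≤j j≤nx) (out-if (≥⇒false h) ⇒ruleA′)
        where
        open Rule j 1≤j j≤nx h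
        -- Shows `B = 0`. A later `x i` above `yl` has the same chosen `y` below it as `x j` and no
        -- more left-out entries behind it, so `Q i ≤ Q j`, while `M` is no smaller at `x i`. The
        -- induction hypothesis leaves `x i` out; `fuel` bounds the number of indices after `j`.
        later : ∀ i → 1 ℕ.≤ i → i ℕ.≤ nx → (j ℕ.<ᵇ i) ·
            ((Decision.yl x y α fX fY j <ᵇ at x i) · (inX i · 1ℤ)) ≡ 0ℤ
        later i 1≤i′ i≤nx with j ℕ.<ᵇ i in e
        ... | false = refl
        ... | true with Decision.yl x y α fX fY j <ᵇ at x i in e′
        ...   | false = refl
        ...   | true = cong (λ t → isIn t · 1ℤ) (rec fuel enough)
          where
          xi≤xj : at x i ≤ at x j
          xi≤xj = Ax j i 1≤j (ℕ.<⇒≤ (true⇒n< e)) i≤nx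
          pwY : ∀ k → 1 ℕ.≤ k → k ℕ.≤ ny → (inY k ∧ (at y k <ᵇ at x j)) · 1ℤ
              ≤ (inY k ∧ (at y k <ᵇ at x i)) · 1ℤ
          pwY k a b with k ℕ.<? Decision.l x y α fX fY j
          ... | yes p rewrite below k a p = 0≤·1 (inY k ∧ (at y k <ᵇ at x i))
          ... | no ¬p rewrite <⇒true (at y k) {at x i} (≤-trans (ℤP.+-monoʳ-≤ 1ℤ (Ay _ k 1≤i (ℕ.≮⇒≥ ¬p) b))
              (true⇒< {_} {at x i} e′)) with inY k
          ...   | true  = ·1≤1 (at y k <ᵇ at x j)
          ...   | false = ≤-refl
          pwX : ∀ k → 1 ℕ.≤ k → k ℕ.≤ nx → ((i ℕ.<ᵇ k) ∧ outX k) · 1ℤ ≤ ((j ℕ.<ᵇ k) ∧ outX k) · 1ℤ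
          pwX k a b with i ℕ.<ᵇ k in e″
          ... | false = 0≤·1 ((j ℕ.<ᵇ k) ∧ outX k)
          ... | true rewrite n<⇒true {j} {k} (ℕ.<-trans (true⇒n< {j} {i} e) (true⇒n< {i} {k} e″)) = ≤-refl
          Qi≤Qj : Q i ≤ Q j
          Qi≤Qj = lin (Σ-≤ ny pwY ⊕ Σ-≤ nx pwX) (eq (+ s) (cY i) (cY j) (cX i) (cX j))
            where
            eq : ∀ s a b c d → s - b + d + 1ℤ - (s - a + c + 1ℤ) ≡ a + d - (b + c)
            eq s a b c d = solve (s ∷ a ∷ b ∷ c ∷ d ∷ [])
          rec : ∀ fuel → nx ℕ.≤ fuel ℕ.+ j → fX i ≡ out
          rec zero p = ⊥-elim (ℕ.<⇒≱ (true⇒n< e) (ℕ.≤-trans i≤nx p))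
          rec (suc fuel) p = go fuel i (ℕ.≤-trans p (subst (ℕ._≤ fuel ℕ.+ i) (ℕ.+-suc fuel j)
              (ℕ.+-monoʳ-≤ fuel (true⇒n< e))))
            1≤i′ i≤nx (≤-trans Qi≤Qj h) (≤-trans Qi≤Qj (≤-trans h′ (M-anti s (at α) xi≤xj)))
        ⇒ruleA′ : Decision.ruleA x y α fX fY j ≡ true
        ⇒ruleA′ = ⇒ruleA (≤-trans (≤-reflexive (trans (cong (λ t → Q j + t) (Σ-≡0 nx later))
            (ℤP.+-identityʳ (Q j)))) h′)

    module _ (j : ℕ) (1≤j : 1 ℕ.≤ j) (j≤nx : j ℕ.≤ nx) (q : ℕ) (Q≡q : Q j ≡ + q) (q≤s : q ℕ.≤ s) where
      open Decision x y α fX fY j using (v; yInLt; lhsB; rhsB)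

      H tail-α : ℤ
      H = Σ s (λ i → (q ℕ.<ᵇ i) · (v - at α i))
      tail-α = sumFT (at α) (suc q) s

      H≡ : H ≡ v * (+ s - + q) - tail-α
      H≡ = trans (Σ-hinge s (q ℕ.<ᵇ_) (at α) v) (cong₂ (λ t r → v * t - r) (Σ-count> q s q≤s)
          (sym (sumFT-Σ (at α) q s)))

      H≤T : H ≤ T₊ s (at α) (+ q) v
      H≤T = Σ-≤ s pw
        where
        pw : ∀ i → 1 ℕ.≤ i → i ℕ.≤ s → (q ℕ.<ᵇ i) · (v - at α i) ≤ (+ q <ᵇ + i) · pos (v - at α i)
        pw i _ _ rewrite +<ᵇ q i with q ℕ.<ᵇ i
        ... | true  = ≤pos (v - at α i)
        ... | false = ≤-refl

      -- When rule (a) is out of reach, every `α i` with `i > q` is at most `v`, and the plain sum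
      -- of rule (b) coincides with the hinge sum.
      T≤H : 1ℤ + M s (at α) v ≤ + q → T₊ s (at α) (+ q) v ≤ H
      T≤H h = Σ-≤ s pw
        where
        pw : ∀ i → 1 ℕ.≤ i → i ℕ.≤ s → (+ q <ᵇ + i) · pos (v - at α i) ≤ (q ℕ.<ᵇ i) · (v - at α i)
        pw i a b rewrite +<ᵇ q i with q ℕ.<ᵇ i in e
        ... | false = ≤-refl
        ... | true with at α i ≤or> v
        ...   | inj₁ p = ≤-reflexive (pos-below p)
        ...   | inj₂ p = absurd (≤-trans (M-low s (at α) Aα i v a b (≤-trans (≤+1 v) p)) (≤+1 (M s (at α) v)))
                  (≤-trans (ℤP.+-monoʳ-≤ 1ℤ h) (+≤ (true⇒n< {q} {i} e)))

      -- By the definition of `Q j` the multiples of `v` on both sides match, the extra `1ℤ` in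
      -- `Q j` accounting for the summand `v` of `rhsB`. Rule (b) therefore leaves the entry out
      -- exactly when `U v ≤ H`.
      U≡ : U v ≡ H + (rhsB + tail-α - lhsB)
      U≡ = trans (cong₂ _-_ (trans (Σ-≡ ny pwY) (Σ-hinge ny yInLt (at y) v))
          (trans (Σ-≡ nx pwX) (Σ-hinge nx (λ i → outX i ∧ (j ℕ.<ᵇ i)) (at x) v)))
        (trans (cong₂ (λ l r → v * cY j - l - (v * Σ nx (λ i → (outX i ∧ (j ℕ.<ᵇ i)) · 1ℤ) - r))
                  (sym (sumWhere-Σ ny yInLt (at y))) (sym (sumWhere-Σ nx (λ i → outX i ∧ (j ℕ.<ᵇ i)) (at x))))
          (trans (cong (λ t → v * cY j - lhsB - (v * t - sumWhere nx (λ i → outX i ∧ (j ℕ.<ᵇ i)) (at x)))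
                    (Σ-≡ nx λ i _ _ → cong (_· 1ℤ) (∧-comm (outX i) (j ℕ.<ᵇ i))))
            (trans (eq v (cY j) (cX j) (+ s) (+ q) lhsB (sumWhere nx (λ i → outX i ∧ (j ℕ.<ᵇ i)) (at x))
                tail-α (sym Q≡q))
              (cong (λ t → t + (rhsB + tail-α - lhsB)) (sym H≡)))))
        where
        eq : ∀ v cy cx s q l r t → q ≡ s - cy + cx + 1ℤ → v * cy - l - (v * cx - r)
            ≡ v * (s - q) - t + (r + v + t - l)
        eq v cy cx s q l r t refl = solve (v ∷ cy ∷ cx ∷ s ∷ l ∷ r ∷ t ∷ [])
        pwY : ∀ i → 1 ℕ.≤ i → i ℕ.≤ ny → inY i · pos (v - at y i) ≡ (inY i ∧ (at y i <ᵇ v)) · (v - at y i)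
        pwY i _ _ with inY i
        ... | false = refl
        ... | true with v ≤or> at y i
        ...   | inj₁ p rewrite ≥⇒false p = pos-above p
        ...   | inj₂ p rewrite <⇒true (at y i) p = pos-below (≤-trans (≤+1 (at y i)) p)
        pwX : ∀ i → 1 ℕ.≤ i → i ℕ.≤ nx → outX i · pos (v - at x i) ≡ (outX i ∧ (j ℕ.<ᵇ i)) · (v - at x i)
        pwX i a b with outX i
        ... | false = refl
        ... | true with j ℕ.<ᵇ i in e
        ...   | true  = pos-below (Ax j i 1≤j (ℕ.<⇒≤ (true⇒n< {j} {i} e)) b)
        ...   | false = pos-above (Ax i j a (false⇒n≥ {j} {i} e) j≤nx)

    Q-nonneg : ∀ j → 1ℤ + M s (at α) (at x j) ≤ Q j → Σ[ q ∈ ℕ ] Q j ≡ + q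
    Q-nonneg j h with Q j | ≤-trans (ℤP.+-monoʳ-≤ 1ℤ (0≤M s (at α) (at x j))) h
    ... | + q | _ = q , refl

    in-if : ∀ {b c d} → b ≡ false → status (if b then true else (if c then false else d)) ≡ inn → c
        ≡ false × d ≡ true
    in-if {c = false} {true} refl e = refl , refl

    out-cases : ∀ {b c d} → status (if b then true else (if c then false else d)) ≡ out → b
        ≡ false × (c ≡ true ⊎ d ≡ false)
    out-cases {false} {true} e = refl , inj₁ refl
    out-cases {false} {false} {false} e = refl , inj₂ refl

    -- For `Q j ≤ + s`, `early-out` excludes `Q j ≤ M`; then `T≤H` turns the failure of rule (b)
    -- into a strict failure of the hinge inequality.
    in⇒ : ∀ j → 1 ℕ.≤ j → j ℕ.≤ nx → fX j ≡ inn →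
      1ℤ + + s ≤ Q j ⊎ 1ℤ + T₊ s (at α) (Q j) (at x j) ≤ U (at x j)
    in⇒ j 1≤j j≤nx e = cases (Q j ≤or> + s) (Q j ≤or> M s (at α) (at x j))
      where
      open Decision x y α fX fY j using (v; lhsB; rhsB; ruleA; ruleB)
      strict : Q j ≤ + s → 1ℤ + M s (at α) v ≤ Q j → Σ[ q ∈ ℕ ] Q j ≡ + q → 1ℤ + T₊ s (at α) (Q j) v ≤ U v
      strict h h′ (q , Q≡q) = subst (λ t → 1ℤ + T₊ s (at α) t v ≤ U v) (sym Q≡q)
        (lin (T≤H j 1≤j j≤nx q Q≡q q≤s (subst (1ℤ + M s (at α) v ≤_) Q≡q h′)
            ⊕ true⇒< {lhsB} {rhsB + tailα} b-fails)
          (trans (cong (_- (1ℤ + T₊ s (at α) (+ q) v)) (U≡ j 1≤j j≤nx q Q≡q q≤s))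
              (eq H′ rhsB tailα lhsB (T₊ s (at α) (+ q) v))))
        where
        q≤s : q ℕ.≤ s
        q≤s = ≤+ (subst (_≤ + s) Q≡q h)
        H′ tailα : ℤ
        H′ = H j 1≤j j≤nx q Q≡q q≤s
        tailα = sumFT (at α) (suc q) s
        b-fails : ruleB (tailSum α (+ q)) ≡ true
        b-fails = trans (sym (cong (λ t → ruleB (tailSum α t)) Q≡q))
          (proj₂ (in-if {(+ s) <ᵇ Q j} {ruleA} (≥⇒false h) (trans (sym (decided j 1≤j j≤nx)) e)))
        eq : ∀ h r t l u → h + (r + t - l) - (1ℤ + u) ≡ h + (r + t) - (u + (1ℤ + l))
        eq h r t l u = solve (h ∷ r ∷ t ∷ l ∷ u ∷ [])
      cases : Q j ≤ + s ⊎ 1ℤ + + s ≤ Q j → Q j ≤ M s (at α) v ⊎ 1ℤ + M s (at α) v ≤ Q j →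
        1ℤ + + s ≤ Q j ⊎ 1ℤ + T₊ s (at α) (Q j) v ≤ U v
      cases (inj₂ h) _ = inj₁ h
      cases (inj₁ h) (inj₁ h′) = ⊥-elim (true≢false (cong isIn (trans (sym e) (early-out j 1≤j j≤nx h h′))))
      cases (inj₁ h) (inj₂ h′) = inj₂ (strict h h′ (Q-nonneg j h′))

    out⇒ : ∀ j → 1 ℕ.≤ j → j ℕ.≤ nx → fX j ≡ out → Q j ≤ + s ×
      (P s (at α) (at x j) ≤ T₊ s (at α) (Q j) (at x j) ⊎ U (at x j) ≤ T₊ s (at α) (Q j) (at x j))
    out⇒ j 1≤j j≤nx e with out-cases {(+ s) <ᵇ Q j} {Decision.ruleA x y α fX fY j}
        (trans (sym (decided j 1≤j j≤nx)) e)
    ... | b , rest = h , cases rest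
      where
      open Decision x y α fX fY j using (v; lhsB; rhsB; ruleA; ruleB)
      h : Q j ≤ + s
      h = false⇒≥ {+ s} {Q j} b
      cases : ruleA ≡ true ⊎ ruleB (tailSum α (Q j)) ≡ false →
        P s (at α) v ≤ T₊ s (at α) (Q j) v ⊎ U v ≤ T₊ s (at α) (Q j) v
      cases (inj₁ a) = inj₁ (P≤T (Q j) v (Rule.ruleA⇒ j 1≤j j≤nx h a))
      cases (inj₂ d) = byQ (Q j) refl
        where
        byQ : ∀ z → Q j ≡ z → P s (at α) v ≤ T₊ s (at α) (Q j) v ⊎ U v ≤ T₊ s (at α) (Q j) v
        -- For negative q the tail sum is +∞, so rule (b) would have chosen the entry.
        byQ -[1+ q ] Q≡q with trans (sym (cong (λ t → ruleB (tailSum α t)) Q≡q)) d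
        ... | ()
        byQ (+ q) Q≡q = inj₂ (subst (λ t → U v ≤ T₊ s (at α) t v) (sym Q≡q)
          (≤-trans (lin (false⇒≥ {lhsB} {rhsB + tailα} (trans (sym (cong (λ t → ruleB (tailSum α t)) Q≡q)) d))
              (trans (cong (λ t → H′ - t) (U≡ j 1≤j j≤nx q Q≡q q≤s)) (eq H′ rhsB tailα lhsB)))
            (H≤T j 1≤j j≤nx q Q≡q q≤s)))
          where
          q≤s : q ℕ.≤ s
          q≤s = ≤+ (subst (_≤ + s) Q≡q h)
          H′ tailα : ℤ
          H′ = H j 1≤j j≤nx q Q≡q q≤s
          tailα = sumFT (at α) (suc q) s
          eq : ∀ h r t l → h - (h + (r + t - l)) ≡ l - (r + t)
          eq h r t l = solve (h ∷ r ∷ t ∷ l ∷ [])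

  -- Slopes and affine minorants

  -- Since `N` is the difference of `P`, an inequality between counts sums up over the thresholds
  -- from `v` to `+ k + v`.
  slope : ∀ n x n′ x′ r v → (∀ u → v ≤ u → r + N n′ x′ u ≤ N n x u) → ∀ k →
    P n x v + P n′ x′ (+ k + v) + r * + k ≤ P n x (+ k + v) + P n′ x′ v
  slope n x n′ x′ r v h zero = ≤-reflexive (trans (eq (P n x v) (P n′ x′ (0ℤ + v)) r)
      (cong₂ (λ s t → P n x s + P n′ x′ t) (sym (ℤP.+-identityˡ v)) (ℤP.+-identityˡ v)))
    where
    eq : ∀ a b r → a + b + r * 0ℤ ≡ a + b
    eq a b r = solve (a ∷ b ∷ r ∷ [])
  slope n x n′ x′ r v h (suc k)
    rewrite ℤP.+-assoc 1ℤ (+ k) v | P-step n x (+ k + v) | P-step n′ x′ (+ k + v) =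
    lin (slope n x n′ x′ r v h k ⊕ h (+ k + v) (ℤP.i≤j+i v (+ k)))
      (eq (P n x v) (P n′ x′ v) (P n x (+ k + v)) (P n′ x′ (+ k + v)) r (+ k) (N n x (+ k + v))
          (N n′ x′ (+ k + v)))
    where
    eq : ∀ a b c d r k m m′ → c + m + b - (a + (d + m′) + r * (1ℤ + k))
        ≡ c + b + m - (a + d + r * k + (r + m′))
    eq a b c d r k m m′ = solve (a ∷ b ∷ c ∷ d ∷ r ∷ k ∷ m ∷ m′ ∷ [])

  -- The tail without positive parts: affine in the threshold, below `P s a` everywhere, and equal
  -- to it between `a j` and `a (suc j)` (`Hα≤P`, `P≡Hα`).
  Hα : ℕ → (ℕ → ℤ) → ℕ → ℤ → ℤ
  Hα s a j V = Σ s (λ i → (j ℕ.<ᵇ i) · (V - a i))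

  Hα≡ : ∀ s a j V → j ℕ.≤ s → Hα s a j V ≡ V * (+ s - + j) - sumFT a (suc j) s
  Hα≡ s a j V h = trans (Σ-hinge s (j ℕ.<ᵇ_) a V)
      (cong₂ (λ t r → V * t - r) (Σ-count> j s h) (sym (sumFT-Σ a j s)))

  Hα≤T₊ : ∀ s a j V → Hα s a j V ≤ T₊ s a (+ j) V
  Hα≤T₊ s a j V = Σ-≤ s pw
    where
    pw : ∀ i → 1 ℕ.≤ i → i ℕ.≤ s → (j ℕ.<ᵇ i) · (V - a i) ≤ (+ j <ᵇ + i) · pos (V - a i)
    pw i _ _ rewrite +<ᵇ j i with j ℕ.<ᵇ i
    ... | true  = ≤pos (V - a i)
    ... | false = ≤-refl

  Hα≤P : ∀ s a j V → Hα s a j V ≤ P s a V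
  Hα≤P s a j V = ≤-trans (Hα≤T₊ s a j V) (T₊≤P s a (+ j) V)

  P≡Hα : ∀ s a j V → (∀ i → 1 ℕ.≤ i → i ℕ.≤ s → i ℕ.≤ j → V ≤ a i) → (∀ i → i ℕ.≤ s → j ℕ.< i → a i ≤ V) →
    P s a V ≡ Hα s a j V
  P≡Hα s a j V lo hi = Σ-≡ s pw
    where
    pw : ∀ i → 1 ℕ.≤ i → i ℕ.≤ s → pos (V - a i) ≡ (j ℕ.<ᵇ i) · (V - a i)
    pw i p q with j ℕ.<ᵇ i in e
    ... | true  = pos-below (hi i q (true⇒n< {j} {i} e))
    ... | false = pos-above (lo i p q (false⇒n≥ {j} {i} e))

  -- Weak generalized majorization in terms of hinge functions

  module Majorization (g d a : List ℤ) (len : length g ≡ length d ℕ.+ length a)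
    (Ag : Anti (length d ℕ.+ length a) (at g)) (Ad : Anti (length d) (at d))
        (Aa : Anti (length a) (at a)) where
    open Maj g d a using (p; s; test; hIdx)

    w : ℕ
    w = p ℕ.+ s
    Pg Pd Ng Nd : ℤ → ℤ
    Pg = P w (at g)
    Pd = P p (at d)
    Ng = N w (at g)
    Nd = N p (at d)
    Ha : ℕ → ℤ → ℤ
    Ha = Hα s (at a)

    -- Minimality of h_j unfolded. The conventions d_i = +∞ and d_i = -∞ outside the range become
    -- the bounds `j ≤ h`, `h ≤ p + j` and `i ≤ p`.
    record Jump (j h : ℕ) : Set where
      field
        j≤h    : j ℕ.≤ h
        h≤p+j  : h ℕ.≤ p ℕ.+ j
        before : ∀ i → 1 ℕ.≤ i → i ℕ.+ j ℕ.≤ h → i ℕ.≤ p × at g (i ℕ.+ (j ∸ 1)) ≤ at d i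
        after  : suc (h ∸ j) ℕ.≤ p → 1ℤ + at d (suc (h ∸ j)) ≤ at g h

    jump : ∀ j → 1 ℕ.≤ j → j ℕ.≤ s → Jump j (hIdx j)
    jump (suc j) 1≤j j≤s = go (findMin-spec w (test (suc j)))
      where
      J : ℕ
      J = suc j
      last : test J (p ℕ.+ J) ≡ true
      last rewrite n≥⇒false {p ℕ.+ J} {J} (ℕ.m≤n+m J p) | ℕ.+-suc p j | ℕ.+-∸-assoc 1 (ℕ.m≤n+m j p) |
          ℕ.m+n∸n≡m p j
                 | n<⇒true {p} {suc p} ℕ.≤-refl = refl
      last≤ : p ℕ.+ J ℕ.≤ w
      last≤ = ℕ.+-monoʳ-≤ p j≤s
      1≤last : 1 ℕ.≤ p ℕ.+ J
      1≤last = subst (1 ℕ.≤_) (sym (ℕ.+-suc p j)) (s≤s z≤n)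
      ≥J : ∀ h → test J h ≡ true → J ℕ.≤ h
      ≥J h e with h ℕ.<ᵇ J in e′
      ... | false = false⇒n≥ {h} {J} e′
      go : Least (test J) w (hIdx J) ⊎ (hIdx J ≡ suc w × (∀ i → 1 ℕ.≤ i → i ℕ.≤ w → test J i ≡ false)) →
          Jump J (hIdx J)
      go (inj₂ (_ , n)) = ⊥-elim (true≢false (trans (sym last) (n (p ℕ.+ J) 1≤last last≤)))
      go (inj₁ (least 1≤h h≤w hh below)) = record { j≤h = J≤h ; h≤p+j = ℕ.≮⇒≥
          (λ q → true≢false (trans (sym last) (below _ 1≤last q))) ; before = bef ; after = aft }
        where
        h : ℕ
        h = hIdx J
        J≤h : J ℕ.≤ h
        J≤h = ≥J h hh
        bef : ∀ i → 1 ℕ.≤ i → i ℕ.+ J ℕ.≤ h → i ℕ.≤ p × at g (i ℕ.+ j) ≤ at d i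
        bef i 1≤i q with below (i ℕ.+ j) (ℕ.≤-trans 1≤i (ℕ.m≤m+n i j)) (subst (ℕ._≤ h) (ℕ.+-suc i j) q)
        ... | e rewrite n≥⇒false {i ℕ.+ j} {J} (ℕ.+-monoˡ-≤ j 1≤i) | ℕ.m+n∸n≡m i j with p ℕ.<ᵇ i in e′
        ...   | false = false⇒n≥ {p} {i} e′ , false⇒≥ {at d i} {at g (i ℕ.+ j)} e
        aft : suc (h ∸ J) ℕ.≤ p → 1ℤ + at d (suc (h ∸ J)) ≤ at g h
        aft q = aux hh
          where
          aux : test J h ≡ true → 1ℤ + at d (suc (h ∸ J)) ≤ at g h
          aux e rewrite n≥⇒false {h} {J} J≤h | ℕ.+-∸-assoc 1 J≤h | n≥⇒false {p} {suc (h ∸ J)} q = true⇒<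
              {at d (suc (h ∸ J))} {at g h} e

    -- Each `d i` is matched with the entry of `g` at index `i + j − 1`, which by the minimality of
    -- h_j is at most `d i` or has index at least h_j and so is at most `u`. The last `s − j + 1`
    -- entries of `g` lie at or beyond h_j and are all counted.
    count-shift : ∀ j → 1 ℕ.≤ j → j ℕ.≤ s → ∀ u → at g (hIdx j) ≤ u → + s - + j + 1ℤ + Nd u ≤ Ng u
    count-shift (suc j) 1≤j j≤s u h≤u =
      ≤-trans (lin (pw₀ ⊕ Σ-≤ p pw₁ ⊕ last) (eq (+ s) (+ j) (Nd u) S₀ S₁ S₂)) (≤-reflexive (sym split))
      where
      open Jump (jump (suc j) 1≤j j≤s)
      j≤s′ : j ℕ.≤ s
      j≤s′ = ℕ.≤-trans (ℕ.n≤1+n j) j≤s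
      f : ℕ → ℤ
      f i = (at g i ≤ᵇ u) · 1ℤ
      S₀ S₁ S₂ : ℤ
      S₀ = Σ j f
      S₁ = Σ p (λ i → f (j ℕ.+ i))
      S₂ = Σ (s ∸ j) (λ i → f (j ℕ.+ (p ℕ.+ i)))
      w≡ : w ≡ j ℕ.+ (p ℕ.+ (s ∸ j))
      w≡ = trans (cong (p ℕ.+_) (sym (ℕ.m+[n∸m]≡n j≤s′)))
        (trans (sym (ℕ.+-assoc p j (s ∸ j))) (trans (cong (ℕ._+ (s ∸ j)) (ℕ.+-comm p j))
            (ℕ.+-assoc j p (s ∸ j))))
      split : Ng u ≡ S₀ + (S₁ + S₂)
      split = trans (cong (λ k → Σ k f) w≡) (trans (Σ-shift j (p ℕ.+ (s ∸ j)) f)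
        (cong (λ t → S₀ + t) (Σ-shift p (s ∸ j) (λ i → f (j ℕ.+ i)))))
      pw₀ : 0ℤ ≤ S₀
      pw₀ = Σ-0≤ j (λ i _ _ → 0≤·1 (at g i ≤ᵇ u))
      ≤u : ∀ k → 1 ℕ.≤ hIdx (suc j) → hIdx (suc j) ℕ.≤ k → k ℕ.≤ w → at g k ≤ u
      ≤u k p q r = ≤-trans (Ag (hIdx (suc j)) k p q r) h≤u
      1≤h : 1 ℕ.≤ hIdx (suc j)
      1≤h = ℕ.≤-trans 1≤j j≤h
      pw₁ : ∀ i → 1 ℕ.≤ i → i ℕ.≤ p → (at d i ≤ᵇ u) · 1ℤ ≤ f (j ℕ.+ i)
      pw₁ i 1≤i i≤p with (i ℕ.+ suc j) ℕ.≤? hIdx (suc j)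
      ... | no ¬q rewrite ≤⇒true (≤u (j ℕ.+ i) 1≤h (ℕ.≤-pred
          (subst (suc (hIdx (suc j)) ℕ.≤_) (trans (ℕ.+-suc i j) (cong suc (ℕ.+-comm i j))) (ℕ.≰⇒> ¬q)))
               (ℕ.≤-trans (ℕ.+-mono-≤ j≤s′ i≤p) (ℕ.≤-reflexive (ℕ.+-comm s p)))) = ·1≤1 (at d i ≤ᵇ u)
      ... | yes q with at d i ≤ᵇ u in e
      ...   | false = 0≤·1 (at g (j ℕ.+ i) ≤ᵇ u)
      ...   | true rewrite ≤⇒true (≤-trans (subst (λ k → at g k ≤ at d i) (ℕ.+-comm i j)
          (proj₂ (before i 1≤i q))) (true⇒≤ {at d i} e)) = ≤-refl
      last : + s - + j ≤ S₂
      last = ≤-trans (≤-reflexive (trans (trans (ℤP.m-n≡m⊖n s j) (ℤP.⊖-≥ j≤s′)) (sym (Σ-1 (s ∸ j)))))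
          (Σ-≤ (s ∸ j) pw₂)
        where
        pw₂ : ∀ i → 1 ℕ.≤ i → i ℕ.≤ s ∸ j → 1ℤ ≤ f (j ℕ.+ (p ℕ.+ i))
        pw₂ i 1≤i i≤ rewrite ≤⇒true (≤u (j ℕ.+ (p ℕ.+ i)) 1≤h
            (ℕ.≤-trans h≤p+j (subst (p ℕ.+ suc j ℕ.≤_) (trans (ℕ.+-comm (p ℕ.+ i) j) refl)
               (ℕ.≤-trans (ℕ.≤-reflexive (ℕ.+-suc p j)) (subst (suc (p ℕ.+ j) ℕ.≤_)
                   (trans (ℕ.+-assoc p j i) (trans (cong (p ℕ.+_) (ℕ.+-comm j i)) (sym (ℕ.+-assoc p i j))))
                  (ℕ.m<m+n (p ℕ.+ j) 1≤i)))))
            (subst (j ℕ.+ (p ℕ.+ i) ℕ.≤_) (sym w≡) (ℕ.+-monoʳ-≤ j (ℕ.+-monoʳ-≤ p i≤)))) = ≤-refl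
      eq : ∀ s j n a b c → a + (b + c) - (s - (1ℤ + j) + 1ℤ + n) ≡ a + b + c - (0ℤ + n + (s - j))
      eq s j n a b c = solve (s ∷ j ∷ n ∷ a ∷ b ∷ c ∷ [])

    -- `Ha j` has slope `s − j`, so by the hypothesis `Pg` grows at least as fast as `Pd + Ha j`
    -- from `v` on. The inequality therefore descends from `V` to `v`.
    slide : ∀ j → j ℕ.≤ s → ∀ {v V} → v ≤ V → (∀ u → v ≤ u → + s - + j + Nd u ≤ Ng u) →
      Pg V ≤ Pd V + Ha j V → Pg v ≤ Pd v + Ha j v
    slide j j≤s {v} {V} v≤V r h with gap v≤V
    ... | k , refl = lin (slope w (at g) p (at d) (+ s - + j) v r k ⊕ h)
      (subst₂ (λ X Y → Pd v + X - Pg v ≡ Pg V + Pd v + (Pd V + Y) - (Pg v + Pd V + (+ s - + j) * + k + Pg V))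
        (sym (Hα≡ s (at a) j v j≤s)) (sym (Hα≡ s (at a) j V j≤s))
        (eq (Pg v) (Pd v) (Pg V) (Pd V) (+ s) (+ j) (+ k) v (sumFT (at a) (suc j) s)))
      where
      eq : ∀ a b c d s j k v t → b + (v * (s - j) - t) - a
          ≡ c + b + (d + ((k + v) * (s - j) - t)) - (a + d + (s - j) * k + c)
      eq a b c d s j k v t = solve (a ∷ b ∷ c ∷ d ∷ s ∷ j ∷ k ∷ v ∷ t ∷ [])

    module _ (h t j : ℕ) (V : ℤ) (h≤w : h ℕ.≤ w) (t≤p : t ℕ.≤ p) (j≤s : j ℕ.≤ s) (h≡ : h ≡ t ℕ.+ j)
      (g≥ : ∀ i → 1 ℕ.≤ i → i ℕ.≤ w → i ℕ.≤ h → V ≤ at g i) (g≤ : ∀ i → i ℕ.≤ w → h ℕ.< i → at g i ≤ V) where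
      private
        Sg Sd Sa : ℤ
        Sg = sumFT (at g) (suc h) w
        Sd = sumFT (at d) (suc t) p
        Sa = sumFT (at a) (suc j) s

        Pg≡ : Pg V ≡ V * (+ w - + h) - Sg
        Pg≡ = trans (P≡Hα w (at g) h V g≥ g≤) (Hα≡ w (at g) h V h≤w)

      -- `V` separates `g` at `h`, so `Pg V` is exactly the affine form of the tail of `g`. For `d`
      -- the minorant is enough here; `P⇒tail` needs equality there too and so assumes that `V` also
      -- separates `d` at `t`.
      tail⇒P : Sd + Sa ≤ Sg → Pg V ≤ Pd V + Ha j V
      tail⇒P c rewrite Hα≡ s (at a) j V j≤s | Pg≡ =
        lin (Hα≤P p (at d) t V ⊕ c) (trans (eq V (+ p) (+ s) (+ h) (+ t) (+ j) (Pd V) Sa Sg Sd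
            (cong +_ h≡)) (cong (λ X → Pd V + Sg - (X + (Sd + Sa))) (sym (Hα≡ p (at d) t V t≤p))))
        where
        eq : ∀ V p s h t j D a g d → h ≡ t + j → D + (V * (s - j) - a) - (V * (p + s - h) - g)
            ≡ D + g - (V * (p - t) - d + (d + a))
        eq V p s h t j D a g d refl = solve (V ∷ p ∷ s ∷ t ∷ j ∷ D ∷ a ∷ g ∷ d ∷ [])

      P⇒tail : (∀ i → 1 ℕ.≤ i → i ℕ.≤ p → i ℕ.≤ t → V ≤ at d i) → (∀ i → i ℕ.≤ p → t ℕ.< i → at d i ≤ V) →
        Pg V ≤ Pd V + Ha j V → Sd + Sa ≤ Sg
      P⇒tail d≥ d≤ c rewrite Hα≡ s (at a) j V j≤s | Pg≡ | P≡Hα p (at d) t V d≥ d≤ | Hα≡ p (at d) t V t≤p =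
        lin c (eq V (+ p) (+ s) (+ h) (+ t) (+ j) Sa Sg Sd (cong +_ h≡))
        where
        eq : ∀ V p s h t j a g d → h ≡ t + j → g - (d + a)
            ≡ V * (p - t) - d + (V * (s - j) - a) - (V * (p + s - h) - g)
        eq V p s h t j a g d refl = solve (V ∷ p ∷ s ∷ t ∷ j ∷ a ∷ g ∷ d ∷ [])

    module _ (j : ℕ) (1≤j : 1 ℕ.≤ j) (j≤s : j ℕ.≤ s) where
      open Jump (jump j 1≤j j≤s)
      private
        h t : ℕ
        h = hIdx j
        t = h ∸ j
        h≡t+j : h ≡ t ℕ.+ j
        h≡t+j = sym (ℕ.m∸n+n≡m j≤h)
        t≤p : t ℕ.≤ p
        t≤p = ℕ.≤-trans (ℕ.∸-monoˡ-≤ j h≤p+j) (ℕ.≤-reflexive (ℕ.m+n∸n≡m p j))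
        1≤h : 1 ℕ.≤ h
        1≤h = ℕ.≤-trans 1≤j j≤h
        h≤w : h ℕ.≤ w
        h≤w = ℕ.≤-trans h≤p+j (ℕ.+-monoʳ-≤ p j≤s)
        V : ℤ
        V = at g h
        g≥ : ∀ i → 1 ℕ.≤ i → i ℕ.≤ w → i ℕ.≤ h → V ≤ at g i
        g≥ i a _ b = Ag i h a b h≤w
        g≤ : ∀ i → i ℕ.≤ w → h ℕ.< i → at g i ≤ V
        g≤ i b c = Ag h i 1≤h (ℕ.<⇒≤ c) b
        suc-∸ : suc h ∸ j ≡ suc t
        suc-∸ = ℕ.+-∸-assoc 1 j≤h

      cond2⇒P : sumFT (at d) (suc h ∸ j) p + sumFT (at a) (suc j) s ≤ sumFT (at g) (suc h) w → Pg V
          ≤ Pd V + Ha j V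
      cond2⇒P c rewrite suc-∸ = tail⇒P h t j V h≤w t≤p j≤s h≡t+j g≥ g≤ c

      P⇒cond2 : Pg V ≤ Pd V + Ha j V → sumFT (at d) (suc h ∸ j) p + sumFT (at a) (suc j) s
          ≤ sumFT (at g) (suc h) w
      P⇒cond2 c rewrite suc-∸ = P⇒tail h t j V h≤w t≤p j≤s h≡t+j g≥ g≤ d≥ d≤ c
        where
        d≥ : ∀ i → 1 ℕ.≤ i → i ℕ.≤ p → i ℕ.≤ t → V ≤ at d i
        d≥ i 1≤i i≤p i≤t with before i 1≤i (ℕ.≤-trans (ℕ.+-monoˡ-≤ j i≤t) (ℕ.≤-reflexive (sym h≡t+j)))
        ... | _ , q = ≤-trans (g≥ (i ℕ.+ (j ∸ 1)) (ℕ.≤-trans 1≤i (ℕ.m≤m+n i _)) (ℕ.≤-trans le h≤w) le) q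
          where
          le : i ℕ.+ (j ∸ 1) ℕ.≤ h
          le = ℕ.≤-trans (ℕ.+-mono-≤ i≤t (ℕ.m∸n≤m j 1)) (ℕ.≤-reflexive (sym h≡t+j))
        d≤ : ∀ i → i ℕ.≤ p → t ℕ.< i → at d i ≤ V
        d≤ i i≤p t<i = ≤-trans (Ad (suc t) i (s≤s z≤n) t<i i≤p)
            (≤-trans (≤+1 (at d (suc t))) (after (ℕ.≤-trans t<i i≤p)))

      -- One below `V = g_h` none of the first `h` entries of `g` is counted, while all `d i` with
      -- `i > t` are. At `V` itself the copies of `g_h` would be counted and q could fall below `j`.
      j≤unused : ∀ u → V ≡ 1ℤ + u → + j ≤ + s - Ng u + Nd u
      j≤unused u V≡ = lin (N-high w (at g) Ag h u 1≤h h≤w (≤-reflexive (sym V≡)) ⊕ Nd≥)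
        (eq (+ s) (+ p) (Ng u) (Nd u) (+ h) (+ t) (+ j) (cong +_ h≡t+j))
        where
        eq : ∀ s p a b h t j → h ≡ t + j → s - a + b - j ≡ p + s - h + b - (a + (p - t))
        eq s p a b h t j refl = solve (s ∷ p ∷ a ∷ b ∷ t ∷ j ∷ [])
        Nd≥ : + p - + t ≤ Nd u
        Nd≥ with suc t ℕ.≤? p
        ... | yes q = N-low p (at d) Ad t u q (lin (after q ⊕ ≤-reflexive V≡) (eq′ (at d (suc t)) V u))
          where
          eq′ : ∀ a v u → u - a ≡ v + (1ℤ + u) - (1ℤ + a + v)
          eq′ a v u = solve (a ∷ v ∷ u ∷ [])
        ... | no ¬q = ≤-trans (ℤP.i≤j⇒i-j≤0 (+≤ (ℕ.≤-pred (ℕ.≰⇒> ¬q))))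
            (Σ-0≤ p (λ i _ _ → 0≤·1 (at d i ≤ᵇ u)))

    upper : ∀ v → Σ[ V ∈ ℤ ] v ≤ V × (∀ i → 1 ℕ.≤ i → i ℕ.≤ w → at g i ≤ V)
    upper v = v ℤ.⊔ at g 1 , ℤP.i≤i⊔j v (at g 1) , λ i a b →
        ≤-trans (Ag 1 i ℕ.≤-refl a b) (ℤP.i≤j⊔i v (at g 1))

    module Elim (G : Maj.GMaj g d a) where
      open Maj.GMaj G

      Nd≤Ng : ∀ u → Nd u ≤ Ng u
      Nd≤Ng u = ≤-trans (lin (Σ-0≤ s (λ i _ _ → 0≤·1 (at g i ≤ᵇ u)) ⊕ Σ-≤ p pw) (eq (Nd u) S₀ S₁))
          (≤-reflexive (sym split))
        where
        f : ℕ → ℤ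
        f i = (at g i ≤ᵇ u) · 1ℤ
        S₀ S₁ : ℤ
        S₀ = Σ s f
        S₁ = Σ p (λ i → f (s ℕ.+ i))
        split : Ng u ≡ S₀ + S₁
        split = trans (cong (λ k → Σ k f) (ℕ.+-comm p s)) (Σ-shift s p f)
        eq : ∀ n a b → a + b - n ≡ a + b - (0ℤ + n)
        eq n a b = solve (n ∷ a ∷ b ∷ [])
        pw : ∀ i → 1 ℕ.≤ i → i ℕ.≤ p → (at d i ≤ᵇ u) · 1ℤ ≤ f (s ℕ.+ i)
        pw i 1≤i i≤p with at d i ≤ᵇ u in e
        ... | false = 0≤·1 (at g (s ℕ.+ i) ≤ᵇ u)
        ... | true rewrite ≤⇒true (≤-trans (subst (λ k → at g k ≤ at d i) (ℕ.+-comm i s) (cond1 i 1≤i i≤p))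
            (true⇒≤ {at d i} e)) = ≤-refl

      bound : ∀ v → Pg v ≤ Pd v + T₊ s (at a) (+ s - Ng v + Nd v) v
      bound v = descend s ℕ.≤-refl (λ u _ → lin (Nd≤Ng u) (eq (+ s) (Nd u) (Ng u)))
        where
        eq : ∀ s a b → b - (s - s + a) ≡ b - a
        eq s a b = solve (s ∷ a ∷ b ∷ [])
        Goal : Set
        Goal = Pg v ≤ Pd v + T₊ s (at a) (+ s - Ng v + Nd v) v
        finish : ∀ j → (∀ u → v ≤ u → + s - + j + Nd u ≤ Ng u) → Pg v ≤ Pd v + Ha j v → Goal
        finish j r h = ≤-trans h (ℤP.+-monoʳ-≤ (Pd v) (≤-trans (Hα≤T₊ s (at a) j v)
          (T₊-anti s (at a) {+ s - Ng v + Nd v} {+ j} v (lin (r v ≤-refl) (eq′ (+ s) (+ j) (Nd v) (Ng v))))))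
          where
          eq′ : ∀ s j a b → j - (s - b + a) ≡ b - (s - j + a)
          eq′ s j a b = solve (s ∷ j ∷ a ∷ b ∷ [])
        -- Looks for the largest `j` with `v < g_{h_j}`. The invariant says that q is at most `j`
        -- from `v` on; when `g_{h_j} ≤ v`, `count-shift` renews it for `j − 1`.
        descend : ∀ j → j ℕ.≤ s → (∀ u → v ≤ u → + s - + j + Nd u ≤ Ng u) → Goal
        -- For `j = 0` the total-sum condition takes the place of the second one, at a threshold
        -- above all of `g`.
        descend zero _ r with upper v
        ... | V , v≤V , g≤V = finish 0 r (slide 0 z≤n v≤V r (tail⇒P 0 0 0 V z≤n z≤n z≤n refl
                (λ i a _ b → ⊥-elim (ℕ.<⇒≱ a b)) (λ i b c → g≤V i c b) cond3))
        descend (suc j) j≤s r with at g (hIdx (suc j)) ≤or> v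
        ... | inj₁ h≤v = descend j (ℕ.≤-trans (ℕ.n≤1+n j) j≤s) λ u v≤u →
                lin (count-shift (suc j) (s≤s z≤n) j≤s u (≤-trans h≤v v≤u)) (eq″ (+ s) (+ j) (Nd u) (Ng u))
          where
          eq″ : ∀ s j a b → b - (s - j + a) ≡ b - (s - (1ℤ + j) + 1ℤ + a)
          eq″ s j a b = solve (s ∷ j ∷ a ∷ b ∷ [])
        ... | inj₂ v<h = finish (suc j) r (slide (suc j) j≤s (≤-trans (≤+1 v) v<h) r
                (cond2⇒P (suc j) (s≤s z≤n) j≤s (cond2 (suc j) (s≤s z≤n) j≤s)))

    intro : ∀ top → (∀ i → 1 ℕ.≤ i → i ℕ.≤ w → at g i ≤ top) → (∀ i → 1 ℕ.≤ i → i ℕ.≤ p → at d i ≤ top) →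
      (∀ i → 1 ℕ.≤ i → i ℕ.≤ s → at a i ≤ top) → (∀ u → Nd u ≤ Ng u) →
      (∀ u v → v ≡ 1ℤ + u → v ≤ top → Pg v ≤ Pd v + T₊ s (at a) (+ s - Ng u + Nd u) v) → Maj.GMaj g d a
    intro top g≤ d≤ a≤ Nd≤Ng Q = record { len = len ; cond1 = c1 ; cond2 = c2 ; cond3 = c3 }
      where
      pred : ∀ V → V ≡ 1ℤ + (V - 1ℤ)
      pred V = solve (V ∷ [])
      c1 : ∀ i → 1 ℕ.≤ i → i ℕ.≤ p → at g (i ℕ.+ s) ≤ at d i
      c1 (suc i) 1≤i i≤p with at g (suc i ℕ.+ s) ≤or> at d (suc i)
      ... | inj₁ h = h
      ... | inj₂ h = absurd {+ p - + i} {+ p - (1ℤ + + i)}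
              (≤-trans (N-low p (at d) Ad i (at d (suc i)) i≤p ≤-refl) (≤-trans (Nd≤Ng (at d (suc i)))
                (≤-trans (N-high w (at g) Ag (suc i ℕ.+ s) (at d (suc i)) (s≤s z≤n) (ℕ.+-monoˡ-≤ s i≤p) h)
                  (≤-reflexive (eq (+ p) (+ s) (+ i))))))
              (≤-reflexive (eq′ (+ p) (+ i)))
        where
        eq : ∀ p s i → p + s - (1ℤ + i + s) ≡ p - (1ℤ + i)
        eq p s i = solve (p ∷ s ∷ i ∷ [])
        eq′ : ∀ p i → 1ℤ + (p - (1ℤ + i)) ≡ p - i
        eq′ p i = solve (p ∷ i ∷ [])
      c2 : ∀ j → 1 ℕ.≤ j → j ℕ.≤ s → sumFT (at d) (suc (hIdx j) ∸ j) p + sumFT (at a) (suc j) s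
          ≤ sumFT (at g) (suc (hIdx j)) w
      c2 j 1≤j j≤s = P⇒cond2 j 1≤j j≤s (main (suc j ℕ.≤? s))
        where
        open Jump (jump j 1≤j j≤s)
        V : ℤ
        V = at g (hIdx j)
        V≤top : V ≤ top
        V≤top = g≤ (hIdx j) (ℕ.≤-trans 1≤j j≤h) (ℕ.≤-trans h≤p+j (ℕ.+-monoʳ-≤ p j≤s))
        direct : (∀ i → i ℕ.≤ s → j ℕ.< i → at a i ≤ V) → Pg V ≤ Pd V + Ha j V
        direct a≤V = ≤-trans (Q (V - 1ℤ) V (pred V) V≤top) (ℤP.+-monoʳ-≤ (Pd V)
          (≤-trans (T₊-anti s (at a) V (j≤unused j 1≤j j≤s (V - 1ℤ) (pred V))) (Σ-≤ s pw)))
          where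
          pw : ∀ i → 1 ℕ.≤ i → i ℕ.≤ s → (+ j <ᵇ + i) · pos (V - at a i) ≤ (j ℕ.<ᵇ i) · (V - at a i)
          pw i _ i≤s rewrite +<ᵇ j i with j ℕ.<ᵇ i in e
          ... | true  = ≤-reflexive (pos-below (a≤V i i≤s (true⇒n< {j} {i} e)))
          ... | false = ≤-refl
        main : _ → Pg V ≤ Pd V + Ha j V
        main (no ¬q) = direct λ i i≤s j<i → ⊥-elim (¬q (ℕ.≤-trans j<i i≤s))
        main (yes q) with at a (suc j) ≤or> V
        ... | inj₁ h = direct λ i i≤s j<i → ≤-trans (Aa (suc j) i (s≤s z≤n) j<i i≤s) h
        -- `Ha j` is not the hinge sum at `V` here. At the threshold `a (suc j)`, however, it equals
        -- `P s a`; the inequality is obtained there and carried down to `V`.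
        ... | inj₂ h = slide j j≤s {V} {at a (suc j)} (≤-trans (≤+1 V) h)
                (λ u V≤u → lin (count-shift j 1≤j j≤s u V≤u ⊕ 0≤1) (eq (+ s) (+ j) (Nd u) (Ng u)))
                (≤-trans (Q (at a (suc j) - 1ℤ) (at a (suc j)) (pred (at a (suc j)))
                    (a≤ (suc j) (s≤s z≤n) q)) (ℤP.+-monoʳ-≤ (Pd (at a (suc j)))
                  (≤-trans (T₊≤P s (at a) (+ s - Ng (at a (suc j) - 1ℤ) + Nd (at a (suc j) - 1ℤ))
                      (at a (suc j))) (≤-reflexive (P≡Hα s (at a) j (at a (suc j))
                    (λ i a b c → Aa i (suc j) a (ℕ.≤-trans c (ℕ.n≤1+n j)) q)
                        (λ i b c → Aa (suc j) i (s≤s z≤n) c b))))))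
          where
          eq : ∀ s j a b → b - (s - j + a) ≡ b + 1ℤ - (s - j + 1ℤ + a + 0ℤ)
          eq s j a b = solve (s ∷ j ∷ a ∷ b ∷ [])
      c3 : sumFT (at d) 1 p + sumFT (at a) 1 s ≤ sumFT (at g) 1 w
      c3 = P⇒tail 0 0 0 top z≤n z≤n z≤n refl (λ i a _ b → ⊥-elim (ℕ.<⇒≱ a b)) (λ i b c → g≤ i c b)
        (λ i a _ b → ⊥-elim (ℕ.<⇒≱ a b)) (λ i b c → d≤ i c b)
        (≤-trans (Q (top - 1ℤ) top (pred top) ≤-refl)
            (ℤP.+-monoʳ-≤ (Pd top) (≤-trans (T₊≤P s (at a) (+ s - Ng (top - 1ℤ) + Nd (top - 1ℤ)) top)
          (≤-reflexive (P≡Hα s (at a) 0 top (λ i a _ b → ⊥-elim (ℕ.<⇒≱ a b)) (λ i b c → a≤ i c b))))))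

  -- Comparison of κ with a solution

  at-step : ∀ n x b → Anti n x → ∀ u → Nw n x b (1ℤ + u) ≤ Nw n x b u
    ⊎ (∃[ j ] x j ≡ 1ℤ + u × Least (λ i → b i ∧ (x i ≤ᵇ x j)) n j)
  at-step n x b A u with firstIndex n (λ i → b i ∧ (x i ≤ᵇ (1ℤ + u)))
  ... | inj₂ none = inj₁ (≤-trans (≤-reflexive (Σ-≡0 n λ i p q →
      trans (·-∧ (b i) (x i ≤ᵇ (1ℤ + u)) 1ℤ) (cong (_· 1ℤ) (none i p q)))) (0≤Nw n x b u))
  ... | inj₁ (j , least 1≤j j≤n e below) with (1ℤ + u) ≤or> x j
  ...   | inj₁ p = inj₂ (j , xj≡ , subst (λ z → Least (λ i → b i ∧ (x i ≤ᵇ z)) n j) (sym xj≡)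
      (least 1≤j j≤n e below))
    where
    xj≡ : x j ≡ 1ℤ + u
    xj≡ = ≤-antisym (true⇒≤ {x j} (proj₂ (∧-true {b j} e))) p
  ...   | inj₂ p = inj₁ (Σ-≤ n pw)
    where
    xj≤u : x j ≤ u
    xj≤u = lin p (eq₀ (x j) u)
      where
      eq₀ : ∀ a b → b - a ≡ 1ℤ + b - (1ℤ + a)
      eq₀ a b = solve (a ∷ b ∷ [])
    pw : ∀ i → 1 ℕ.≤ i → i ℕ.≤ n → b i · ((x i ≤ᵇ (1ℤ + u)) · 1ℤ) ≤ b i · ((x i ≤ᵇ u) · 1ℤ)
    pw i a c with i ℕ.<? j
    ... | yes q = ≤-trans (≤-reflexive (trans (·-∧ (b i) (x i ≤ᵇ (1ℤ + u)) 1ℤ)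
        (cong (_· 1ℤ) (below i a q)))) (·-0≤ (b i) (0≤·1 (x i ≤ᵇ u)))
    ... | no ¬q rewrite ≤⇒true (≤-trans (A j i 1≤j (ℕ.≮⇒≥ ¬q) c) xj≤u) | ≤⇒true
        (≤-trans (A j i 1≤j (ℕ.≮⇒≥ ¬q) c) (≤-trans xj≤u (≤+1 u))) = ≤-refl

  -- An entry is chosen only where leaving it out is impossible for g as well.
  module Dominated (nx ny w : ℕ) (x y g : ℕ → ℤ) (inX inY : ℕ → Bool) (Ax : Anti nx x) (Ay : Anti ny y)
    (forcedX : ∀ j → Least (λ i → inX i ∧ (x i ≤ᵇ x j)) nx j →
      Pw nx x inX (x j) + Pw ny y inY (x j) ≤ P w g (x j) → Nw nx x inX (x j) + Nw ny y inY (x j)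
          ≤ N w g (x j))
    (forcedY : ∀ j → Least (λ i → inY i ∧ (y i ≤ᵇ y j)) ny j →
      Pw ny y inY (y j) + Pw nx x inX (y j) ≤ P w g (y j) → Nw ny y inY (y j) + Nw nx x inX (y j)
          ≤ N w g (y j)) where

    Both : ℤ → Set
    Both v = Pw nx x inX v + Pw ny y inY v ≤ P w g v × Nw nx x inX v + Nw ny y inY v ≤ N w g v

    -- The bound on `P` at `1ℤ + u` needs only both bounds at `u`, so it is available when `forcedX`
    -- or `forcedY` asks for it to bound the count at `1ℤ + u`.
    both-step : ∀ u → Both u → Both (1ℤ + u)
    both-step u (p , q) = p′ , q′
      where
      p′ : Pw nx x inX (1ℤ + u) + Pw ny y inY (1ℤ + u) ≤ P w g (1ℤ + u)
      p′ rewrite Pw-step nx x inX u | Pw-step ny y inY u | P-step w g u =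
        lin (p ⊕ q) (eq (Pw nx x inX u) (Nw nx x inX u) (Pw ny y inY u) (Nw ny y inY u) (P w g u) (N w g u))
        where
        eq : ∀ a b c d e f → e + f - (a + b + (c + d)) ≡ e + f - (a + c + (b + d))
        eq a b c d e f = solve (a ∷ b ∷ c ∷ d ∷ e ∷ f ∷ [])
      q′ : Nw nx x inX (1ℤ + u) + Nw ny y inY (1ℤ + u) ≤ N w g (1ℤ + u)
      q′ with at-step nx x inX Ax u | at-step ny y inY Ay u
      ... | inj₁ r | inj₁ r′ = ≤-trans (r ⊕ r′) (≤-trans q (N-mono w g (≤+1 u)))
      ... | inj₂ (j , e , L) | _ = subst (λ z → Nw nx x inX z + Nw ny y inY z ≤ N w g z) e
              (forcedX j L (subst (λ z → Pw nx x inX z + Pw ny y inY z ≤ P w g z) (sym e) p′))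
      ... | inj₁ _ | inj₂ (j , e , L) = ≤-trans (≤-reflexive
          (ℤP.+-comm (Nw nx x inX (1ℤ + u)) (Nw ny y inY (1ℤ + u))))
              (subst (λ z → Nw ny y inY z + Nw nx x inX z ≤ N w g z) e
                (forcedY j L (subst (λ z → Pw ny y inY z + Pw nx x inX z ≤ P w g z) (sym e)
                  (≤-trans (≤-reflexive (ℤP.+-comm (Pw ny y inY (1ℤ + u)) (Pw nx x inX (1ℤ + u)))) p′))))

    dominated : ∀ v → Pw nx x inX v + Pw ny y inY v ≤ P w g v
    dominated v with lower nx x v
    ... | b₀ , b₀≤v , hx with lower ny y b₀
    ...   | b , b≤b₀ , hy with gap (≤-trans b≤b₀ b₀≤v)
    ...     | k , refl = proj₁ (go k)
      where
      hx′ : ∀ i → 1 ℕ.≤ i → i ℕ.≤ nx → 1ℤ + b ≤ x i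
      hx′ i p q = ≤-trans (ℤP.+-monoʳ-≤ 1ℤ b≤b₀) (hx i p q)
      go : ∀ k → Both (+ k + b)
      go zero = subst Both (sym (ℤP.+-identityˡ b))
        ( ≤-trans (≤-reflexive (cong₂ _+_ (Pw-low nx x inX b hx′) (Pw-low ny y inY b hy)))
            (Σ-0≤ w λ i _ _ → 0≤pos (b - g i))
        , ≤-trans (≤-reflexive (cong₂ _+_ (Nw-low nx x inX b hx′) (Nw-low ny y inY b hy)))
            (Σ-0≤ w λ i _ _ → 0≤·1 (g i ≤ᵇ b)))
      go (suc k) rewrite ℤP.+-assoc 1ℤ (+ k) b = both-step (+ k + b) (go k)

  -- Conditions (i) and (ii) as hinge inequalities

  Σ-hinge₂ : ∀ n (b c : ℕ → Bool) (x : ℕ → ℤ) v →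
    Σ n (λ i → b i · (c i · (v - x i))) ≡ v * Σ n (λ i → b i · (c i · 1ℤ)) - Σ n (λ i → b i · (c i · x i))
  Σ-hinge₂ n b c x v = trans (Σ-≡ n λ i _ _ → ·-∧ (b i) (c i) (v - x i))
      (trans (Σ-hinge n (λ i → b i ∧ c i) x v)
    (cong₂ (λ s t → v * s - t) (Σ-≡ n λ i _ _ → sym (·-∧ (b i) (c i) 1ℤ))
        (Σ-≡ n λ i _ _ → sym (·-∧ (b i) (c i) (x i)))))

  module Rank (n z : ℕ) (x : ℕ → ℤ) (A : Anti n x) (X : ℤ) (z≡ : + z ≡ Σ n (λ i → (X <ᵇ x i) · 1ℤ)) where
    z≡M : + z ≡ M n x (1ℤ + X)
    z≡M = trans z≡ (Σ-≡ n λ i _ _ → cong (_· 1ℤ) (pw (x i)))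
      where
      pw : ∀ t → (X <ᵇ t) ≡ ((1ℤ + X) ≤ᵇ t)
      pw t with t ≤or> X
      ... | inj₁ p rewrite ≥⇒false p = sym (>⇒false {1ℤ + X} t (ℤP.+-monoʳ-≤ 1ℤ p))
      ... | inj₂ p rewrite <⇒true X p = sym (≤⇒true p)

    rank≤ : z ℕ.≤ n
    rank≤ = ≤+ (≤-trans (≤-reflexive z≡) (≤-trans (Σ-≤ n λ i _ _ → ·1≤1 (X <ᵇ x i)) (≤-reflexive (Σ-1 n))))

    above : ∀ i → 1 ℕ.≤ i → i ℕ.≤ z → 1ℤ + X ≤ x i
    above (suc i) p q with x (suc i) ≤or> X
    ... | inj₂ r = r
    ... | inj₁ r = ⊥-elim (ℕ.<⇒≱ q (≤+ (≤-trans (≤-reflexive z≡M)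
            (M-high n x A i (1ℤ + X) (ℕ.≤-trans q rank≤) (ℤP.+-monoʳ-≤ 1ℤ r)))))

    under : ∀ i → 1 ℕ.≤ i → i ℕ.≤ n → z ℕ.< i → x i ≤ X
    under i p q r with x i ≤or> X
    ... | inj₁ h = h
    ... | inj₂ h = ⊥-elim (ℕ.<⇒≱ r (≤+ (≤-trans (M-low n x A i (1ℤ + X) p q h) (≤-reflexive (sym z≡M)))))

    rank<ᵇ : ∀ i → 1 ℕ.≤ i → i ℕ.≤ n → (z ℕ.<ᵇ i) ≡ (x i ≤ᵇ X)
    rank<ᵇ i p q with z ℕ.<ᵇ i in e
    ... | true  = sym (≤⇒true (under i p q (true⇒n< {z} {i} e)))
    ... | false = sym (>⇒false X (above i p (false⇒n≥ {z} {i} e)))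

  module CondStar (x y α : List ℤ) (inX outX inY : ℕ → Bool)
    (Ax : Anti (length x) (at x)) (Ay : Anti (length y) (at y)) (Aα : Anti (length α) (at α))
    (x≢y : ∀ i j → 1 ℕ.≤ i → i ℕ.≤ length x → 1 ℕ.≤ j → j ℕ.≤ length y → at x i ≢ at y j)
    (compl : ∀ i → 1 ℕ.≤ i → i ℕ.≤ length x → outX i ≡ not (inX i)) where

    nx ny s : ℕ
    nx = length x
    ny = length y
    s = length α

    module C = Core nx ny s (at x) (at y) (at α) inX outX inY Ax Ay Aα x≢y compl

    xs e : List ℤ
    xs = sel (at y) inY 1 ny
    e = eSeq α x

    module D = Cond xs x outX α e

    ineq-intro : ∀ j → (∀ lo → (+ D.zY j) + D.tY j ≡ + suc lo → sumFT (at e) (suc lo) (D.zY j ℕ.+ D.mY j)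
        ≤ D.rhs j) →
      ((+ D.zY j) + D.tY j ≤ 0ℤ → ⊥) → D.Ineq j
    ineq-intro j f n with (+ D.zY j) + D.tY j
    ... | + zero = n ≤-refl
    ... | -[1+ _ ] = n -≤+
    ... | + suc lo = f lo refl

    ineq-elim : ∀ j → D.Ineq j → Σ[ lo ∈ ℕ ] (+ D.zY j) + D.tY j
        ≡ + suc lo × sumFT (at e) (suc lo) (D.zY j ℕ.+ D.mY j) ≤ D.rhs j
    ineq-elim j h with (+ D.zY j) + D.tY j
    ... | + suc lo = lo , refl , h

    module Pivot (j l : ℕ) (I : Index (at y) inY 1 ny xs j l) where
      open Index I renaming (r≤l to 1≤l)
      l≤ny : l ℕ.≤ ny
      l≤ny = ℕ.≤-pred l<rk
      X : ℤ
      X = at y l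
      m z E : ℕ
      m = D.mY j
      z = D.zY j
      E = z ℕ.+ m

      m≡ : + m ≡ C.ml l
      m≡ = trans (count-Σ s (λ i → at xs j <ᵇ at α i)) (cong (λ t → Σ s (λ i → (t <ᵇ at α i) · 1ℤ)) val)
      z≡ : + z ≡ Σ nx (λ i → (X <ᵇ at x i) · 1ℤ)
      z≡ = trans (count-Σ nx (λ i → at xs j <ᵇ at x i)) (cong (λ t → Σ nx (λ i → (t <ᵇ at x i) · 1ℤ)) val)
      E≡ : + E ≡ Σ (length e) (λ i → (X <ᵇ at e i) · 1ℤ)
      E≡ = trans (cong₂ _+_ z≡ m≡) (trans (ℤP.+-comm (Σ nx (λ i → (X <ᵇ at x i) · 1ℤ)) (C.ml l))
        (sym (trans (Σ-at (λ t → (X <ᵇ t) · 1ℤ) e) (eSeq-Σ α x (λ t → (X <ᵇ t) · 1ℤ)))))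

      module Rα = Rank s m (at α) Aα X m≡
      module Rx = Rank nx z (at x) Ax X z≡
      Ae : Anti (length e) (at e)
      Ae = eSeq-Anti α x Aα Ax
      module Re = Rank (length e) E (at e) Ae X E≡

      n₁ n₂ Sy Sx Sα : ℤ
      n₁ = Σ ny (λ i → (l ℕ.<ᵇ i) · (inY i · 1ℤ))
      n₂ = Σ nx (λ i → (outX i ∧ (at x i <ᵇ X)) · 1ℤ)
      Sy = Σ ny (λ i → (l ℕ.<ᵇ i) · (inY i · at y i))
      Sx = Σ nx (λ i → (outX i ∧ (at x i <ᵇ X)) · at x i)
      Sα = sumFT (at α) (suc m) s

      t≡ : D.tY j ≡ C.tl l
      t≡ = cong₂ (λ a b → + s - a + b)
        (trans (sym (Σ-count> j (length xs) y≤h)) (tail (λ _ → 1ℤ)))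
        (trans (count-Σ nx (λ i → outX i ∧ (at x i <ᵇ at xs j)))
            (cong (λ t → Σ nx (λ i → (outX i ∧ (at x i <ᵇ t)) · 1ℤ)) val))

      rhs≡ : D.rhs j ≡ X + Sy - Sx - Sα
      rhs≡ = cong₂ (λ a b → a - b - Sα) first second
        where
        peel : ∀ j → 1 ℕ.≤ j → j ℕ.≤ length xs → sumFT (at xs) j (length xs)
            ≡ at xs j + Σ (length xs) (λ i → (j ℕ.<ᵇ i) · at xs i)
        peel (suc j) _ q = trans (sumFT-Σ (at xs) j (length xs)) (Σ-peel (at xs) j (length xs) q)
        first : sumFT (at xs) j (length xs) ≡ X + Sy
        first = trans (peel j 1≤y y≤h) (cong₂ _+_ val (tail id))
        second : sumWhere nx (λ i → outX i ∧ (z ℕ.<ᵇ i)) (at x) ≡ Sx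
        second = trans (sumWhere-Σ nx (λ i → outX i ∧ (z ℕ.<ᵇ i)) (at x)) (Σ-≡ nx pw)
          where
          pw : ∀ i → 1 ℕ.≤ i → i ℕ.≤ nx → (outX i ∧ (z ℕ.<ᵇ i)) · at x i ≡ (outX i ∧ (at x i <ᵇ X)) · at x i
          pw i a b rewrite Rx.rank<ᵇ i a b with at x i ≤or> X
          ... | inj₁ p rewrite ≤⇒true p | <⇒true (at x i) {X}
              (ℤP.i<j⇒suc[i]≤j (ℤP.≤∧≢⇒< p (x≢y i l a b 1≤l l≤ny))) = refl
          ... | inj₂ p rewrite >⇒false X p | ≥⇒false {at x i} {X} (≤-trans (≤+1 X) p) = refl

      -- The number of terms in the sum of condition (i), from `z + t` to `z + m`.
      r : ℤ
      r = + m - D.tY j + 1ℤ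

      S₁ S₂ S₄ : ℤ → ℤ
      S₁ v = Σ ny (λ i → (l ℕ.≤ᵇ i) · (inY i · (v - at y i)))
      S₂ v = Σ nx (λ i → (outX i ∧ (at x i <ᵇ X)) · (v - at x i))
      S₄ v = Σ nx (λ i → (X <ᵇ at x i) · pos (v - at x i))

      S₁≡ : ∀ v → S₁ v ≡ v - X + (v * n₁ - Sy)
      S₁≡ v = trans (peel l 1≤l l≤ny pl) (cong (λ t → v - X + t) (Σ-hinge₂ ny (l ℕ.<ᵇ_) inY (at y) v))
        where
        peel : ∀ l → 1 ℕ.≤ l → l ℕ.≤ ny → inY l ≡ true → Σ ny (λ i → (l ℕ.≤ᵇ i) · (inY i · (v - at y i)))
          ≡ v - at y l + Σ ny (λ i → (l ℕ.<ᵇ i) · (inY i · (v - at y i)))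
        peel (suc l) _ q e′ = trans (Σ-peel (λ i → inY i · (v - at y i)) l ny q)
          (cong (λ t → t · (v - at y (suc l)) + Σ ny (λ i → (suc l ℕ.<ᵇ i) · (inY i · (v - at y i)))) e′)

      -- The first `E` entries of e are those above `X`. Those from `x` contribute `S₄`; those from
      -- `α` contribute all of `P s α` except the tail at or below `X`, which is affine as `X ≤ v`.
      P-e : ∀ v → X ≤ v → P E (at e) v ≡ S₄ v + (P s (at α) v - Hα s (at α) m v)
      P-e v X≤v = trans (sym cut) (trans (Σ-at (λ t → (X <ᵇ t) · pos (v - t)) e)
        (trans (eSeq-Σ α x (λ t → (X <ᵇ t) · pos (v - t)))
            (trans (ℤP.+-comm _ (S₄ v)) (cong (λ t → S₄ v + t) (Σ-≡₋ s pw)))))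
        where
        rest : ℕ
        rest = length e ∸ E
        cut : Σ (length e) (λ i → (X <ᵇ at e i) · pos (v - at e i)) ≡ P E (at e) v
        cut = trans (cong (λ k → Σ k (λ i → (X <ᵇ at e i) · pos (v - at e i))) (sym (ℕ.m+[n∸m]≡n Re.rank≤)))
          (trans (Σ-shift E rest (λ i → (X <ᵇ at e i) · pos (v - at e i)))
            (trans (cong₂ _+_ (Σ-≡ E pw₁) (Σ-≡0 rest pw₂)) (ℤP.+-identityʳ (P E (at e) v))))
          where
          pw₁ : ∀ i → 1 ℕ.≤ i → i ℕ.≤ E → (X <ᵇ at e i) · pos (v - at e i) ≡ pos (v - at e i)
          pw₁ i a b rewrite <⇒true X (Re.above i a b) = refl
          pw₂ : ∀ i → 1 ℕ.≤ i → i ℕ.≤ rest → (X <ᵇ at e (E ℕ.+ i)) · pos (v - at e (E ℕ.+ i)) ≡ 0ℤ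
          pw₂ i a b rewrite ≥⇒false {X} (Re.under (E ℕ.+ i) (ℕ.≤-trans a (ℕ.m≤n+m i E))
              (ℕ.≤-trans (ℕ.+-monoʳ-≤ E b) (ℕ.≤-reflexive (ℕ.m+[n∸m]≡n Re.rank≤))) (ℕ.m<m+n E a)) = refl
        pw : ∀ i → 1 ℕ.≤ i → i ℕ.≤ s → (X <ᵇ at α i) · pos (v - at α i)
            ≡ pos (v - at α i) - (m ℕ.<ᵇ i) · (v - at α i)
        pw i a b rewrite Rα.rank<ᵇ i a b with at α i ≤or> X
        ... | inj₁ p rewrite ≤⇒true p | pos-below {v} {at α i} (≤-trans p X≤v) = sym
            (ℤP.i≡j⇒i-j≡0 {v - at α i} refl)
        ... | inj₂ p rewrite >⇒false X p = sym (ℤP.+-identityʳ (pos (v - at α i)))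

      -- Collects the terms of `Star` so that it reads `r * v − rhs ≤ P E e v`. The least `rhs`
      -- allowing this for all `v` is a conjugate value of `P E e`, namely the sum of the last `r`
      -- of the first `E` entries when `1 ≤ r ≤ E`.
      star-eq : ∀ v → X ≤ v → S₂ v + S₄ v + P s (at α) v - S₁ v ≡ P E (at e) v - (r * v - D.rhs j)
      star-eq v X≤v rewrite P-e v X≤v | rhs≡ | S₁≡ v | Σ-hinge nx (λ i → outX i ∧ (at x i <ᵇ X)) (at x) v
        | Hα≡ s (at α) m v Rα.rank≤ | t≡ = eq v X n₁ n₂ Sy Sx Sα (S₄ v) (P s (at α) v) (+ s) (+ m)
        where
        eq : ∀ v X n₁ n₂ y x a f p s m → v * n₂ - x + f + p - (v - X + (v * n₁ - y))
          ≡ f + (p - (v * (s - m) - a)) - ((m - (s - n₁ + n₂) + 1ℤ) * v - (X + y - x - a))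
        eq v X n₁ n₂ y x a f p s m = solve (v ∷ X ∷ n₁ ∷ n₂ ∷ y ∷ x ∷ a ∷ f ∷ p ∷ s ∷ m ∷ [])

      module _ (lo : ℕ) (lo≡ : + z + D.tY j ≡ + suc lo) (t≤m : D.tY j ≤ + m) where
        lo<E : suc lo ℕ.≤ E
        lo<E = ≤+ (subst (_≤ + E) lo≡ (ℤP.+-monoʳ-≤ (+ z) t≤m))
        H≡ : ∀ v → Hα E (at e) lo v ≡ r * v - sumFT (at e) (suc lo) E
        H≡ v = trans (Hα≡ E (at e) lo v (ℕ.<⇒≤ lo<E))
            (cong (_- sumFT (at e) (suc lo) E) (eq (+ z) (+ m) (D.tY j) (+ lo) v lo≡))
          where
          eq : ∀ z m t lo v → z + t ≡ 1ℤ + lo → v * (z + m - lo) ≡ (m - t + 1ℤ) * v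
          eq z m t lo v h = trans (cong (λ k → v * (z + m - k))
              (trans (eq₁ lo) (cong (λ k → k - 1ℤ) (sym h)))) (eq₂ z m t v)
            where
            eq₁ : ∀ lo → lo ≡ 1ℤ + lo - 1ℤ
            eq₁ lo = solve (lo ∷ [])
            eq₂ : ∀ z m t v → v * (z + m - (z + t - 1ℤ)) ≡ (m - t + 1ℤ) * v
            eq₂ z m t v = solve (z ∷ m ∷ t ∷ v ∷ [])

        -- `r * v` minus the sum of e is an affine minorant of `P E e`, so the bound on the sum
        -- gives `Star` at every threshold.
        ineq⇒star : sumFT (at e) (suc lo) E ≤ D.rhs j → ∀ v → X ≤ v → C.Star l v
        ineq⇒star h v X≤v = lin (Hα≤P E (at e) lo v ⊕ h) (trans (star-eq v X≤v)
          (trans (eq (P E (at e) v) (r * v) (D.rhs j) (sumFT (at e) (suc lo) E))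
              (cong (λ t → P E (at e) v + D.rhs j - (t + sumFT (at e) (suc lo) E)) (sym (H≡ v)))))
          where
          eq : ∀ p rv h s → p - (rv - h) ≡ p + h - (rv - s + s)
          eq p rv h s = solve (p ∷ rv ∷ h ∷ s ∷ [])

        star⇒ineq : (∀ v → X ≤ v → C.Star l v) → sumFT (at e) (suc lo) E ≤ D.rhs j
        star⇒ineq h = lin (h v X≤v) (sym (trans (star-eq v X≤v)
          (trans (cong (λ t → t - (r * v - D.rhs j)) (trans (P≡Hα E (at e) lo v
              (λ i a b c → Ae i (suc lo) a (ℕ.≤-trans c (ℕ.n≤1+n lo)) (ℕ.≤-trans lo<E Re.rank≤))
              (λ i b c → Ae (suc lo) i (s≤s z≤n) c (ℕ.≤-trans b Re.rank≤))) (H≡ v)))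
            (eq (r * v) (D.rhs j) (sumFT (at e) (suc lo) E)))))
          where
          -- At the first entry of the sum the affine minorant touches `P E e`, so `Star` there is
          -- the inequality itself.
          v : ℤ
          v = at e (suc lo)
          X≤v : X ≤ v
          X≤v = ≤-trans (≤+1 X) (Re.above (suc lo) (s≤s z≤n) lo<E)
          eq : ∀ rv h s → rv - s - (rv - h) ≡ h - s
          eq rv h s = solve (rv ∷ h ∷ s ∷ [])

      -- If `z + t ≤ 0`, then `r` is at least `E + 1`, more than the slope of `P E e` can ever be,
      -- and `Star` fails for large `v`. This is the case in which the sum in (i) would contain e_i
      -- = +∞.
      star⇒positive : (∀ v → X ≤ v → C.Star l v) → + z + D.tY j ≤ 0ℤ → ⊥
      star⇒positive h nonpos with above-all E (at e) (X ℤ.⊔ 0ℤ)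
      ... | top , X⊔0≤top , e≤top = contradiction (gap 0≤v)
        where
        -- `v` lies above the first `E` entries of e, making `P E e` affine there; it is
        -- nonnegative, so that a factor of at least 1 does not decrease it; and it exceeds `c`,
        -- contradicting `excess`.
        c v : ℤ
        c = D.rhs j - sumFT (at e) 1 E
        v = top ℤ.⊔ (1ℤ + c)
        top≤v : top ≤ v
        top≤v = ℤP.i≤i⊔j top (1ℤ + c)
        X≤v : X ≤ v
        X≤v = ≤-trans (ℤP.i≤i⊔j X 0ℤ) (≤-trans X⊔0≤top top≤v)
        0≤v : 0ℤ ≤ v
        0≤v = ≤-trans (ℤP.i≤j⊔i X 0ℤ) (≤-trans X⊔0≤top top≤v)
        P≡ : P E (at e) v ≡ v * (+ E - 0ℤ) - sumFT (at e) 1 E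
        P≡ = trans (P≡Hα E (at e) 0 v (λ i a _ b → ⊥-elim (ℕ.<⇒≱ a b))
            (λ i b q → ≤-trans (e≤top i q b) top≤v)) (Hα≡ E (at e) 0 v z≤n)
        excess : (1ℤ - (+ z + D.tY j)) * v ≤ c
        excess = lin (h v X≤v) (sym (trans (star-eq v X≤v) (trans (cong (λ t → t - (r * v - D.rhs j)) P≡)
          (eq v (+ z) (+ m) (D.tY j) (sumFT (at e) 1 E) (D.rhs j)))))
          where
          eq : ∀ v z m t s h → v * (z + m - 0ℤ) - s - ((m - t + 1ℤ) * v - h) ≡ h - s - (1ℤ - (z + t)) * v
          eq v z m t s h = solve (v ∷ z ∷ m ∷ t ∷ s ∷ h ∷ [])
        contradiction : Σ[ k ∈ ℕ ] v ≡ + k + 0ℤ → ⊥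
        contradiction (k , v≡) with gap nonpos
        ... | n , n≡ = absurd {1ℤ + c} {c} (≤-trans (ℤP.i≤j⊔i top (1ℤ + c)) (≤-trans v≤ excess)) ≤-refl
          where
          0≤nk : 0ℤ ≤ + n * + k
          0≤nk = subst (0ℤ ≤_) (ℤP.pos-* n k) (+≤+ z≤n)
          v≤ : v ≤ (1ℤ - (+ z + D.tY j)) * v
          v≤ = lin 0≤nk (trans (cong (λ t → (1ℤ - (+ z + D.tY j)) * t - t) v≡)
              (eq (+ z + D.tY j) (+ n) (+ k) n≡))
            where
            eq : ∀ q n k → 0ℤ ≡ n + q → (1ℤ - q) * (k + 0ℤ) - (k + 0ℤ) ≡ n * k - 0ℤ
            eq q n k h = trans (cong (λ t → (1ℤ - t) * (k + 0ℤ) - (k + 0ℤ))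
                (trans (eq₁ q n) (cong (_- n) (sym h)))) (eq₂ n k)
              where
              eq₁ : ∀ q n → q ≡ n + q - n
              eq₁ q n = solve (q ∷ n ∷ [])
              eq₂ : ∀ n k → (1ℤ - (0ℤ - n)) * (k + 0ℤ) - (k + 0ℤ) ≡ n * k - 0ℤ
              eq₂ n k = solve (n ∷ k ∷ [])

    holds⇒star : D.Holds → ∀ l → 1 ℕ.≤ l → l ℕ.≤ ny → inY l ≡ true → C.tl l ≤ C.ml l → ∀ v → at y l ≤ v →
        C.Star l v
    holds⇒star H l 1≤l l≤ny inl t≤m with bwd (at y) inY 1 ny l 1≤l (s≤s l≤ny) inl
    ... | j , I with ineq-elim j (H j (Index.1≤y I) (Index.y≤h I) t≤m′)
      where
      t≤m′ : D.tY j ≤ + D.mY j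
      t≤m′ = subst₂ _≤_ (sym (Pivot.t≡ j l I)) (sym (Pivot.m≡ j l I)) t≤m
    ...   | lo , lo≡ , h = Pivot.ineq⇒star j l I lo lo≡
        (subst₂ _≤_ (sym (Pivot.t≡ j l I)) (sym (Pivot.m≡ j l I)) t≤m) h

    stars⇒holds : (∀ l → 1 ℕ.≤ l → l ℕ.≤ ny → inY l ≡ true → ∀ v → at y l ≤ v → C.Star l v) → D.Holds
    stars⇒holds S j 1≤j j≤h t≤m with fwd (at y) inY 1 ny j 1≤j j≤h
    ... | l , I = ineq-intro j (λ lo lo≡ → Pivot.star⇒ineq j l I lo lo≡ t≤m st) (Pivot.star⇒positive j l I st)
      where
      st : ∀ v → at y l ≤ v → C.Star l v
      st = S l (Index.r≤l I) (ℕ.≤-pred (Index.l<rk I)) (Index.pl I)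

  -- Both directions for lists

  isIn⇒inn : ∀ t → isIn t ≡ true → t ≡ inn
  isIn⇒inn inn _ = refl

  isOut⇒out : ∀ t → isOut t ≡ true → t ≡ out
  isOut⇒out out _ = refl

  linked⇒Anti : ∀ l → Linked ℤ._≥_ l → Anti (length l) (at l)
  linked⇒Anti l h = sorted⇒Anti l (Linked⇒AllPairs (λ p q → ≤-trans q p) h)

  ΣL-↭ : ∀ {A : Set} (f : A → ℤ) {l l′} → l ↭ l′ → ΣL f l ≡ ΣL f l′
  ΣL-↭ f Perm.refl = refl
  ΣL-↭ f (Perm.prep x p) = cong (λ t → f x + t) (ΣL-↭ f p)
  ΣL-↭ f (Perm.swap {xs} {ys} x y p) = trans (cong (λ t → f x + (f y + t)) (ΣL-↭ f p))
      (eq (f x) (f y) (ΣL f ys))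
    where
    eq : ∀ a b c → a + (b + c) ≡ b + (a + c)
    eq a b c = solve (a ∷ b ∷ c ∷ [])
  ΣL-↭ f (Perm.trans p q) = trans (ΣL-↭ f p) (ΣL-↭ f q)

  ΣL-replicate : ∀ {A : Set} (f : A → ℤ) n z → f z ≡ 0ℤ → ΣL f (replicate n z) ≡ 0ℤ
  ΣL-replicate f zero    z e = refl
  ΣL-replicate f (suc n) z e = cong₂ _+_ e (ΣL-replicate f n z e)

  ΣL-replicate-0≤ : ∀ {A : Set} (f : A → ℤ) n z → 0ℤ ≤ f z → 0ℤ ≤ ΣL f (replicate n z)
  ΣL-replicate-0≤ f zero    z h = ≤-refl
  ΣL-replicate-0≤ f (suc n) z h = h ⊕ ΣL-replicate-0≤ f n z h

  Nw-top : ∀ n x b t → (∀ i → 1 ℕ.≤ i → i ℕ.≤ n → x i ≤ t) → Nw n x b t ≡ Σ n (λ i → b i · 1ℤ)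
  Nw-top n x b t h = Σ-≡ n λ i p q → cong (λ c → b i · (c · 1ℤ)) (≤⇒true (h i p q))

  N-top : ∀ n x t → (∀ i → 1 ℕ.≤ i → i ℕ.≤ n → x i ≤ t) → N n x t ≡ + n
  N-top n x t h = trans (Σ-≡ n λ i p q → cong (_· 1ℤ) (≤⇒true (h i p q))) (Σ-1 n)

  module Main (a d b c : List ℤ)
    (Aa : Anti (length a) (at a)) (Ad : Anti (length d) (at d)) (Ab : Anti (length b) (at b))
        (Ac : Anti (length c) (at c))
    (w≡ : length d ℕ.+ length a ≡ length c ℕ.+ length b)
    (c≢d : ∀ i j → 1 ℕ.≤ i → i ℕ.≤ length c → 1 ℕ.≤ j → j ℕ.≤ length d → at c i ≢ at d j) where

    open Construction a d b c using (stS; stΔ; cSup; dSup)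
    open Process a d b c Ad Ac using (fix-Δ; fix-S)

    m n : ℕ
    m = length d
    n = length c

    inΔ inS outΔ outS : ℕ → Bool
    inΔ i = isIn (stΔ i)
    inS i = isIn (stS i)
    outΔ i = isOut (stΔ i)
    outS i = isOut (stS i)

    d≢c : ∀ i j → 1 ℕ.≤ i → i ℕ.≤ m → 1 ℕ.≤ j → j ℕ.≤ n → at d i ≢ at c j
    d≢c i j p q r t e = c≢d j i r t p q (sym e)

    module SΔ = Side d c a stΔ stS Ad Ac Aa d≢c fix-Δ
    module SS = Side c d b stS stΔ Ac Ad Ab c≢d fix-S
    module KΔ = CondStar d c a inΔ outΔ inS Ad Ac Aa d≢c SΔ.not-inX
    module KS = CondStar c d b inS outS inΔ Ac Ad Ab c≢d SS.not-inX
    module CΔ = KΔ.C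
    module CS = KS.C

    cSup≡ : cSup ≡ KΔ.xs
    cSup≡ = cong (λ l → map (at c) (filterᵇ inS l)) (range-from 1 n)

    dSup≡ : dSup ≡ KS.xs
    dSup≡ = cong (λ l → map (at d) (filterᵇ inΔ l)) (range-from 1 m)

    I⇔ : ConditionI a d b c ≡ KΔ.D.Holds
    I⇔ = cong (λ l → Cond.Holds l d outΔ a (eSeq a d)) cSup≡

    II⇔ : ConditionII a d b c ≡ KS.D.Holds
    II⇔ = cong (λ l → Cond.Holds l c outS b (eSeq b c)) dSup≡

    module Necessary (g : List ℤ) (Ag : Anti (m ℕ.+ length a) (at g)) (G₁ : Maj.GMaj g d a)
        (G₂ : Maj.GMaj g c b) where
      w : ℕ
      w = m ℕ.+ length a
      Ag′ : Anti (n ℕ.+ length b) (at g)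
      Ag′ = subst (λ k → Anti k (at g)) w≡ Ag
      module E₁ = Majorization.Elim g d a (Maj.GMaj.len G₁) Ag Ad Aa G₁
      module E₂ = Majorization.Elim g c b (Maj.GMaj.len G₂) Ag′ Ac Ab G₂
      module NΔ = CΔ.Necessity (λ j p q e → SΔ.in⇒ j p q (isIn⇒inn (stΔ j) e)) w (at g) E₁.Nd≤Ng E₁.bound
      module NS = CS.Necessity (λ j p q e → SS.in⇒ j p q (isIn⇒inn (stS j) e)) (n ℕ.+ length b) (at g)
          E₂.Nd≤Ng E₂.bound
      open Dominated m n w (at d) (at c) (at g) inΔ inS Ad Ac NΔ.forced
        (subst (λ k → ∀ j → Least (λ i → inS i ∧ (at c i ≤ᵇ at c j)) n j →
          CS.Pκ (at c j) ≤ P k (at g) (at c j) → CS.Nκ (at c j) ≤ N k (at g) (at c j)) (sym w≡) NS.forced)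

      bound₁ : ∀ v → CΔ.Pκ v ≤ P m (at d) v + P (length a) (at a) v
      bound₁ v = ≤-trans (dominated v) (≤-trans (E₁.bound v) (ℤP.+-monoʳ-≤ (P m (at d) v)
        (T₊≤P (length a) (at a) (+ length a - N w (at g) v + N m (at d) v) v)))

      bound₂ : ∀ v → CS.Pκ v ≤ P n (at c) v + P (length b) (at b) v
      bound₂ v = ≤-trans (≤-reflexive (ℤP.+-comm (Pw n (at c) inS v) (Pw m (at d) inΔ v)))
        (≤-trans (dominated v) (≤-trans (≤-reflexive (cong (λ k → P k (at g) v) w≡))
            (≤-trans (E₂.bound v) (ℤP.+-monoʳ-≤ (P n (at c) v)
          (T₊≤P (length b) (at b) (+ length b - N (n ℕ.+ length b) (at g) v + N n (at c) v) v)))))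

      necessary : ConditionI a d b c × ConditionII a d b c
      necessary = subst id (sym I⇔) (KΔ.stars⇒holds λ l p q e v r → CΔ.bound⇒star bound₁ l p q e v r)
                , subst id (sym II⇔) (KS.stars⇒holds λ l p q e v r → CS.bound⇒star bound₂ l p q e v r)

    module Sufficient (H₁ : ConditionI a d b c) (H₂ : ConditionII a d b c) where
      module FΔ = CΔ.Sufficiency (λ j p q h h′ → cong isOut (SΔ.early-out j p q h h′))
        (λ j p q e → SΔ.out⇒ j p q (isOut⇒out (stΔ j) e)) (KΔ.holds⇒star (subst id I⇔ H₁))
      module FS = CS.Sufficiency (λ j p q h h′ → cong isOut (SS.early-out j p q h h′))
        (λ j p q e → SS.out⇒ j p q (isOut⇒out (stS j) e)) (KS.holds⇒star (subst id II⇔ H₂))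

      bounds : Σ[ t ∈ ℤ ] (∀ i → 1 ℕ.≤ i → i ℕ.≤ m → at d i ≤ t) × (∀ i → 1 ℕ.≤ i → i ℕ.≤ n → at c i ≤ t)
        × (∀ i → 1 ℕ.≤ i → i ℕ.≤ length a → at a i ≤ t) × (∀ i → 1 ℕ.≤ i → i ℕ.≤ length b → at b i ≤ t)
      bounds with above-all m (at d) 0ℤ
      ... | t₁ , _ , h₁ with above-all n (at c) t₁
      ...   | t₂ , l₂ , h₂ with above-all (length a) (at a) t₂
      ...     | t₃ , l₃ , h₃ with above-all (length b) (at b) t₃
      ...       | t₄ , l₄ , h₄ = t₄ , (λ i p q → ≤-trans (h₁ i p q) (≤-trans l₂ (≤-trans l₃ l₄))) ,
                    (λ i p q → ≤-trans (h₂ i p q) (≤-trans l₃ l₄)) , (λ i p q → ≤-trans (h₃ i p q) l₄) , h₄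

      top : ℤ
      top = proj₁ bounds
      d≤ : ∀ i → 1 ℕ.≤ i → i ℕ.≤ m → at d i ≤ top
      d≤ = proj₁ (proj₂ bounds)
      c≤ : ∀ i → 1 ℕ.≤ i → i ℕ.≤ n → at c i ≤ top
      c≤ = proj₁ (proj₂ (proj₂ bounds))
      a≤ : ∀ i → 1 ℕ.≤ i → i ℕ.≤ length a → at a i ≤ top
      a≤ = proj₁ (proj₂ (proj₂ (proj₂ bounds)))
      b≤ : ∀ i → 1 ℕ.≤ i → i ℕ.≤ length b → at b i ≤ top
      b≤ = proj₂ (proj₂ (proj₂ (proj₂ bounds)))

      w : ℕ
      w = m ℕ.+ length a

      -- κ lists the chosen entries of d and c.
      κ filler g : List ℤ
      κ = sel (at d) inΔ 1 m ++ sel (at c) inS 1 n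
      filler = replicate (w ∸ length κ) top
      g = sort (filler ++ κ)

      ΣL-κ : ∀ (f : ℤ → ℤ) → ΣL f κ ≡ Σ m (λ i → inΔ i · f (at d i)) + Σ n (λ i → inS i · f (at c i))
      ΣL-κ f = trans (ΣL-++ f (sel (at d) inΔ 1 m) (sel (at c) inS 1 n))
        (cong₂ _+_ (ΣL-sel (at d) inΔ f 1 m) (ΣL-sel (at c) inS f 1 n))

      -- The length of κ is its count at `top`, which is `m + used top`; `used≤s` leaves room for
      -- the filler.
      κ≤w : length κ ℕ.≤ w
      κ≤w = ≤+ (≤-trans (≤-reflexive (trans (ΣL-length κ) (trans (ΣL-κ (λ _ → 1ℤ))
          (trans (cong₂ _+_ (sym (Nw-top m (at d) inΔ top d≤)) (sym (Nw-top n (at c) inS top c≤)))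
            (trans (CΔ.Nκ≡ top) (cong (λ t → t + CΔ.used top) (N-top m (at d) top d≤)))))))
        (ℤP.+-monoʳ-≤ (+ m) (FΔ.used≤s top d≤ c≤ a≤)))

      length-g : length g ≡ w
      length-g = trans (↭-length (sort-↭ (filler ++ κ))) (trans (length-++ filler)
        (trans (cong (ℕ._+ length κ) (length-replicate (w ∸ length κ))) (ℕ.m∸n+n≡m κ≤w)))

      Σ-g : ∀ (f : ℤ → ℤ) → Σ w (λ i → f (at g i)) ≡ ΣL f filler + ΣL f κ
      Σ-g f = trans (cong (λ k → Σ k (λ i → f (at g i))) (sym length-g)) (trans (Σ-at f g)
        (trans (ΣL-↭ f (sort-↭ (filler ++ κ))) (ΣL-++ f filler κ)))

      -- Copies of `top` contribute nothing at thresholds up to `top`, the only ones that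
      -- `Majorization.intro` consults.
      Pg : ∀ v → v ≤ top → P w (at g) v ≡ CΔ.Pκ v
      Pg v h = trans (Σ-g (λ z → pos (v - z))) (trans
          (cong₂ _+_ (ΣL-replicate (λ z → pos (v - z)) (w ∸ length κ) top (pos-above h))
              (ΣL-κ (λ z → pos (v - z))))
        (ℤP.+-identityˡ (CΔ.Pκ v)))

      Ng= : ∀ u → 1ℤ + u ≤ top → N w (at g) u ≡ CΔ.Nκ u
      Ng= u h = trans (Σ-g (λ z → (z ≤ᵇ u) · 1ℤ)) (trans
          (cong₂ _+_ (ΣL-replicate (λ z → (z ≤ᵇ u) · 1ℤ) (w ∸ length κ) top (cong (_· 1ℤ) (>⇒false u h)))
              (ΣL-κ (λ z → (z ≤ᵇ u) · 1ℤ)))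
        (ℤP.+-identityˡ (CΔ.Nκ u)))

      Ng≥ : ∀ u → CΔ.Nκ u ≤ N w (at g) u
      Ng≥ u = ≤-trans (≤-trans (≤-reflexive (sym (ℤP.+-identityˡ (CΔ.Nκ u))))
        (ΣL-replicate-0≤ (λ z → (z ≤ᵇ u) · 1ℤ) (w ∸ length κ) top (0≤·1 (top ≤ᵇ u))
            ⊕ ≤-reflexive (sym (ΣL-κ (λ z → (z ≤ᵇ u) · 1ℤ)))))
        (≤-reflexive (sym (Σ-g (λ z → (z ≤ᵇ u) · 1ℤ))))

      g-linked : Linked ℤ._≥_ g
      g-linked = sort-↗ (filler ++ κ)

      Ag : Anti w (at g)
      Ag = subst (λ k → Anti k (at g)) length-g (linked⇒Anti g g-linked)

      g≤ : ∀ i → 1 ℕ.≤ i → i ℕ.≤ w → at g i ≤ top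
      g≤ i p q with at g i ≤or> top
      ... | inj₁ h = h
      ... | inj₂ h = absurd {+ w} {+ w - + i} full (lin (+≤ p) (eq (+ w) (+ i)))
        where
        eq : ∀ w i → w - (1ℤ + (w - i)) ≡ i - 1ℤ
        eq w i = solve (w ∷ i ∷ [])
        full : + w ≤ + w - + i
        full = ≤-trans (≤-reflexive (sym count-top)) (N-high w (at g) Ag i top p q h)
          where
          f : ℤ → ℤ
          f z = (z ≤ᵇ top) · 1ℤ
          filler-top : ∀ k → ΣL f (replicate k top) ≡ ΣL (λ _ → 1ℤ) (replicate k top)
          filler-top zero    = refl
          filler-top (suc k) = cong₂ _+_ (cong (_· 1ℤ) (≤⇒true {top} ≤-refl)) (filler-top k)
          κ-top : ΣL f κ ≡ ΣL (λ _ → 1ℤ) κ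
          κ-top = trans (ΣL-κ f) (trans (cong₂ _+_ (Nw-top m (at d) inΔ top d≤)
              (Nw-top n (at c) inS top c≤)) (sym (ΣL-κ (λ _ → 1ℤ))))
          count-top : N w (at g) top ≡ + w
          count-top = trans (Σ-g f) (trans (cong₂ _+_ (filler-top (w ∸ length κ)) κ-top)
              (trans (sym (Σ-g (λ _ → 1ℤ))) (Σ-1 w)))

      G₁ : Maj.GMaj g d a
      G₁ = Majorization.intro g d a length-g Ag Ad Aa top g≤ d≤ a≤ Nd≤ Q′
        where
        Nd≤ : ∀ u → N m (at d) u ≤ N w (at g) u
        Nd≤ u = ≤-trans (lin (FΔ.0≤used u) (trans (cong (λ t → t - N m (at d) u) (CΔ.Nκ≡ u))
            (eq (N m (at d) u) (CΔ.used u)))) (Ng≥ u)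
          where
          eq : ∀ a b → a + b - a ≡ b - 0ℤ
          eq a b = solve (a ∷ b ∷ [])
        Q′ : ∀ u v → v ≡ 1ℤ + u → v ≤ top → P w (at g) v
            ≤ P m (at d) v + T₊ (length a) (at a) (+ length a - N w (at g) u + N m (at d) u) v
        -- `advance` leaves q at its value for `u`, the form that `Majorization.intro` asks for;
        -- `u < top` lets `Ng=` identify the counts of `g` and κ.
        Q′ u v refl v≤ = ≤-trans (≤-reflexive (trans (Pg v v≤) (CΔ.Pκ≡ v))) (ℤP.+-monoʳ-≤ (P m (at d) v)
          (≤-trans (FΔ.advance u (FΔ.feasible u)) (≤-reflexive (cong (λ t → T₊ (length a) (at a) t v)
            (trans (eq (+ length a) (CΔ.used u) (N m (at d) u))
                (cong (λ t → + length a - t + N m (at d) u) (sym (trans (Ng= u v≤) (CΔ.Nκ≡ u)))))))))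
          where
          eq : ∀ s b n → s - b ≡ s - (n + b) + n
          eq s b n = solve (s ∷ b ∷ n ∷ [])

      G₂ : Maj.GMaj g c b
      G₂ = Majorization.intro g c b (trans length-g w≡) (subst (λ k → Anti k (at g)) w≡ Ag) Ac Ab top
        (subst (λ k → ∀ i → 1 ℕ.≤ i → i ℕ.≤ k → at g i ≤ top) w≡ g≤) c≤ b≤
        (subst (λ k → ∀ u → N n (at c) u ≤ N k (at g) u) w≡ Nc≤)
        (subst (λ k → ∀ u v → v ≡ 1ℤ + u → v ≤ top → P k (at g) v
            ≤ P n (at c) v + T₊ (length b) (at b) (+ length b - N k (at g) u + N n (at c) u) v) w≡ Q′)
        where
        Nκ≡′ : ∀ u → CΔ.Nκ u ≡ N n (at c) u + CS.used u
        Nκ≡′ u = trans (ℤP.+-comm (Nw m (at d) inΔ u) (Nw n (at c) inS u)) (CS.Nκ≡ u)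
        Pκ≡′ : ∀ v → CΔ.Pκ v ≡ P n (at c) v + CS.U v
        Pκ≡′ v = trans (ℤP.+-comm (Pw m (at d) inΔ v) (Pw n (at c) inS v)) (CS.Pκ≡ v)
        Nc≤ : ∀ u → N n (at c) u ≤ N w (at g) u
        Nc≤ u = ≤-trans (lin (FS.0≤used u) (trans (cong (λ t → t - N n (at c) u) (Nκ≡′ u))
            (eq (N n (at c) u) (CS.used u)))) (Ng≥ u)
          where
          eq : ∀ a b → a + b - a ≡ b - 0ℤ
          eq a b = solve (a ∷ b ∷ [])
        Q′ : ∀ u v → v ≡ 1ℤ + u → v ≤ top → P w (at g) v
            ≤ P n (at c) v + T₊ (length b) (at b) (+ length b - N w (at g) u + N n (at c) u) v
        Q′ u v refl v≤ = ≤-trans (≤-reflexive (trans (Pg v v≤) (Pκ≡′ v))) (ℤP.+-monoʳ-≤ (P n (at c) v)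
          (≤-trans (FS.advance u (FS.feasible u)) (≤-reflexive (cong (λ t → T₊ (length b) (at b) t v)
            (trans (eq (+ length b) (CS.used u) (N n (at c) u))
                (cong (λ t → + length b - t + N n (at c) u) (sym (trans (Ng= u v≤) (Nκ≡′ u)))))))))
          where
          eq : ∀ s b n → s - b ≡ s - (n + b) + n
          eq s b n = solve (s ∷ b ∷ n ∷ [])

  -- From lists to vectors

  at-lookup : ∀ {n} (v : Vec ℤ n) i → 1 ℕ.≤ i → i ℕ.≤ length (toList v) → Σ[ f ∈ Fin n ] at (toList v) i
      ≡ lookup v f
  at-lookup (z Vec.∷ v) (suc zero)    p q = Fin.zero , refl
  at-lookup (z Vec.∷ v) (suc (suc i)) p (s≤s q) with at-lookup v (suc i) (s≤s z≤n) q
  ... | f , e = Fin.suc f , e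

  at-distinct : ∀ {m n} (c : Vec ℤ n) (d : Vec ℤ m) → (∀ i j → lookup c i ≢ lookup d j) →
    ∀ i j → 1 ℕ.≤ i → i ℕ.≤ length (toList c) → 1 ℕ.≤ j → j ℕ.≤ length (toList d) →
        at (toList c) i ≢ at (toList d) j
  at-distinct c d c≢d i j p q r t e with at-lookup c i p q | at-lookup d j r t
  ... | f , ef | f′ , ef′ = c≢d f f′ (trans (sym ef) (trans e ef′))

  module Vectors {m n s k : ℕ} (w≡ : m ℕ.+ s ≡ n ℕ.+ k) (a : Vec ℤ s) (d : Vec ℤ m) (b : Vec ℤ k)
      (c : Vec ℤ n)
    (pa : IsPartition a) (pd : IsPartition d) (pb : IsPartition b) (pc : IsPartition c)
    (c≢d : ∀ (i : Fin n) (j : Fin m) → lookup c i ≢ lookup d j) where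

    lengths : length (toList d) ℕ.+ length (toList a) ≡ m ℕ.+ s
    lengths = cong₂ ℕ._+_ (length-toList d) (length-toList a)

    open Main (toList a) (toList d) (toList b) (toList c)
      (linked⇒Anti (toList a) pa) (linked⇒Anti (toList d) pd) (linked⇒Anti (toList b) pb)
          (linked⇒Anti (toList c) pc)
      (trans lengths (trans w≡ (sym (cong₂ ℕ._+_ (length-toList c) (length-toList b))))) (at-distinct c d c≢d)
      using (module Necessary; module Sufficient)

    ConditionsI∧II Solution : Set
    ConditionsI∧II = ConditionI (toList a) (toList d) (toList b) (toList c) × ConditionII (toList a)
        (toList d) (toList b) (toList c)
    Solution = ∃[ g ] (IsPartition {m ℕ.+ s} g × g ≺″ (d , a) × g ≺″ (c , b))

    solution⇒conditions : Solution → ConditionsI∧II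
    solution⇒conditions (g , pg , G₁ , G₂) = Necessary.necessary (toList g)
      (subst (λ k → Anti k (at (toList g))) (Maj.GMaj.len G₁) (linked⇒Anti (toList g) pg)) G₁ G₂

    conditions⇒solution : ConditionsI∧II → Solution
    conditions⇒solution (H₁ , H₂) = gᵛ , subst (Linked ℤ._≥_) (sym toList-g) g-linked
      , subst (λ l → Maj.GMaj l (toList d) (toList a)) (sym toList-g) G₁
      , subst (λ l → Maj.GMaj l (toList c) (toList b)) (sym toList-g) G₂
      where
      open Sufficient H₁ H₂
      gᵛ : Vec ℤ (m ℕ.+ s)
      gᵛ = Vec.cast (trans length-g lengths) (Vec.fromList g)
      toList-g : toList gᵛ ≡ g
      toList-g = trans (toList-cast (trans length-g lengths) (Vec.fromList g)) (toList∘fromList g)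

open import Defs
open import Data.Nat using (ℕ; _+_; _<_)
open import Data.Integer using (ℤ)
open import Data.Vec using (Vec; lookup; toList)
open import Data.Fin using (Fin)
open import Data.Product using (_×_; _,_; ∃-syntax)
open import Relation.Binary.PropositionalEquality using (_≡_; _≢_)
open import Function.Bundles using (_⇔_; mk⇔)

theorem4p1 : (m n s k : ℕ) → 0 < m → 0 < n → 0 < s → 0 < k → m + s ≡ n + k →
    (a : Vec ℤ s) (d : Vec ℤ m) (b : Vec ℤ k) (c : Vec ℤ n) →
    IsPartition a → IsPartition d → IsPartition b → IsPartition c →
    (∀ (i : Fin n) (j : Fin m) → lookup c i ≢ lookup d j) →
    (∃[ g ] (IsPartition {m + s} g × g ≺″ (d , a) × g ≺″ (c , b)))
    ⇔ (ConditionI (toList a) (toList d) (toList b) (toList c)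
    × ConditionII (toList a) (toList d) (toList b) (toList c))
theorem4p1 m n s k _ _ _ _ m+s≡n+k a d b c pa pd pb pc c≢d =
  mk⇔ solution⇒conditions conditions⇒solution
  where open Greedy.Vectors m+s≡n+k a d b c pa pd pb pc c≢d
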